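{- Every $\mathrm{L}_2$-convex polyhedron $P\subseteq\mathbb{R}^n$ is a box-TDI polyhedron. More generally, every $\mathrm{L}^\natural_2$-convex polyhedron $P\subseteq\mathbb{R}^n$ is a box-TDI polyhedron.
   Context: $x\vee y$, $x\wedge y$ denote componentwise maximum and minimum, $\mathbf{1}=(1,\ldots,1)$. A polyhedron $P\subseteq\mathbb{R}^n$ is L-convex if $x,y\in P$ implies $x\vee y,\ x\wedge y\in P$, and $x\in P,\ \mu\in\mathbb{R}$ implies $x+\mu\mathbf{1}\in P$. A polyhedron $P\subseteq\mathbb{R}^n$ is $\mathrm{L}^\natural$-convex if $P=\{x\in\mathbb{R}^n\mid(x,0)\in Q\}$ for some L-convex polyhedron $Q\subseteq\mathbb{R}^{n+1}$. A polyhedron $P\subseteq\mathbb{R}^n$ is $\mathrm{L}_2$-convex (resp. $\mathrm{L}^\natural_2$-convex) if it is the Minkowski sum of two L-convex (resp. $\mathrm{L}^\natural$-convex) polyhedra. A linear inequality system $Ax\le b$ is totally dual integral (TDI) if the entries of $A$ and $b$ are rational numbers and the minimum in the linear programming duality equation $\max\{c^\top x\mid Ax\le b\}=\min\{y^\top b\mid y^\top A=c^\top,\ y\ge0\}$ has an integral optimal solution $y$ for every integral vector $c$ such that the minimum is finite. The system $Ax\le b$ is box-totally dual integral (box-TDI) if the system $[Ax\le b,\ d\le x\le c]$ is TDI for each choice of rational (finite-valued) vectors $c$ and $d$. A polyhedron is called a box-TDI polyhedron if it can be described by a box-TDI system.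
   Formalization: The polyhedron P is additionally assumed rational (describable by a system with rational A and b), since e.g. {x in R^2 | x1 - x2 <= sqrt 2} is L_2-convex but no TDI system, whose data must be rational, describes it. -}

module Defs where

open import Algebra.Bundles using (CommutativeRing)
open import Algebra.Structures using (IsCommutativeRing)
import Algebra.Construct.NaturalChoice.Max as NaturalMax
import Algebra.Construct.NaturalChoice.Min as NaturalMin
import Algebra.Definitions.RawMonoid as RawMonoidDefs
open import Data.Bool.Base using (if_then_else_)
open import Data.Fin.Base using (Fin)
import Data.Fin.Properties as Fin
open import Data.Integer.Base as ℤ using (ℤ; +_; -[1+_])
open import Data.Nat.Base as ℕ using (ℕ; suc)
open import Data.Product.Base using (_×_; ∃; ∃₂; ∃-syntax)
open import Data.Rational.Base as ℚ using (ℚ; 0ℚ; 1ℚ)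
open import Data.Vec.Functional as Vector using (Vector; _∷_; []; _++_)
open import Level using (0ℓ)
open import Relation.Binary.Bundles using (DecTotalOrder)
open import Relation.Binary.Core using (Rel)
open import Relation.Binary.Structures using (IsDecTotalOrder)
open import Relation.Nullary.Decidable.Core using (does)
open import Relation.Nullary.Negation.Core using (¬_)
open import Relation.Unary using (Pred; _≐_)

-- The field of real numbers, characterised (classically, up to isomorphism) as
-- a Dedekind-complete linearly ordered field.  The order is decidable, as it is
-- classically.  The inverse is total; its value at 0# is unconstrained.
record Reals : Set₁ where
  infix  4 _≈_ _≤_
  infixl 6 _+_
  infixl 7 _*_
  infix  8 -_
  infix  9 _⁻¹
  field
    Carrier           : Set
    _≈_ _≤_           : Rel Carrier 0ℓ
    _+_ _*_           : Carrier → Carrier → Carrier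
    -_ _⁻¹            : Carrier → Carrier
    0# 1#             : Carrier
    isCommutativeRing : IsCommutativeRing _≈_ _+_ _*_ -_ 0# 1#
    isDecTotalOrder   : IsDecTotalOrder _≈_ _≤_
    0≉1               : ¬ (0# ≈ 1#)
    *-inverseʳ        : ∀ x → ¬ (x ≈ 0#) → x * x ⁻¹ ≈ 1#
    +-monoʳ-≤         : ∀ z {x y} → x ≤ y → z + x ≤ z + y
    *-nonNeg          : ∀ {x y} → 0# ≤ x → 0# ≤ y → 0# ≤ x * y
    supremum          : (S : Pred Carrier 0ℓ) → ∃ S →
                        (∃[ u ] (∀ x → S x → x ≤ u)) →
                        ∃[ s ] (∀ x → S x → x ≤ s) ×
                               (∀ u → (∀ x → S x → x ≤ u) → s ≤ u)

  commutativeRing : CommutativeRing 0ℓ 0ℓ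
  commutativeRing = record { isCommutativeRing = isCommutativeRing }

  decTotalOrder : DecTotalOrder 0ℓ 0ℓ 0ℓ
  decTotalOrder = record { isDecTotalOrder = isDecTotalOrder }

  open NaturalMax (DecTotalOrder.totalOrder decTotalOrder) public using (_⊔_)
  open NaturalMin (DecTotalOrder.totalOrder decTotalOrder) public using (_⊓_)
  open RawMonoidDefs (CommutativeRing.+-rawMonoid commutativeRing) public
    using (sum) renaming (_×_ to _·ℕ_)

  fromℤ : ℤ → Carrier
  fromℤ (+ n)    = n ·ℕ 1#
  fromℤ -[1+ n ] = - (suc n ·ℕ 1#)

  fromℚ : ℚ → Carrier
  fromℚ q = fromℤ (ℚ.numerator q) * fromℤ (ℚ.denominator q) ⁻¹

module _ (ℝ : Reals) where
  open Reals ℝ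

  infix 7 _∙_
  _∙_ : ∀ {n} → Vector Carrier n → Vector Carrier n → Carrier
  u ∙ v = sum (λ i → u i * v i)

  Solutions : ∀ {m n} → Vector (Vector Carrier n) m → Vector Carrier m →
              Pred (Vector Carrier n) 0ℓ
  Solutions A b x = ∀ i → A i ∙ x ≤ b i

  matℚ : ∀ {m n} → Vector (Vector ℚ n) m → Vector (Vector Carrier n) m
  matℚ A i j = fromℚ (A i j)

  vecℚ : ∀ {n} → Vector ℚ n → Vector Carrier n
  vecℚ b i = fromℚ (b i)

  vecℤ : ∀ {n} → Vector ℤ n → Vector Carrier n
  vecℤ c i = fromℤ (c i)

  IsPolyhedron : ∀ {n} → Pred (Vector Carrier n) 0ℓ → Set
  IsPolyhedron {n} P =
    ∃[ m ] ∃₂ λ (A : Vector (Vector Carrier n) m) b → P ≐ Solutions A b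

  -- A TDI system has rational data, so only rational polyhedra can be box-TDI:
  -- { x | x₀ - x₁ ≤ √2 } is L-convex and is described by no rational system.
  IsRationalPolyhedron : ∀ {n} → Pred (Vector Carrier n) 0ℓ → Set
  IsRationalPolyhedron {n} P =
    ∃[ m ] ∃₂ λ (A : Vector (Vector ℚ n) m) b → P ≐ Solutions (matℚ A) (vecℚ b)

  record IsLConvex {n} (P : Pred (Vector Carrier n) 0ℓ) : Set where
    field
      isPolyhedron : IsPolyhedron P
      ∨-closed     : ∀ {x y} → P x → P y → P (λ i → x i ⊔ y i)
      ∧-closed     : ∀ {x y} → P x → P y → P (λ i → x i ⊓ y i)
      +𝟏-closed    : ∀ {x} → P x → ∀ μ → P (λ i → x i + μ)

  IsL♮Convex : ∀ {n} → Pred (Vector Carrier n) 0ℓ → Set₁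
  IsL♮Convex {n} P =
    IsPolyhedron P ×
    (∃[ Q ] IsLConvex {n ℕ.+ 1} Q × P ≐ λ x → Q (x ++ (0# ∷ [])))

  infixl 6 _⊕_
  _⊕_ : ∀ {n} → Pred (Vector Carrier n) 0ℓ → Pred (Vector Carrier n) 0ℓ →
        Pred (Vector Carrier n) 0ℓ
  (P ⊕ Q) z = ∃₂ λ x y → P x × Q y × (∀ i → z i ≈ x i + y i)

  IsL₂Convex : ∀ {n} → Pred (Vector Carrier n) 0ℓ → Set₁
  IsL₂Convex P =
    IsPolyhedron P × ∃₂ λ P₁ P₂ → IsLConvex P₁ × IsLConvex P₂ × P ≐ P₁ ⊕ P₂

  IsL♮₂Convex : ∀ {n} → Pred (Vector Carrier n) 0ℓ → Set₁
  IsL♮₂Convex P =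
    IsPolyhedron P × ∃₂ λ P₁ P₂ → IsL♮Convex P₁ × IsL♮Convex P₂ × P ≐ P₁ ⊕ P₂

  record DualFeasible {m n} (A : Vector (Vector Carrier n) m)
                      (c : Vector Carrier n) (y : Vector Carrier m) : Set where
    field
      yA≈c : ∀ j → y ∙ (λ i → A i j) ≈ c j
      y≥0  : ∀ i → 0# ≤ y i

  record DualOptimal {m n} (A : Vector (Vector Carrier n) m)
                     (b : Vector Carrier m) (c : Vector Carrier n)
                     (y : Vector Carrier m) : Set where
    field
      feasible : DualFeasible A c y
      minimal  : ∀ y′ → DualFeasible A c y′ → y ∙ b ≤ y′ ∙ b

  -- Finiteness of the minimum is expressed as the existence of an optimal
  -- real solution y.
  IsTDI : ∀ {m n} → Vector (Vector ℚ n) m → Vector ℚ m → Set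
  IsTDI {m} {n} A b =
    (c : Vector ℤ n) →
    (∃[ y ] DualOptimal (matℚ A) (vecℚ b) (vecℤ c) y) →
    ∃[ z ] DualOptimal (matℚ A) (vecℚ b) (vecℤ c) (vecℤ {m} z)

  identity : ∀ n → Vector (Vector ℚ n) n
  identity n i j = if does (i Fin.≟ j) then 1ℚ else 0ℚ

  -- The system [ A x ≤ b , d ≤ x ≤ c ] is written as
  -- A x ≤ b, (- I) x ≤ - d, I x ≤ c.
  IsBoxTDI : ∀ {m n} → Vector (Vector ℚ n) m → Vector ℚ m → Set
  IsBoxTDI {m} {n} A b =
    (c d : Vector ℚ n) →
    IsTDI (A ++ ((λ i j → ℚ.- identity n i j) ++ identity n))
          (b ++ ((λ i → ℚ.- d i) ++ c))

  IsBoxTDIPolyhedron : ∀ {n} → Pred (Vector Carrier n) 0ℓ → Set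
  IsBoxTDIPolyhedron {n} P =
    ∃[ m ] ∃₂ λ (A : Vector (Vector ℚ n) m) b →
      P ≐ Solutions (matℚ A) (vecℚ b) × IsBoxTDI A b

{-# OPTIONS --safe #-}

-- The system of all inequalities a·x ≤ max { a·y | y ∈ P } with a an integer vector of bounded
-- size has the property that every integer vector normal to P at some point is a nonnegative
-- integer combination of the rows tight there.  Hence P is box-TDI once every integer w that
-- is maximized over P ∩ [lo, hi] at x can be written as p + u − v with p integer and normal to P
-- at x and with u, v ≥ 0 integer and supported on the tight box constraints.
--
-- For P = P₁ + P₂ with L-convex summands, the pairs (s, −t) with s ∈ P₁, t ∈ P₂ and
-- lo ≤ s + t ≤ hi form an intersection of two L-convex sets: P₁ × (−P₂), and the bounds on
-- the differences sᵢ − (−t)ᵢ.  The vector (w, −w) is normal to this intersection, and an integer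
-- normal vector of an intersection of L-convex sets is a sum of integer normal vectors: it is
-- the boundary of an integer flow on the arcs i → j whose difference xᵢ − xⱼ is maximal.
module Submission where

open import Defs
open import Algebra.Bundles using (CommutativeRing)
import Algebra.Construct.NaturalChoice.Max as NaturalMax
import Algebra.Construct.NaturalChoice.Min as NaturalMin
import Algebra.Properties.AbelianGroup as AbelianGroupProperties
import Algebra.Properties.Ring as RingProperties
import Algebra.Properties.Semiring.Mult as SemiringMult
import Algebra.Properties.Semiring.Sum as SemiringSum
import Algebra.Solver.Ring as RingSolver
open import Algebra.Solver.Ring.AlmostCommutativeRing
  using (fromCommutativeRing; _-Raw-AlmostCommutative⟶_)
open import Data.Bool.Base using (Bool; true; false; not; _∧_; _∨_; if_then_else_)
import Data.Bool.Properties as Bool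
open import Data.Empty using (⊥; ⊥-elim)
open import Data.Fin.Base using (Fin; zero; suc; _↑ˡ_; _↑ʳ_; splitAt)
import Data.Fin.Properties as Fin
open import Data.Integer.Base as ℤ using (ℤ; +_; -[1+_]; _⊖_; 0ℤ; 1ℤ)
open import Data.Integer.GCD using (gcd)
import Data.Integer.Properties as ℤ
open import Data.Integer.Tactic.RingSolver using (solve-∀)
open import Data.List.Base as List using (List)
open import Data.List.Membership.Propositional using (_∈_; find; lose)
open import Data.List.Membership.Propositional.Properties
  using (∈-map⁺; ∈-map⁻; ∈-++⁺ˡ; ∈-++⁺ʳ; ∈-++⁻; ∈-filter⁺; ∈-allFin; ∈-upTo⁺;
         ∈-cartesianProduct⁺; ∈-cartesianProductWith⁺; ∈-cartesianProductWith⁻)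
open import Data.List.Relation.Unary.All as All using (All)
import Data.List.Relation.Unary.All.Properties as All
open import Data.List.Relation.Unary.Any using (here; there; any?; index)
open import Data.List.Relation.Unary.Any.Properties using (lookup-index)
open import Data.Maybe.Base using (Maybe; just; nothing)
open import Data.Nat.Base as ℕ using (ℕ; zero; suc; _/_; _%_)
import Data.Nat.DivMod as ℕ
import Data.Nat.Properties as ℕ
open import Data.Product.Base using (_×_; _,_; proj₁; proj₂; ∃; ∃₂; ∃-syntax)
open import Data.Rational.Base as ℚ using (ℚ)
import Data.Rational.Properties as ℚ
open import Data.Sum.Base using (_⊎_; inj₁; inj₂)
open import Data.Unit.Base using (⊤; tt)
open import Data.Vec.Base as Vec using (Vec; lookup)
import Data.Vec.Properties as Vec
open import Data.Vec.Functional as Vector using (Vector)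
import Data.Vec.Functional.Properties as Vector
open import Level using (0ℓ)
open import Relation.Binary.Bundles using (DecTotalOrder)
open import Relation.Binary.PropositionalEquality as ≡ using (_≡_; _≢_)
import Relation.Binary.Reasoning.Setoid as SetoidReasoning
open import Relation.Nullary using (¬_; Dec; yes; no; ¬?; _×-dec_; _⊎-dec_; _→-dec_)
open import Relation.Unary using (Pred; Decidable; _≐_)

-- Only P is assumed rational. The summands need not be: translating one of them by an irrational
-- vector and the other one back leaves the sum unchanged. So integrality cannot be drawn from
-- inequality descriptions of P₁ and P₂. It comes from the tight differences, whose normals e_i -
-- e_j are integral whatever the bounds are, and from the integrality of flows. Tightness quantifies
-- over an arbitrary predicate on real vectors. Dedekind completeness decides such negated
-- statements; the points that witness the failure of tightness exist only under double negation,
-- which is removed as soon as an inequality has been reached. Linear programming is done by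
-- elimination with natural multipliers and an explicit common denominator. These certificates turn
-- into integral dual solutions once their fractional parts have been absorbed by the additional
-- rows.

module ℤΣ = SemiringSum (CommutativeRing.semiring ℤ.+-*-commutativeRing)

-- Arithmetic and order of the reals, with the embeddings of ℤ and ℚ

module OrderedField (ℝ : Reals) where
  open Reals ℝ public
  open CommutativeRing commutativeRing public
    using (refl; sym; trans; reflexive; setoid; _-_; +-cong; +-congˡ; +-congʳ; *-congˡ; *-congʳ; -‿cong;
           +-comm; +-assoc; +-identityˡ; +-identityʳ; -‿inverseˡ; -‿inverseʳ;
           *-comm; *-assoc; *-identityˡ; *-identityʳ; zeroˡ; zeroʳ; distribˡ; distribʳ)
  open DecTotalOrder decTotalOrder public
    using (_≤?_; antisym; total; ≤-respˡ-≈; ≤-respʳ-≈)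
    renaming (refl to ≤-refl; trans to ≤-trans; reflexive to ≤-reflexive)
  open NaturalMax (DecTotalOrder.totalOrder decTotalOrder) public
    using (⊔-lub; x≤x⊔y; x≤y⊔x)
  open NaturalMin (DecTotalOrder.totalOrder decTotalOrder) public
    using (⊓-glb; x⊓y≤x; x⊓y≤y)
  open RingProperties (CommutativeRing.ring commutativeRing) public
    using (-‿distribˡ-*; -‿distribʳ-*; -0#≈0#; -‿involutive)
  open AbelianGroupProperties (CommutativeRing.+-abelianGroup commutativeRing) public
    using () renaming (⁻¹-∙-comm to -‿+-comm)
  open SemiringMult (CommutativeRing.semiring commutativeRing) public
    using (×-homo-+; ×1-homo-*)
  open SemiringSum (CommutativeRing.semiring commutativeRing) public
    using (sum-cong-≋; ∑-distrib-+; ∑-comm; *-distribˡ-sum; *-distribʳ-sum; sum-replicate-zero)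

  module ≈R = SetoidReasoning setoid

  fromℕ : ℕ → Carrier
  fromℕ n = fromℤ (+ n)

  fromℤ-⊖ : ∀ m n → fromℤ (m ⊖ n) ≈ fromℕ m - fromℕ n
  fromℤ-⊖ zero    zero    = sym (-‿inverseʳ 0#)
  fromℤ-⊖ zero    (suc n) = sym (+-identityˡ _)
  fromℤ-⊖ (suc m) zero    = sym (trans (+-congˡ -0#≈0#) (+-identityʳ _))
  fromℤ-⊖ (suc m) (suc n) = begin
    fromℤ (suc m ⊖ suc n)                      ≡⟨ ≡.cong fromℤ (ℤ.[1+m]⊖[1+n]≡m⊖n m n) ⟩
    fromℤ (m ⊖ n)                              ≈⟨ fromℤ-⊖ m n ⟩
    fromℕ m - fromℕ n                          ≈⟨ +-congʳ (sym (trans (+-congʳ (-‿inverseʳ 1#))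
        (+-identityˡ _))) ⟩
    ((1# - 1#) + fromℕ m) - fromℕ n            ≈⟨ +-congʳ (trans (+-assoc _ _ _)
        (trans (+-congˡ (+-comm _ _)) (sym (+-assoc _ _ _)))) ⟩
    ((1# + fromℕ m) + - 1#) - fromℕ n          ≈⟨ +-assoc _ _ _ ⟩
    (1# + fromℕ m) + (- 1# - fromℕ n)          ≈⟨ +-congˡ (-‿+-comm 1# (fromℕ n)) ⟩
    (1# + fromℕ m) - (1# + fromℕ n)            ∎
    where open ≈R

  fromℤ-+ : ∀ i j → fromℤ (i ℤ.+ j) ≈ fromℤ i + fromℤ j
  fromℤ-+ (+ m)    (+ n)    = ×-homo-+ 1# m n
  fromℤ-+ (+ m)    -[1+ n ] = fromℤ-⊖ m (suc n)
  fromℤ-+ -[1+ m ] (+ n)    = trans (fromℤ-⊖ n (suc m)) (+-comm _ _)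
  fromℤ-+ -[1+ m ] -[1+ n ] = begin
    - fromℕ (suc (suc (m ℕ.+ n)))              ≡⟨ ≡.cong (λ k → - fromℕ (suc k)) (≡.sym (ℕ.+-suc m n)) ⟩
    - fromℕ (suc m ℕ.+ suc n)                  ≈⟨ -‿cong (×-homo-+ 1# (suc m) (suc n)) ⟩
    - (fromℕ (suc m) + fromℕ (suc n))          ≈⟨ sym (-‿+-comm _ _) ⟩
    - fromℕ (suc m) - fromℕ (suc n)            ∎
    where open ≈R

  fromℤ-neg : ∀ i → fromℤ (ℤ.- i) ≈ - fromℤ i
  fromℤ-neg (+ zero)  = sym -0#≈0#
  fromℤ-neg (+ suc n) = refl
  fromℤ-neg -[1+ n ]  = sym (-‿involutive _)

  fromℕ-*ℤ : ∀ m j → fromℤ (+ m ℤ.* j) ≈ fromℕ m * fromℤ j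
  fromℕ-*ℤ m (+ n) = trans (reflexive (≡.cong fromℤ (≡.sym (ℤ.pos-* m n)))) (×1-homo-* m n)
  fromℕ-*ℤ m -[1+ n ] = begin
    fromℤ (+ m ℤ.* -[1+ n ])          ≡⟨ ≡.cong fromℤ (≡.sym (ℤ.neg-distribʳ-* (+ m) (+ suc n))) ⟩
    fromℤ (ℤ.- (+ m ℤ.* + suc n))     ≈⟨ fromℤ-neg (+ m ℤ.* + suc n) ⟩
    - fromℤ (+ m ℤ.* + suc n)         ≈⟨ -‿cong (fromℕ-*ℤ m (+ suc n)) ⟩
    - (fromℕ m * fromℕ (suc n))       ≈⟨ -‿distribʳ-* _ _ ⟩
    fromℕ m * - fromℕ (suc n)         ∎
    where open ≈R

  fromℤ-* : ∀ i j → fromℤ (i ℤ.* j) ≈ fromℤ i * fromℤ j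
  fromℤ-* (+ m)    j = fromℕ-*ℤ m j
  fromℤ-* -[1+ m ] j = begin
    fromℤ (-[1+ m ] ℤ.* j)         ≡⟨ ≡.cong fromℤ (≡.sym (ℤ.neg-distribˡ-* (+ suc m) j)) ⟩
    fromℤ (ℤ.- (+ suc m ℤ.* j))    ≈⟨ fromℤ-neg (+ suc m ℤ.* j) ⟩
    - fromℤ (+ suc m ℤ.* j)        ≈⟨ -‿cong (fromℕ-*ℤ (suc m) j) ⟩
    - (fromℕ (suc m) * fromℤ j)    ≈⟨ -‿distribˡ-* _ _ ⟩
    - fromℕ (suc m) * fromℤ j      ∎
    where open ≈R

  -- `fromℤ 1ℤ` unfolds to `1# + 0#`. The ring solver below reads the constant 1 as `fromℤ 1ℤ`,
  -- hence the conversions wherever `1#` itself occurs.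
  fromℤ-1 : fromℤ 1ℤ ≈ 1#
  fromℤ-1 = +-identityʳ 1#

  -- Gives the ring solver integer coefficients, whose equality test computes, unlike that of
  -- `Carrier`.
  fromℤ-morphism : CommutativeRing.rawRing ℤ.+-*-commutativeRing
                   -Raw-AlmostCommutative⟶ fromCommutativeRing commutativeRing
  fromℤ-morphism = record
    { ⟦_⟧    = fromℤ
    ; +-homo = fromℤ-+
    ; *-homo = fromℤ-*
    ; -‿homo = fromℤ-neg
    ; 0-homo = refl
    ; 1-homo = fromℤ-1
    }

  fromℤ-cong? : ∀ i j → Maybe (fromℤ i ≈ fromℤ j)
  fromℤ-cong? i j with i ℤ.≟ j
  ... | yes ≡.refl = just refl
  ... | no _       = nothing

  module Solver = RingSolver (CommutativeRing.rawRing ℤ.+-*-commutativeRing)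
    (fromCommutativeRing commutativeRing) fromℤ-morphism fromℤ-cong?
  open Solver public using (solve; _:=_; _:+_; _:*_; _:-_; :-_; con)

  x+[y-x]≈y : ∀ x y → x + (y - x) ≈ y
  x+[y-x]≈y = solve 2 (λ x y → x :+ (y :- x) := y) refl

  infix 4 _<_
  _<_ : Carrier → Carrier → Set
  x < y = ¬ (y ≤ x)

  <⇒≤ : ∀ {x y} → x < y → x ≤ y
  <⇒≤ {x} {y} x<y with total x y
  ... | inj₁ x≤y = x≤y
  ... | inj₂ y≤x = ⊥-elim (x<y y≤x)

  ≤∨> : ∀ x y → x ≤ y ⊎ y < x
  ≤∨> x y with x ≤? y
  ... | yes p = inj₁ p
  ... | no ¬p = inj₂ ¬p

  ≤-stable : ∀ {x y} → ¬ ¬ (x ≤ y) → x ≤ y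
  ≤-stable {x} {y} ¬¬p with x ≤? y
  ... | yes p = p
  ... | no ¬p = ⊥-elim (¬¬p ¬p)

  <-≤-trans : ∀ {x y z} → x < y → y ≤ z → x < z
  <-≤-trans x<y y≤z z≤x = x<y (≤-trans y≤z z≤x)

  ≤-resp-≈ : ∀ {x y x′ y′} → x ≈ x′ → y ≈ y′ → x ≤ y → x′ ≤ y′
  ≤-resp-≈ p q r = ≤-respʳ-≈ q (≤-respˡ-≈ p r)

  +-mono-≤ : ∀ {x y u v} → x ≤ y → u ≤ v → x + u ≤ y + v
  +-mono-≤ {x} {y} {u} {v} p q =
    ≤-trans (+-monoʳ-≤ x q) (≤-resp-≈ (+-comm v x) (+-comm v y) (+-monoʳ-≤ v p))

  diff-nonNeg : ∀ {x y} → x ≤ y → 0# ≤ y - x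
  diff-nonNeg {x} {y} p = ≤-resp-≈ (-‿inverseˡ x) (+-comm (- x) y) (+-monoʳ-≤ (- x) p)

  -- Linear inequalities reduce to ring identities between differences.
  ≤-from-diff : ∀ {x y e} → 0# ≤ e → y - x ≈ e → x ≤ y
  ≤-from-diff {x} {y} {e} p q =
    ≤-resp-≈ (+-identityʳ x)
             (x+[y-x]≈y x y)
             (+-monoʳ-≤ x (≤-respʳ-≈ (sym q) p))

  neg-mono-≤ : ∀ {x y} → x ≤ y → - y ≤ - x
  neg-mono-≤ {x} {y} p = ≤-from-diff (diff-nonNeg p)
    (solve 2 (λ x y → (:- x) :- (:- y) := y :- x) refl x y)

  +-nonNeg : ∀ {x y} → 0# ≤ x → 0# ≤ y → 0# ≤ x + y
  +-nonNeg p q = ≤-respˡ-≈ (+-identityʳ 0#) (+-mono-≤ p q)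

  *-monoˡ-≤ : ∀ {z x y} → 0# ≤ z → x ≤ y → z * x ≤ z * y
  *-monoˡ-≤ {z} {x} {y} p q = ≤-from-diff (*-nonNeg p (diff-nonNeg q))
    (solve 3 (λ x y z → z :* y :- z :* x := z :* (y :- x)) refl x y z)

  0≤1 : 0# ≤ 1#
  0≤1 with total 0# 1#
  ... | inj₁ p = p
  ... | inj₂ p = ≤-respʳ-≈ (trans (solve 0 (:- con 1ℤ :* :- con 1ℤ := con 1ℤ) refl) fromℤ-1)
      (*-nonNeg q q)
    where
    q : 0# ≤ - fromℤ 1ℤ
    q = ≤-resp-≈ -0#≈0# (-‿cong (sym fromℤ-1)) (neg-mono-≤ p)

  0<1 : 0# < 1#
  0<1 1≤0 = 0≉1 (antisym 0≤1 1≤0)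

  fromℕ-nonNeg : ∀ n → 0# ≤ fromℕ n
  fromℕ-nonNeg zero    = ≤-refl
  fromℕ-nonNeg (suc n) = +-nonNeg 0≤1 (fromℕ-nonNeg n)

  fromℕ-pos : ∀ n .{{_ : ℕ.NonZero n}} → 0# < fromℕ n
  fromℕ-pos (suc n) = <-≤-trans 0<1 (≤-from-diff (fromℕ-nonNeg n)
    (trans (+-congˡ (-‿cong (sym fromℤ-1)))
      (trans (+-congʳ (+-congʳ (sym fromℤ-1)))
        (solve 1 (λ x → (con 1ℤ :+ x) :- con 1ℤ := x) refl (fromℕ n)))))

  fromℤ-mono : ∀ {i j} → i ℤ.≤ j → fromℤ i ≤ fromℤ j
  fromℤ-mono {i} {j} i≤j = ≤-from-diff {e = fromℤ (j ℤ.- i)} (nonNeg (ℤ.i≤j⇒0≤j-i i≤j))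
    (trans (+-congˡ (sym (fromℤ-neg i))) (sym (fromℤ-+ j (ℤ.- i))))
    where
    nonNeg : ∀ {k} → 0ℤ ℤ.≤ k → 0# ≤ fromℤ k
    nonNeg (ℤ.+≤+ {n = n} _) = fromℕ-nonNeg n

  -- If i ≰ j, integrality gives the full gap j + 1 ≤ i, which contradicts the real inequality.
  -- Integer signs are read off from real estimates in this way.
  fromℤ-cancel-≤ : ∀ {i j} → fromℤ i ≤ fromℤ j → i ℤ.≤ j
  fromℤ-cancel-≤ {i} {j} p with i ℤ.≤? j
  ... | yes i≤j = i≤j
  ... | no  i≰j = ⊥-elim (fromℕ-pos 1 (≤-from-diff (+-nonNeg (diff-nonNeg q) (diff-nonNeg p))
    (solve 2 (λ x y → con 0ℤ :- con 1ℤ := (x :- (con 1ℤ :+ y)) :+ (y :- x)) refl (fromℤ i) (fromℤ j))))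
    where
    q : fromℤ 1ℤ + fromℤ j ≤ fromℤ i
    q = ≤-respˡ-≈ (fromℤ-+ 1ℤ j) (fromℤ-mono (ℤ.i<j⇒suc[i]≤j (ℤ.≰⇒> i≰j)))

  ⁻¹-nonNeg : ∀ {x} → 0# < x → 0# ≤ x ⁻¹
  ⁻¹-nonNeg {x} 0<x with total 0# (x ⁻¹)
  ... | inj₁ p = p
  ... | inj₂ p = ⊥-elim (0<1 (≤-resp-≈ (*-inverseʳ x (λ x≈0 → 0<x (≤-reflexive x≈0))) (zeroʳ x)
                                (*-monoˡ-≤ (<⇒≤ 0<x) p)))

  *-inverse-cancel : ∀ {x} → 0# < x → ∀ y → x ⁻¹ * (x * y) ≈ y
  *-inverse-cancel {x} 0<x y = begin
    x ⁻¹ * (x * y)   ≈⟨ solve 3 (λ x y z → z :* (x :* y) := (x :* z) :* y) refl x y (x ⁻¹) ⟩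
    (x * x ⁻¹) * y   ≈⟨ *-congʳ (*-inverseʳ x (λ x≈0 → 0<x (≤-reflexive x≈0))) ⟩
    1# * y           ≈⟨ *-identityˡ y ⟩
    y                ∎
    where open ≈R

  *-cancelˡ-≤ : ∀ {z x y} → 0# < z → z * x ≤ z * y → x ≤ y
  *-cancelˡ-≤ {z} {x} {y} 0<z p =
    ≤-resp-≈ (*-inverse-cancel 0<z x) (*-inverse-cancel 0<z y) (*-monoˡ-≤ (⁻¹-nonNeg 0<z) p)

  -- The supremum of { 0 } ∪ { 1 | A } is positive exactly when A is not refutable.
  ¬-dec : (A : Set) → Dec (¬ A)
  ¬-dec A with supremum S (0# , inj₁ refl) (1# , ≤1)
    where
    S : Carrier → Set
    S x = x ≈ 0# ⊎ (x ≈ 1# × A)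
    ≤1 : ∀ x → S x → x ≤ 1#
    ≤1 x (inj₁ x≈0)       = ≤-respˡ-≈ (sym x≈0) 0≤1
    ≤1 x (inj₂ (x≈1 , _)) = ≤-reflexive x≈1
  ... | s , upper , least with s ≤? 0#
  ...   | yes s≤0 = yes λ a → 0<1 (≤-trans (upper 1# (inj₂ (refl , a))) s≤0)
  ...   | no  s≰0 = no λ ¬a → s≰0 (least 0# λ where
            x (inj₁ x≈0)     → ≤-reflexive x≈0
            x (inj₂ (_ , a)) → ⊥-elim (¬a a))

  sum-nonNeg : ∀ {n} {f : Vector Carrier n} → (∀ i → 0# ≤ f i) → 0# ≤ sum f
  sum-nonNeg {zero}  p = ≤-refl
  sum-nonNeg {suc n} p = +-nonNeg (p zero) (sum-nonNeg (λ i → p (suc i)))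

  sum-mono-≤ : ∀ {n} {f g : Vector Carrier n} → (∀ i → f i ≤ g i) → sum f ≤ sum g
  sum-mono-≤ {zero}  p = ≤-refl
  sum-mono-≤ {suc n} p = +-mono-≤ (p zero) (sum-mono-≤ (λ i → p (suc i)))

  sum-neg : ∀ {n} (f : Vector Carrier n) → sum (λ i → - f i) ≈ - sum f
  sum-neg {zero}  f = sym -0#≈0#
  sum-neg {suc n} f = trans (+-congˡ (sum-neg (λ i → f (suc i)))) (-‿+-comm _ _)

  fromℤ-sum : ∀ {n} (f : Vector ℤ n) → fromℤ (ℤΣ.sum f) ≈ sum (λ i → fromℤ (f i))
  fromℤ-sum {zero}  f = refl
  fromℤ-sum {suc n} f = trans (fromℤ-+ (f zero) (ℤΣ.sum (λ i → f (suc i))))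
      (+-congˡ (fromℤ-sum (λ i → f (suc i))))

  -- Rational numbers are stored in lowest terms, so identities are transferred by checking the
  -- defining equation instead of unfolding the arithmetic of ℚ.
  fromℚ-unique : ∀ q {x} → fromℤ (ℚ.denominator q) * x ≈ fromℤ (ℚ.numerator q) → fromℚ q ≈ x
  fromℚ-unique q {x} p = begin
    fromℤ (ℚ.numerator q) * d ⁻¹   ≈⟨ *-comm _ _ ⟩
    d ⁻¹ * fromℤ (ℚ.numerator q)   ≈⟨ *-congˡ (sym p) ⟩
    d ⁻¹ * (d * x)                 ≈⟨ *-inverse-cancel (fromℕ-pos (ℚ.denominatorℕ q)) x ⟩
    x                              ∎
    where
    open ≈R
    d = fromℤ (ℚ.denominator q)

  denominator-*-fromℚ : ∀ q → fromℤ (ℚ.denominator q) * fromℚ q ≈ fromℤ (ℚ.numerator q)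
  denominator-*-fromℚ q = begin
    d * (z * d ⁻¹)   ≈⟨ solve 3 (λ d z e → d :* (z :* e) := z :* (d :* e)) refl d z (d ⁻¹) ⟩
    z * (d * d ⁻¹)   ≈⟨ *-congˡ (*-inverseʳ d (λ d≈0 → fromℕ-pos (ℚ.denominatorℕ q)
        (≤-reflexive d≈0))) ⟩
    z * 1#           ≈⟨ *-identityʳ z ⟩
    z                ∎
    where
    open ≈R
    d = fromℤ (ℚ.denominator q)
    z = fromℤ (ℚ.numerator q)

  -- Multiplying the reduced numerator and denominator by the gcd restores z and n, so the gcd never
  -- has to be divided out.
  fromℚ-/ : ∀ z n .{{_ : ℕ.NonZero n}} → fromℕ n * fromℚ (z ℚ./ n) ≈ fromℤ z
  fromℚ-/ z n = begin
    fromℕ n * x                        ≡⟨ ≡.cong (λ k → fromℤ k * x) (≡.sym (ℚ.↧-/ z n)) ⟩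
    fromℤ (↧q ℤ.* g) * x               ≈⟨ *-congʳ (fromℤ-* ↧q g) ⟩
    fromℤ ↧q * fromℤ g * x             ≈⟨ solve 3 (λ d g x → d :* g :* x := d :* x :* g) refl _ _ x ⟩
    fromℤ ↧q * x * fromℤ g             ≈⟨ *-congʳ (denominator-*-fromℚ (z ℚ./ n)) ⟩
    fromℤ ↥q * fromℤ g                 ≈⟨ sym (fromℤ-* ↥q g) ⟩
    fromℤ (↥q ℤ.* g)                   ≡⟨ ≡.cong fromℤ (ℚ.↥-/ z n) ⟩
    fromℤ z                            ∎
    where
    open ≈R
    x = fromℚ (z ℚ./ n)
    ↧q = ℚ.denominator (z ℚ./ n)
    ↥q = ℚ.numerator (z ℚ./ n)
    g = gcd z (+ n)

  fromℚ-neg : ∀ q → fromℚ (ℚ.- q) ≈ - fromℚ q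
  fromℚ-neg q = fromℚ-unique (ℚ.- q) (begin
    fromℤ (ℚ.denominator (ℚ.- q)) * - fromℚ q   ≡⟨ ≡.cong (λ k → fromℤ k * - fromℚ q) (ℚ.↧-neg q) ⟩
    fromℤ (ℚ.denominator q) * - fromℚ q         ≈⟨ sym (-‿distribʳ-* _ _) ⟩
    - (fromℤ (ℚ.denominator q) * fromℚ q)       ≈⟨ -‿cong (denominator-*-fromℚ q) ⟩
    - fromℤ (ℚ.numerator q)                     ≈⟨ sym (fromℤ-neg (ℚ.numerator q)) ⟩
    fromℤ (ℤ.- ℚ.numerator q)                   ≡⟨ ≡.cong fromℤ (≡.sym (ℚ.↥-neg q)) ⟩
    fromℤ (ℚ.numerator (ℚ.- q))                 ∎)
    where open ≈R

  fromℚ-0 : fromℚ ℚ.0ℚ ≈ 0#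
  fromℚ-0 = fromℚ-unique ℚ.0ℚ (zeroʳ _)

  fromℚ-1 : fromℚ ℚ.1ℚ ≈ 1#
  fromℚ-1 = fromℚ-unique ℚ.1ℚ (*-identityʳ _)

-- Integer flows with prescribed boundary

module ClosedSets where
  open ≡ using (refl; sym; trans; cong; cong₂; subst; module ≡-Reasoning)
  open import Data.List.Base using ([]; _∷_)
  open import Data.List.Relation.Unary.All using ([]; _∷_)
  open import Data.Vec.Base using ([]; _∷_; replicate; zipWith)

  -- Natural entries let the basis vectors serve as row multipliers and, after coercion, as integer
  -- or real vectors.
  unit : ∀ {m} → Fin m → Vector ℕ m
  unit zero    zero    = 1
  unit zero    (suc j) = 0
  unit (suc i) zero    = 0
  unit (suc i) (suc j) = unit i j

  sum-*-unit : ∀ {m} (f : Vector ℤ m) i → ℤΣ.sum (λ j → f j ℤ.* + unit i j) ≡ f i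
  sum-*-unit {suc m} f zero    = trans
    (cong₂ ℤ._+_ (ℤ.*-identityʳ (f zero))
      (trans (ℤΣ.sum-cong-≗ (λ j → ℤ.*-zeroʳ (f (suc j)))) (ℤΣ.sum-replicate-zero m)))
    (ℤ.+-identityʳ _)
  sum-*-unit {suc m} f (suc i) =
      trans (cong₂ ℤ._+_ (ℤ.*-zeroʳ (f zero)) (sum-*-unit (λ j → f (suc j)) i)) (ℤ.+-identityˡ _)

  maximum-subset : ∀ {W} {P : Vec Bool W → Set} → Decidable P → (f : Vec Bool W → ℤ) →
                   (∀ X → ¬ P X) ⊎ ∃[ X ] P X × (∀ Y → P Y → f Y ℤ.≤ f X)
  maximum-subset {zero} P? f with P? []
  ... | yes p = inj₂ ([] , p , λ { [] _ → ℤ.≤-refl })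
  ... | no ¬p = inj₁ λ { [] p → ¬p p }
  maximum-subset {suc W} P? f
    with maximum-subset (λ X → P? (true ∷ X)) (λ X → f (true ∷ X))
       | maximum-subset (λ X → P? (false ∷ X)) (λ X → f (false ∷ X))
  ... | inj₁ ∄₁ | inj₁ ∄₀ = inj₁ λ { (true ∷ X) → ∄₁ X ; (false ∷ X) → ∄₀ X }
  ... | inj₁ ∄₁ | inj₂ (X , p , max) =
      inj₂ (false ∷ X , p , λ { (true ∷ Y) q → ⊥-elim (∄₁ Y q) ; (false ∷ Y) → max Y })
  ... | inj₂ (X , p , max) | inj₁ ∄₀ =
    inj₂ (true ∷ X , p , λ { (true ∷ Y) → max Y ; (false ∷ Y) q → ⊥-elim (∄₀ Y q) })
  ... | inj₂ (X , p , maxX) | inj₂ (Y , q , maxY) with ℤ.≤-total (f (true ∷ X)) (f (false ∷ Y))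
  ...   | inj₁ X≤Y =
    inj₂ (false ∷ Y , q , λ { (true ∷ Z) r → ℤ.≤-trans (maxX Z r) X≤Y ; (false ∷ Z) → maxY Z })
  ...   | inj₂ Y≤X =
    inj₂ (true ∷ X , p , λ { (true ∷ Z) → maxX Z ; (false ∷ Z) r → ℤ.≤-trans (maxY Z r) Y≤X })

  module _ {W : ℕ} where

    χ : Vec Bool W → Fin W → ℤ
    χ X i = if lookup X i then 1ℤ else 0ℤ

    weight : Vector ℤ W → Vec Bool W → ℤ
    weight ω X = ℤΣ.sum (λ i → χ X i ℤ.* ω i)

    full : Vec Bool W
    full = replicate W true

    _∪_ _∩_ : Vec Bool W → Vec Bool W → Vec Bool W
    _∪_ = zipWith _∨_
    _∩_ = zipWith _∧_

    weight-+ : ∀ ω X Y X′ Y′ → (∀ i → χ X i ℤ.+ χ Y i ≡ χ X′ i ℤ.+ χ Y′ i) →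
               weight ω X ℤ.+ weight ω Y ≡ weight ω X′ ℤ.+ weight ω Y′
    weight-+ ω X Y X′ Y′ p = begin
      weight ω X ℤ.+ weight ω Y
        ≡⟨ sym (ℤΣ.∑-distrib-+ (λ i → χ X i ℤ.* ω i) _) ⟩
      ℤΣ.sum (λ i → χ X i ℤ.* ω i ℤ.+ χ Y i ℤ.* ω i)
        ≡⟨ ℤΣ.sum-cong-≗ pointwise ⟩
      ℤΣ.sum (λ i → χ X′ i ℤ.* ω i ℤ.+ χ Y′ i ℤ.* ω i)
        ≡⟨ ℤΣ.∑-distrib-+ (λ i → χ X′ i ℤ.* ω i) _ ⟩
      weight ω X′ ℤ.+ weight ω Y′ ∎
      where
      open ≡-Reasoning
      pointwise : ∀ i → χ X i ℤ.* ω i ℤ.+ χ Y i ℤ.* ω i ≡ χ X′ i ℤ.* ω i ℤ.+ χ Y′ i ℤ.* ω i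
      pointwise i = trans (sym (ℤ.*-distribʳ-+ (ω i) (χ X i) (χ Y i)))
        (trans (cong (ℤ._* ω i) (p i)) (ℤ.*-distribʳ-+ (ω i) (χ X′ i) (χ Y′ i)))

    weight-modular : ∀ ω X Y → weight ω X ℤ.+ weight ω Y ≡ weight ω (X ∪ Y) ℤ.+ weight ω (X ∩ Y)
    weight-modular ω X Y = weight-+ ω X Y (X ∪ Y) (X ∩ Y) χ-modular
      where
      χ-modular : ∀ i → χ X i ℤ.+ χ Y i ≡ χ (X ∪ Y) i ℤ.+ χ (X ∩ Y) i
      χ-modular i rewrite Vec.lookup-zipWith _∨_ i X Y | Vec.lookup-zipWith _∧_ i X Y
        with lookup X i | lookup Y i
      ... | true  | true  = refl
      ... | true  | false = refl
      ... | false | true  = refl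
      ... | false | false = refl

    -- The boundary that is left to realise once the arc i → j, whose own boundary is e_i - e_j,
    -- carries k units.
    shift : Vector ℤ W → ℕ → Fin W → Fin W → Vector ℤ W
    shift ω k i j m = ω m ℤ.- + k ℤ.* (+ unit i m ℤ.- + unit j m)

    weight-shift : ∀ ω k i j X → weight (shift ω k i j) X ≡ weight ω X ℤ.- + k ℤ.* (χ X i ℤ.- χ X j)
    weight-shift ω k i j X = begin
      weight (shift ω k i j) X
        ≡⟨ ℤΣ.sum-cong-≗ (λ m → expand (χ X m) (ω m) (+ k) (+ unit i m) (+ unit j m)) ⟩
      ℤΣ.sum (λ m → χ X m ℤ.* ω m ℤ.+ (ℤ.- + k ℤ.* (χ X m ℤ.* + unit i m) ℤ.+ + k ℤ.*
          (χ X m ℤ.* + unit j m)))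
        ≡⟨ ℤΣ.∑-distrib-+ (λ m → χ X m ℤ.* ω m) _ ⟩
      weight ω X ℤ.+ ℤΣ.sum (λ m → ℤ.- + k ℤ.* (χ X m ℤ.* + unit i m) ℤ.+ + k ℤ.*
          (χ X m ℤ.* + unit j m))
        ≡⟨ cong (λ z → weight ω X ℤ.+ z) (ℤΣ.∑-distrib-+ (λ m → ℤ.- + k ℤ.* (χ X m ℤ.* + unit i m)) _) ⟩
      weight ω X ℤ.+ (ℤΣ.sum (λ m → ℤ.- + k ℤ.* (χ X m ℤ.* + unit i m)) ℤ.+ ℤΣ.sum
          (λ m → + k ℤ.* (χ X m ℤ.* + unit j m)))
        ≡⟨ cong (λ z → weight ω X ℤ.+ z) (cong₂ ℤ._+_ (pull (ℤ.- + k) i) (pull (+ k) j)) ⟩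
      weight ω X ℤ.+ (ℤ.- + k ℤ.* χ X i ℤ.+ + k ℤ.* χ X j)
        ≡⟨ collect (weight ω X) (+ k) (χ X i) (χ X j) ⟩
      weight ω X ℤ.- + k ℤ.* (χ X i ℤ.- χ X j) ∎
      where
      open ≡-Reasoning
      expand : ∀ c w k u v →
          c ℤ.* (w ℤ.- k ℤ.* (u ℤ.- v)) ≡ c ℤ.* w ℤ.+ (ℤ.- k ℤ.* (c ℤ.* u) ℤ.+ k ℤ.* (c ℤ.* v))
      expand = solve-∀
      collect : ∀ w k a b → w ℤ.+ (ℤ.- k ℤ.* a ℤ.+ k ℤ.* b) ≡ w ℤ.- k ℤ.* (a ℤ.- b)
      collect = solve-∀
      pull : ∀ z i → ℤΣ.sum (λ m → z ℤ.* (χ X m ℤ.* + unit i m)) ≡ z ℤ.* χ X i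
      pull z i = trans (sym (ℤΣ.*-distribˡ-sum z (λ m → χ X m ℤ.* + unit i m)))
          (cong (z ℤ.*_) (sum-*-unit (χ X) i))

    -- No arc of L leaves X, so a nonnegative flow on L has net outflow at most 0 from X.
    -- `decompose` shows that this necessary condition suffices.
    Closed : List (Fin W × Fin W) → Vec Bool W → Set
    Closed L X = All (λ (i , j) → lookup X i ≡ true → lookup X j ≡ true) L

    closed? : ∀ L → Decidable (Closed L)
    closed? L X = All.all? (λ (i , j) → (lookup X i Bool.≟ true) →-dec (lookup X j Bool.≟ true)) L

    ∪-closed : ∀ {L} X Y → Closed L X → Closed L Y → Closed L (X ∪ Y)
    ∪-closed X Y p q = All.zipWith (λ {(i , j)} (p , q) → step i j p q) (p , q)
      where
      step : ∀ i j → (lookup X i ≡ true → lookup X j ≡ true) → (lookup Y i ≡ true → lookup Y j ≡ true) →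
             lookup (X ∪ Y) i ≡ true → lookup (X ∪ Y) j ≡ true
      step i j p q r rewrite Vec.lookup-zipWith _∨_ i X Y | Vec.lookup-zipWith _∨_ j X Y
        with lookup X i | lookup Y i
      ... | true  | _    rewrite p refl = refl
      ... | false | true rewrite q refl = Bool.∨-zeroʳ _

    ∩-closed : ∀ {L} X Y → Closed L X → Closed L Y → Closed L (X ∩ Y)
    ∩-closed X Y p q = All.zipWith (λ {(i , j)} (p , q) → step i j p q) (p , q)
      where
      step : ∀ i j → (lookup X i ≡ true → lookup X j ≡ true) → (lookup Y i ≡ true → lookup Y j ≡ true) →
             lookup (X ∩ Y) i ≡ true → lookup (X ∩ Y) j ≡ true
      step i j p q r rewrite Vec.lookup-zipWith _∧_ i X Y | Vec.lookup-zipWith _∧_ j X Y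
        with lookup X i | lookup Y i
      ... | true | true rewrite p refl | q refl = refl

    -- A nonnegative integer flow on the arcs of L with boundary ω, recorded arc by arc: the index
    -- of each tail is the boundary still to be realised.
    data Flow : List (Fin W × Fin W) → Vector ℤ W → Set where
      stop : ∀ {ω} → (∀ i → ω i ≡ 0ℤ) → Flow [] ω
      skip : ∀ {i j L ω} → Flow L ω → Flow ((i , j) ∷ L) ω
      push : ∀ {i j L ω} k → Flow L (shift ω k i j) → Flow ((i , j) ∷ L) ω

    single co-single : Fin W → Vec Bool W
    single i    = Vec.tabulate (λ j → 0 ℕ.<ᵇ unit i j)
    co-single i = Vec.map not (single i)

  0<ᵇunit : ∀ {W} (i j : Fin W) → (if 0 ℕ.<ᵇ unit i j then 1ℤ else 0ℤ) ≡ + unit i j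
  0<ᵇunit zero    zero    = refl
  0<ᵇunit zero    (suc j) = refl
  0<ᵇunit (suc i) zero    = refl
  0<ᵇunit (suc i) (suc j) = 0<ᵇunit i j

  module _ {W : ℕ} where

    weight-single : ∀ (ω : Vector ℤ W) i → weight ω (single i) ≡ ω i
    weight-single ω i = trans (ℤΣ.sum-cong-≗ (λ j → trans (ℤ.*-comm (χ (single i) j) (ω j))
        (cong (ω j ℤ.*_) (χ-single j)))) (sum-*-unit ω i)
      where
      χ-single : ∀ j → χ (single i) j ≡ + unit i j
      χ-single j = trans (cong (if_then 1ℤ else 0ℤ) (Vec.lookup∘tabulate _ j)) (0<ᵇunit i j)

    weight-empty : ∀ (ω : Vector ℤ W) → weight ω (replicate W false) ≡ 0ℤ
    weight-empty ω = trans (ℤΣ.sum-cong-≗ (λ i → cong (λ b → (if b then 1ℤ else 0ℤ) ℤ.* ω i)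
        (Vec.lookup-replicate i false)))
                           (ℤΣ.sum-replicate-zero W)

    weight-co-single : ∀ (ω : Vector ℤ W) i → weight ω (co-single i) ℤ.+ ω i ≡ weight ω full
    weight-co-single ω i = begin
      weight ω (co-single i) ℤ.+ ω i                       ≡⟨ cong (λ z → weight ω (co-single i) ℤ.+ z)
          (sym (weight-single ω i)) ⟩
      weight ω (co-single i) ℤ.+ weight ω (single i)       ≡⟨ weight-+ ω (co-single i) (single i) full
          (replicate W false) χ-complement ⟩
      weight ω full ℤ.+ weight ω (replicate W false)       ≡⟨ cong (λ z → weight ω full ℤ.+ z)
          (weight-empty ω) ⟩
      weight ω full ℤ.+ 0ℤ                                 ≡⟨ ℤ.+-identityʳ _ ⟩
      weight ω full                                        ∎
      where
      open ≡-Reasoning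
      χ-complement : ∀ j → χ (co-single i) j ℤ.+ χ (single i) j ≡ χ full j ℤ.+ χ (replicate W false) j
      χ-complement j rewrite Vec.lookup-map j not (single i) | Vec.lookup-replicate j true
          | Vec.lookup-replicate {n = W} j false
        with lookup (single i) j
      ... | true  = refl
      ... | false = refl

    χ-∈ : ∀ {X : Vec Bool W} {i} {b} → lookup X i ≡ b → χ X i ≡ (if b then 1ℤ else 0ℤ)
    χ-∈ = cong (if_then 1ℤ else 0ℤ)

    -- An arc i → j is given as much flow as the sets that only this arc prevents from being
    -- closed require. Uncrossing such a set with one of maximum weight gives closed sets, so
    -- the remaining weights satisfy the hypothesis for the remaining arcs.
    decompose : ∀ L (ω : Vector ℤ W) → weight ω full ≡ 0ℤ → (∀ X → Closed L X → weight ω X ℤ.≤ 0ℤ) →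
        Flow L ω
    decompose [] ω total ω≤0 = stop λ i →
        -- Without arcs every set is closed: {i} gives `ω i ≤ 0`, and its complement, since the
        -- total is 0, gives `ω i ≥ 0`.
        ℤ.≤-antisym (subst (ℤ._≤ 0ℤ) (weight-single ω i) (ω≤0 (single i) []))
      (subst (0ℤ ℤ.≤_) (trans (cong (ℤ._- weight ω (co-single i))
          (trans (sym total) (sym (weight-co-single ω i))))
                         (cancel (weight ω (co-single i)) (ω i)))
        (ℤ.i≤j⇒0≤j-i (ω≤0 (co-single i) [])))
      where
      cancel : ∀ a b → (a ℤ.+ b) ℤ.- a ≡ b
      cancel = solve-∀
    decompose ((i , j) ∷ L) ω total ω≤0 = split (maximum-subset separating? (weight ω))
      where
      Separating : Vec Bool W → Set
      Separating X = Closed L X × lookup X i ≡ true × lookup X j ≡ false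

      separating? : Decidable Separating
      separating? X = closed? L X ×-dec (lookup X i Bool.≟ true) ×-dec (lookup X j Bool.≟ false)

      data Position (X : Vec Bool W) : Set where
        separating : Separating X → Position X
        crossing   : lookup X i ≡ false → lookup X j ≡ true → Position X
        neutral    : ∀ {b} → lookup X i ≡ b → lookup X j ≡ b → Position X

      position : ∀ X → Closed L X → Position X
      position X cl with lookup X i in eqi | lookup X j in eqj
      ... | true  | true  = neutral eqi eqj
      ... | true  | false = separating (cl , eqi , eqj)
      ... | false | true  = crossing eqi eqj
      ... | false | false = neutral eqi eqj

      lookup-∪ : ∀ X Y m → lookup (X ∪ Y) m ≡ lookup X m ∨ lookup Y m
      lookup-∪ X Y m = Vec.lookup-zipWith _∨_ m X Y

      lookup-∩ : ∀ X Y m → lookup (X ∩ Y) m ≡ lookup X m ∧ lookup Y m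
      lookup-∩ X Y m = Vec.lookup-zipWith _∧_ m X Y

      -- A set closed for L that is not separating is also closed for the new arc, so the hypothesis
      -- already bounds it.
      without : (∀ X → Separating X → weight ω X ℤ.≤ 0ℤ) → Flow ((i , j) ∷ L) ω
      without sep≤0 = skip (decompose L ω total λ X cl → bound X cl (position X cl))
        where
        bound : ∀ X → Closed L X → Position X → weight ω X ℤ.≤ 0ℤ
        bound X cl (separating sep) = sep≤0 X sep
        bound X cl (crossing p q)   = ω≤0 X ((λ _ → q) ∷ cl)
        bound X cl (neutral p q)    = ω≤0 X ((λ r → trans q (trans (sym p) r)) ∷ cl)

      with-flow : ∀ k Z → Separating Z → weight ω Z ≡ + k → (∀ X → Separating X → weight ω X ℤ.≤ + k) →
          Flow ((i , j) ∷ L) ω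
      with-flow k Z (clZ , i∈Z , j∉Z) Z≡k ≤k = push k (decompose L (shift ω k i j)
        (trans (weight-shift ω k i j full)
            (trans (cong₂ (λ a b → weight ω full ℤ.- + k ℤ.* (a ℤ.- b))
            (χ-∈ {full} {i} (Vec.lookup-replicate i true))
            (χ-∈ {full} {j} (Vec.lookup-replicate j true)))
          (trans (cong (ℤ._- + k ℤ.* 0ℤ) total) (zero-flow (+ k)))))
        λ X cl → subst (ℤ._≤ 0ℤ) (sym (weight-shift ω k i j X)) (bound X cl (position X cl)))
        where
        zero-flow : ∀ k → 0ℤ ℤ.- k ℤ.* 0ℤ ≡ 0ℤ
        zero-flow = solve-∀
        separated : ∀ w k → w ℤ.- k ℤ.* 1ℤ ≡ w ℤ.- k
        separated = solve-∀
        crossed : ∀ w k → w ℤ.- k ℤ.* (0ℤ ℤ.- 1ℤ) ≡ w ℤ.+ k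
        crossed = solve-∀
        unaffected : ∀ w k b → w ℤ.- k ℤ.* (b ℤ.- b) ≡ w
        unaffected = solve-∀
        at : ∀ X a b → lookup X i ≡ a → lookup X j ≡ b →
             weight ω X ℤ.- + k ℤ.* (χ X i ℤ.- χ X j) ≡
             weight ω X ℤ.- + k ℤ.* ((if a then 1ℤ else 0ℤ) ℤ.- (if b then 1ℤ else 0ℤ))
        at X a b p q = cong₂ (λ a b → weight ω X ℤ.- + k ℤ.* (a ℤ.- b)) (χ-∈ {X} {i} p) (χ-∈ {X} {j} q)
        bound : ∀ X → Closed L X → Position X → weight ω X ℤ.- + k ℤ.* (χ X i ℤ.- χ X j) ℤ.≤ 0ℤ
        bound X cl (separating sep@(_ , p , q)) =
          subst (ℤ._≤ 0ℤ) (sym (trans (at X true false p q) (separated (weight ω X) (+ k))))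
              (ℤ.i≤j⇒i-j≤0 (≤k X sep))
        bound X cl (neutral {b} p q) =
          subst (ℤ._≤ 0ℤ) (sym (trans (at X b b p q) (unaffected (weight ω X) (+ k)
              (if b then 1ℤ else 0ℤ))))
            (ω≤0 X ((λ r → trans q (trans (sym p) r)) ∷ cl))
        -- The shift has raised the weight of X by k, the weight of Z. By modularity the sum is
        -- shared by `X ∪ Z`, which contains j, and `X ∩ Z`, which misses i; neither is left by the
        -- arc i → j.
        bound X cl (crossing p q) = subst (ℤ._≤ 0ℤ)
          (sym (trans (at X false true p q) (trans (crossed (weight ω X) (+ k))
                 (trans (cong (λ z → weight ω X ℤ.+ z) (sym Z≡k)) (weight-modular ω X Z)))))
          (ℤ.+-mono-≤
            (ω≤0 (X ∪ Z) ((λ _ → trans (lookup-∪ X Z j) (cong (_∨ lookup Z j) q))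
                        ∷ ∪-closed X Z cl clZ))
            (ω≤0 (X ∩ Z) ((λ r →
                ⊥-elim (Bool.not-¬ (trans (lookup-∩ X Z i) (cong (_∧ lookup Z i) p)) r))
                        ∷ ∩-closed X Z cl clZ)))

      split : _ ⊎ _ → Flow ((i , j) ∷ L) ω
      split (inj₁ ∄) = without λ X sep → ⊥-elim (∄ X sep)
      split (inj₂ (Z , sep , max)) with weight ω Z in eq
      ... | + k      = with-flow k Z sep eq max
      -- The amount of flow is the positive part of the maximum; a negative maximum calls for none.
      ... | -[1+ n ] = without λ X sepX → ℤ.≤-trans (max X sepX) ℤ.-≤+

open ClosedSets

-- Fourier-Motzkin elimination, Farkas' lemma and linear programming

module LinearProgramming (ℝ : Reals) where
  open OrderedField ℝ
  open import Data.List.Base using ([]; _∷_)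

  -- Multipliers are natural numbers throughout: elimination over an integer matrix produces no
  -- others, and integral dual solutions are assembled from them.
  ⟨_,_⟩ : ∀ {m} → Vector ℕ m → Vector Carrier m → Carrier
  ⟨ l , r ⟩ = sum (λ i → fromℕ (l i) * r i)

  ⟨,⟩-cong : ∀ {m} (l : Vector ℕ m) {r s : Vector Carrier m} → (∀ i → r i ≈ s i) → ⟨ l , r ⟩ ≈ ⟨ l , s ⟩
  ⟨,⟩-cong l p = sum-cong-≋ (λ i → *-congˡ (p i))

  ⟨0,⟩ : ∀ {m} (r : Vector Carrier m) → ⟨ (λ _ → 0) , r ⟩ ≈ 0#
  ⟨0,⟩ {m} r = trans (sum-cong-≋ (λ i → zeroˡ (r i))) (sum-replicate-zero m)

  ⟨,⟩-linearʳ : ∀ {m} (l : Vector ℕ m) (r s : Vector Carrier m) z →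
                ⟨ l , (λ i → r i - z * s i) ⟩ ≈ ⟨ l , r ⟩ - z * ⟨ l , s ⟩
  ⟨,⟩-linearʳ l r s z = begin
    ⟨ l , (λ i → r i - z * s i) ⟩
      ≈⟨ sum-cong-≋ (λ i →
          solve 4 (λ l r s z → l :* (r :- z :* s) := l :* r :+ (:- z) :* (l :* s)) refl (fromℕ (l i))
          (r i) (s i) z) ⟩
    sum (λ i → fromℕ (l i) * r i + (- z) * (fromℕ (l i) * s i))
      ≈⟨ ∑-distrib-+ (λ i → fromℕ (l i) * r i) (λ i → (- z) * (fromℕ (l i) * s i)) ⟩
    ⟨ l , r ⟩ + sum (λ i → (- z) * (fromℕ (l i) * s i))
      ≈⟨ +-congˡ (sym (*-distribˡ-sum (- z) (λ i → fromℕ (l i) * s i))) ⟩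
    ⟨ l , r ⟩ + (- z) * ⟨ l , s ⟩
      ≈⟨ +-congˡ (sym (-‿distribˡ-* z ⟨ l , s ⟩)) ⟩
    ⟨ l , r ⟩ - z * ⟨ l , s ⟩ ∎
    where open ≈R

  combine : ∀ {m} → ℕ → Vector ℕ m → ℕ → Vector ℕ m → Vector ℕ m
  combine a k b l i = a ℕ.* k i ℕ.+ b ℕ.* l i

  fromℕ-+ : ∀ m n → fromℕ (m ℕ.+ n) ≈ fromℕ m + fromℕ n
  fromℕ-+ = ×-homo-+ 1#

  fromℕ-* : ∀ m n → fromℕ (m ℕ.* n) ≈ fromℕ m * fromℕ n
  fromℕ-* = ×1-homo-*

  ⟨combine,⟩ : ∀ {m} a (k : Vector ℕ m) b l r →
      ⟨ combine a k b l , r ⟩ ≈ fromℕ a * ⟨ k , r ⟩ + fromℕ b * ⟨ l , r ⟩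
  ⟨combine,⟩ a k b l r = begin
    ⟨ combine a k b l , r ⟩
      ≈⟨ sum-cong-≋ (λ i → *-congʳ (trans (fromℕ-+ (a ℕ.* k i) (b ℕ.* l i))
          (+-cong (fromℕ-* a (k i)) (fromℕ-* b (l i))))) ⟩
    sum (λ i → (fromℕ a * fromℕ (k i) + fromℕ b * fromℕ (l i)) * r i)
      ≈⟨ sum-cong-≋ (λ i → solve 5 (λ a k b l r →
          (a :* k :+ b :* l) :* r := a :* (k :* r) :+ b :* (l :* r)) refl
                              (fromℕ a) (fromℕ (k i)) (fromℕ b) (fromℕ (l i)) (r i)) ⟩
    sum (λ i → fromℕ a * (fromℕ (k i) * r i) + fromℕ b * (fromℕ (l i) * r i))
      ≈⟨ ∑-distrib-+ (λ i → fromℕ a * (fromℕ (k i) * r i)) (λ i → fromℕ b * (fromℕ (l i) * r i)) ⟩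
    sum (λ i → fromℕ a * (fromℕ (k i) * r i)) + sum (λ i → fromℕ b * (fromℕ (l i) * r i))
      ≈⟨ sym (+-cong (*-distribˡ-sum (fromℕ a) (λ i → fromℕ (k i) * r i))
          (*-distribˡ-sum (fromℕ b) (λ i → fromℕ (l i) * r i))) ⟩
    fromℕ a * ⟨ k , r ⟩ + fromℕ b * ⟨ l , r ⟩ ∎
    where open ≈R

  pairing : ∀ {m} → Vector ℕ m → Vector ℤ m → ℤ
  pairing l c = ℤΣ.sum (λ i → + l i ℤ.* c i)

  fromℤ-pairing : ∀ {m} (l : Vector ℕ m) c → fromℤ (pairing l c) ≈ ⟨ l , vecℤ ℝ c ⟩
  fromℤ-pairing l c = trans (fromℤ-sum (λ i → + l i ℤ.* c i)) (sum-cong-≋ (λ i → fromℤ-* (+ l i) (c i)))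

  data Bound : Set where
    none        : Bound
    lower upper : Carrier → Bound

  Within : Carrier → Bound → Set
  Within δ none      = ⊤
  Within δ (lower x) = x ≤ δ
  Within δ (upper x) = δ ≤ x

  -- Helly's theorem on the line. The point found for the tail is lifted to a new lower bound or
  -- lowered to a new upper one; compatibility with the opposite bounds keeps it admissible.
  common-point : ∀ {I : Set} (β : I → Bound) (is : List I) →
                 (∀ {i j x y} → i ∈ is → j ∈ is → β i ≡ lower x → β j ≡ upper y → x ≤ y) →
                 ∃[ δ ] (∀ {i} → i ∈ is → Within δ (β i))
  common-point β []       _ = 0# , λ ()
  common-point β (i ∷ is) compatible with common-point β is (λ p q → compatible (there p) (there q))
      | β i in βi
  ... | δ , δ-ok | none = δ , λ where
    (here ≡.refl) → ≡.subst (Within δ) (≡.sym βi) tt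
    (there p)     → δ-ok p
  ... | δ , δ-ok | lower x = x ⊔ δ , λ where
      (here ≡.refl) → ≡.subst (Within (x ⊔ δ)) (≡.sym βi) (x≤x⊔y x δ)
      (there p)     → raise p
    where
    raise : ∀ {j} → j ∈ is → Within (x ⊔ δ) (β j)
    raise {j} p with β j in βj | δ-ok p
    ... | none    | _   = tt
    ... | lower y | y≤δ = ≤-trans y≤δ (x≤y⊔x x δ)
    ... | upper y | δ≤y = ⊔-lub (compatible (here ≡.refl) (there p) βi βj) δ≤y
  ... | δ , δ-ok | upper x = x ⊓ δ , λ where
      (here ≡.refl) → ≡.subst (Within (x ⊓ δ)) (≡.sym βi) (x⊓y≤x x δ)
      (there p)     → drop p
    where
    drop : ∀ {j} → j ∈ is → Within (x ⊓ δ) (β j)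
    drop {j} p with β j in βj | δ-ok p
    ... | none    | _   = tt
    ... | lower y | y≤δ = ⊓-glb (compatible (there p) (here ≡.refl) βj βi) y≤δ
    ... | upper y | δ≤y = ≤-trans (x⊓y≤y x δ) δ≤y

  Satisfies : ∀ {m} → List (Vector ℕ m) → Vector Carrier m → Set
  Satisfies L r = ∀ {l} → l ∈ L → 0# ≤ ⟨ l , r ⟩

  -- With `A′` = 1/A and `B′` = 1/B, this divides B s + A t ≥ 0 by A B: the combination that cancels
  -- the variable compares the upper bound from one row with the lower bound from the other.
  lower≤upper : ∀ {A B A′ B′ s t} → 0# ≤ A′ → 0# ≤ B′ → B * (B′ * s) ≈ s → A * (A′ * t) ≈ t →
                0# ≤ B * s + A * t → - (B′ * t) ≤ A′ * s
  lower≤upper {A} {B} {A′} {B′} {s} {t} 0≤A′ 0≤B′ BB′s AA′t p =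
    ≤-from-diff (*-nonNeg (*-nonNeg 0≤A′ 0≤B′) p) (begin
      A′ * s - - (B′ * t)
        ≈⟨ sym (+-cong (*-congˡ BB′s) (-‿cong (-‿cong (*-congˡ AA′t)))) ⟩
      A′ * (B * (B′ * s)) - - (B′ * (A * (A′ * t)))
        ≈⟨ solve 6 (λ A B A′ B′ s t → A′ :* (B :* (B′ :* s)) :- (:- (B′ :* (A :* (A′ :* t))))
                                   := A′ :* B′ :* (B :* s :+ A :* t)) refl A B A′ B′ s t ⟩
      A′ * B′ * (B * s + A * t) ∎)
    where open ≈R

  upper-slack : ∀ {A A′ s δ k} → 0# ≤ A → A * (A′ * s) ≈ s → k ≈ A → δ ≤ A′ * s → 0# ≤ s - δ * k
  upper-slack {A} {A′} {s} {δ} {k} 0≤A AA′s k≈A δ≤ =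
    ≤-respʳ-≈ (+-cong AA′s (-‿cong (trans (*-comm A δ) (*-congˡ (sym k≈A)))))
        (diff-nonNeg (*-monoˡ-≤ 0≤A δ≤))

  lower-slack : ∀ {B B′ s δ k} → 0# ≤ B → B * (B′ * s) ≈ s → k ≈ - B → - (B′ * s) ≤ δ → 0# ≤ s - δ * k
  lower-slack {B} {B′} {s} {δ} {k} 0≤B BB′s k≈-B ≤δ = ≤-respʳ-≈ (begin
    B * δ - B * - (B′ * s)   ≈⟨ solve 3 (λ B δ s →
        B :* δ :- B :* (:- s) := B :* s :- δ :* (:- B)) refl B δ (B′ * s) ⟩
    B * (B′ * s) - δ * - B   ≈⟨ +-cong BB′s (-‿cong (*-congˡ (sym k≈-B))) ⟩
    s - δ * k                ∎) (diff-nonNeg (*-monoˡ-≤ 0≤B ≤δ))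
    where open ≈R

  x*[y*z]≈y*[x*z] : ∀ x y z → x * (y * z) ≈ y * (x * z)
  x*[y*z]≈y*[x*z] = solve 3 (λ x y z → x :* (y :* z) := y :* (x :* z)) refl

  b-δc-s≈b-[cδ+s] : ∀ b δ c s → (b - δ * c) - s ≈ b - (c * δ + s)
  b-δc-s≈b-[cδ+s] = solve 4 (λ b δ c s → (b :- δ :* c) :- s := b :- (c :* δ :+ s)) refl

  x+y*-x≈0 : ∀ a b → b * a + a * - b ≈ 0#
  x+y*-x≈0 = solve 2 (λ a b → b :* a :+ a :* (:- b) := con 0ℤ) refl

  Satisfies-cong : ∀ {m} L {r s : Vector Carrier m} → (∀ i → r i ≈ s i) → Satisfies L r → Satisfies L s
  Satisfies-cong L p sat {l} l∈L = ≤-respʳ-≈ (⟨,⟩-cong l p) (sat l∈L)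

  module Elimination {m} (c : Vector ℤ m) where

    -- Multipliers with unsuitable signs are replaced by 0, whose inequality 0 ≤ 0 is harmless; the
    -- new list is then a plain map and product without filtering. The same holds for `cancel`.
    keep : ℤ → Vector ℕ m → Vector ℕ m
    keep (+ zero) l = l
    keep _        l = λ _ → 0

    cancel : ℤ → ℤ → Vector ℕ m → Vector ℕ m → Vector ℕ m
    cancel (+ suc a) -[1+ b ] k l = combine (suc b) k (suc a) l
    cancel _         _        k l = λ _ → 0

    kept : Vector ℕ m → Vector ℕ m
    kept l = keep (pairing l c) l

    cancelled : Vector ℕ m → Vector ℕ m → Vector ℕ m
    cancelled k l = cancel (pairing k c) (pairing l c) k l

    -- A Fourier-Motzkin step performed on multipliers of the original rows rather than on the rows:
    -- `pairing l c` is the coefficient of the eliminated variable in the combination l.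
    eliminate : List (Vector ℕ m) → List (Vector ℕ m)
    eliminate L = List.map kept L List.++ List.cartesianProductWith cancelled L L

    eliminate-elim : ∀ (Q : Vector ℕ m → Set) L → (∀ {l} → l ∈ L → Q (kept l)) →
                     (∀ {k l} → k ∈ L → l ∈ L → Q (cancelled k l)) → ∀ {l} → l ∈ eliminate L → Q l
    eliminate-elim Q L p q l∈ with ∈-++⁻ (List.map kept L) l∈
    ... | inj₁ l∈kept with ∈-map⁻ kept l∈kept
    ...   | _ , k∈L , ≡.refl = p k∈L
    eliminate-elim Q L p q l∈ | inj₂ l∈cancelled with ∈-cartesianProductWith⁻ cancelled L L l∈cancelled
    ...   | _ , _ , j∈L , k∈L , ≡.refl = q j∈L k∈L

    pairing-value : ∀ l {z} → pairing l c ≡ z → ⟨ l , vecℤ ℝ c ⟩ ≈ fromℤ z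
    pairing-value l p = trans (sym (fromℤ-pairing l c)) (reflexive (≡.cong fromℤ p))

    eliminate-annihilates : ∀ L {l} → l ∈ eliminate L → ⟨ l , vecℤ ℝ c ⟩ ≈ 0#
    eliminate-annihilates L = eliminate-elim _ L (λ {l} _ → keep-0 l) (λ {k} {l} _ _ → cancel-0 k l)
      where
      keep-0 : ∀ l → ⟨ kept l , vecℤ ℝ c ⟩ ≈ 0#
      keep-0 l with pairing l c in eq
      ... | + zero   = pairing-value l eq
      ... | + suc _  = ⟨0,⟩ (vecℤ ℝ c)
      ... | -[1+ _ ] = ⟨0,⟩ (vecℤ ℝ c)
      cancel-0 : ∀ k l → ⟨ cancelled k l , vecℤ ℝ c ⟩ ≈ 0#
      cancel-0 k l with pairing k c in eqk | pairing l c in eql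
      ... | + zero   | _        = ⟨0,⟩ (vecℤ ℝ c)
      ... | -[1+ _ ] | _        = ⟨0,⟩ (vecℤ ℝ c)
      ... | + suc _  | + _      = ⟨0,⟩ (vecℤ ℝ c)
      ... | + suc a  | -[1+ b ] = begin
        ⟨ combine (suc b) k (suc a) l , vecℤ ℝ c ⟩
          ≈⟨ ⟨combine,⟩ (suc b) k (suc a) l (vecℤ ℝ c) ⟩
        fromℕ (suc b) * ⟨ k , vecℤ ℝ c ⟩ + fromℕ (suc a) * ⟨ l , vecℤ ℝ c ⟩
          ≈⟨ +-cong (*-congˡ (pairing-value k eqk)) (*-congˡ (pairing-value l eql)) ⟩
        fromℕ (suc b) * fromℕ (suc a) + fromℕ (suc a) * - fromℕ (suc b)
          ≈⟨ x+y*-x≈0 (fromℕ (suc a)) (fromℕ (suc b)) ⟩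
        0# ∎
        where open ≈R

    eliminate-preserves : ∀ L r → (∀ {l} → l ∈ L → ⟨ l , r ⟩ ≈ 0#) → ∀ {l} → l ∈ eliminate L →
        ⟨ l , r ⟩ ≈ 0#
    eliminate-preserves L r h = eliminate-elim _ L (λ {l} → keep-0 l) (λ {k} {l} → cancel-0 k l)
      where
      keep-0 : ∀ l → l ∈ L → ⟨ kept l , r ⟩ ≈ 0#
      keep-0 l p with pairing l c
      ... | + zero   = h p
      ... | + suc _  = ⟨0,⟩ r
      ... | -[1+ _ ] = ⟨0,⟩ r
      cancel-0 : ∀ k l → k ∈ L → l ∈ L → ⟨ cancelled k l , r ⟩ ≈ 0#
      cancel-0 k l p q with pairing k c | pairing l c
      ... | + zero   | _        = ⟨0,⟩ r
      ... | -[1+ _ ] | _        = ⟨0,⟩ r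
      ... | + suc _  | + _      = ⟨0,⟩ r
      ... | + suc a  | -[1+ b ] = begin
        ⟨ combine (suc b) k (suc a) l , r ⟩
          ≈⟨ ⟨combine,⟩ (suc b) k (suc a) l r ⟩
        fromℕ (suc b) * ⟨ k , r ⟩ + fromℕ (suc a) * ⟨ l , r ⟩
          ≈⟨ +-cong (*-congˡ (h p)) (*-congˡ (h q)) ⟩
        fromℕ (suc b) * 0# + fromℕ (suc a) * 0#
          ≈⟨ +-cong (zeroʳ _) (zeroʳ _) ⟩
        0# + 0#
          ≈⟨ +-identityʳ 0# ⟩
        0# ∎
        where open ≈R

    module _ (r : Vector Carrier m) where

      -- The condition 0 ≤ s - δ z solved for δ. For z = 0 it does not involve δ and is secured by
      -- the kept multiplier.
      boundAt : ℤ → Carrier → Bound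
      boundAt (+ zero)  s = none
      boundAt (+ suc a) s = upper (fromℕ (suc a) ⁻¹ * s)
      boundAt -[1+ b ]  s = lower (- (fromℕ (suc b) ⁻¹ * s))

      bound : Vector ℕ m → Bound
      bound l = boundAt (pairing l c) ⟨ l , r ⟩

      ⁻¹-cancel : ∀ n s → fromℕ (suc n) * (fromℕ (suc n) ⁻¹ * s) ≈ s
      ⁻¹-cancel n s = trans (x*[y*z]≈y*[x*z] (fromℕ (suc n)) _ s)
                            (*-inverse-cancel (fromℕ-pos (suc n)) s)

      bounds-compatible : ∀ L → Satisfies (eliminate L) r → ∀ {k l x y} → k ∈ L → l ∈ L →
                          bound k ≡ lower x → bound l ≡ upper y → x ≤ y
      bounds-compatible L sat {k} {l} k∈L l∈L
        with pairing k c in eqk | pairing l c in eql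
           | sat (∈-++⁺ʳ (List.map kept L) (∈-cartesianProductWith⁺ cancelled l∈L k∈L))
      ... | + zero   | _        | _ = λ ()
      ... | + suc _  | _        | _ = λ ()
      ... | -[1+ _ ] | -[1+ _ ] | _ = λ _ ()
      ... | -[1+ _ ] | + zero   | _ = λ _ ()
      ... | -[1+ b ] | + suc a  | p = λ { ≡.refl ≡.refl →
        lower≤upper (⁻¹-nonNeg (fromℕ-pos (suc a))) (⁻¹-nonNeg (fromℕ-pos (suc b)))
                    (⁻¹-cancel b ⟨ l , r ⟩) (⁻¹-cancel a ⟨ k , r ⟩)
                    (≤-respʳ-≈ (⟨combine,⟩ (suc b) l (suc a) k r) p) }

      eliminate-solve : ∀ L → Satisfies (eliminate L) r →
          ∃[ δ ] Satisfies L (λ i → r i - δ * fromℤ (c i))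
      eliminate-solve L sat with common-point bound L (bounds-compatible L sat)
      ... | δ , within = δ , λ {l} l∈L → ≤-respʳ-≈ (sym (⟨,⟩-linearʳ l r (vecℤ ℝ c) δ))
          (nonNeg l l∈L (within l∈L))
        where
        nonNeg : ∀ l → l ∈ L → Within δ (bound l) → 0# ≤ ⟨ l , r ⟩ - δ * ⟨ l , vecℤ ℝ c ⟩
        nonNeg l l∈L with pairing l c in eq | sat (∈-++⁺ˡ (∈-map⁺ kept l∈L))
        ... | + zero   | p = λ _ → ≤-respʳ-≈ (sym (trans
                (+-congˡ (trans (-‿cong (trans (*-congˡ (pairing-value l eq)) (zeroʳ δ))) -0#≈0#))
                (+-identityʳ _))) p
        ... | + suc a  | _ = upper-slack (fromℕ-nonNeg (suc a)) (⁻¹-cancel a ⟨ l , r ⟩)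
            (pairing-value l eq)
        ... | -[1+ b ] | _ = lower-slack (fromℕ-nonNeg (suc b)) (⁻¹-cancel b ⟨ l , r ⟩)
            (pairing-value l eq)
  open Elimination

  -- The slack of every row at x. The matrix is given by columns, so that eliminating a variable
  -- removes the head.
  residual : ∀ {m n} → Vector (Vector ℤ m) n → Vector Carrier m → Vector Carrier n → Vector Carrier m
  residual C b x i = b i - sum (λ j → fromℤ (C j i) * x j)

  residual-∷ : ∀ {m n} (C : Vector (Vector ℤ m) (suc n)) b δ (x : Vector Carrier n) i →
    residual (λ j → C (suc j)) (λ i → b i - δ * fromℤ (C zero i)) x i ≈ residual C b (δ Vector.∷ x) i
  residual-∷ C b δ x i = b-δc-s≈b-[cδ+s] (b i) δ (fromℤ (C zero i))
      (sum (λ j → fromℤ (C (suc j) i) * x j))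

  -- The list Λ is fixed before b: the right-hand side takes no part in the elimination, so one
  -- finite list decides solvability for every b.
  fourierMotzkin : ∀ {m} n (C : Vector (Vector ℤ m) n) (L : List (Vector ℕ m)) →
    ∃ λ Λ → (∀ j {l} → l ∈ Λ → ⟨ l , vecℤ ℝ (C j) ⟩ ≈ 0#) ×
            (∀ b → Satisfies Λ b → ∃ λ (x : Vector Carrier n) → Satisfies L (residual C b x))
  fourierMotzkin zero    C L = L , (λ ()) , λ b sat → (λ ()) ,
    Satisfies-cong L (λ i → sym (trans (+-congˡ -0#≈0#) (+-identityʳ (b i)))) sat
  fourierMotzkin {m} (suc n) C L with fourierMotzkin n (λ j → C (suc j)) L
  ... | Λ , annihilated , solvable = eliminate (C zero) Λ , annihilated′ , solvable′
    where
    annihilated′ : ∀ j {l} → l ∈ eliminate (C zero) Λ → ⟨ l , vecℤ ℝ (C j) ⟩ ≈ 0#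
    annihilated′ zero    = eliminate-annihilates (C zero) Λ
    annihilated′ (suc j) = eliminate-preserves (C zero) Λ (vecℤ ℝ (C (suc j))) (annihilated j)
    solvable′ : ∀ b → Satisfies (eliminate (C zero) Λ) b →
                ∃ λ (x : Vector Carrier (suc n)) → Satisfies L (residual C b x)
    solvable′ b sat =
      let (δ , sat′) = eliminate-solve (C zero) b Λ sat
          (x , sat″) = solvable (λ i → b i - δ * fromℤ (C zero i)) sat′
      in δ Vector.∷ x , Satisfies-cong L (residual-∷ C b δ x) sat″

  ⟨unit,⟩ : ∀ {m} (i : Fin m) r → ⟨ unit i , r ⟩ ≈ r i
  ⟨unit,⟩ {suc m} zero    r = trans (+-cong (trans (*-congʳ fromℤ-1) (*-identityˡ _))
      (⟨0,⟩ {m} (λ j → r (suc j)))) (+-identityʳ _)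
  ⟨unit,⟩ {suc m} (suc i) r = trans (+-cong (zeroˡ _) (⟨unit,⟩ i (λ j → r (suc j)))) (+-identityˡ _)

  matℤ : ∀ {m n} → Vector (Vector ℤ n) m → Vector (Vector Carrier n) m
  matℤ M i = vecℤ ℝ (M i)

  column : ∀ {m n} → Vector (Vector ℤ n) m → Fin n → Vector Carrier m
  column M j i = fromℤ (M i j)

  -- Starting the elimination from the unit multipliers means starting from the rows themselves,
  -- each of which asks for nonnegative slack.
  farkas : ∀ {m n} (M : Vector (Vector ℤ n) m) →
    ∃ λ Λ → (∀ {l} → l ∈ Λ → ∀ j → ⟨ l , column M j ⟩ ≈ 0#) ×
            (∀ b → Satisfies Λ b → ∃ λ x → Solutions ℝ (matℤ M) b x)
  farkas {m} {n} M with fourierMotzkin n (λ j i → M i j) (List.map unit (List.allFin m))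
  ... | Λ , annihilated , solvable = Λ , (λ l∈Λ j → annihilated j l∈Λ) , solutions
    where
    solutions : ∀ b → Satisfies Λ b → ∃ λ x → Solutions ℝ (matℤ M) b x
    solutions b sat with solvable b sat
    ... | x , sat′ = x , λ i → ≤-from-diff (sat′ (∈-map⁺ unit (∈-allFin i))) (sym (⟨unit,⟩ i _))

  infix 7 _·_
  _·_ : ∀ {n} → Vector Carrier n → Vector Carrier n → Carrier
  _·_ = _∙_ ℝ

  Solvesℤ : ∀ {m n} → Vector (Vector ℤ n) m → Vector Carrier m → Vector Carrier n → Set
  Solvesℤ M b = Solutions ℝ (matℤ M) b

  -- In the optimal case the dual solution is l / τ; keeping the denominator τ apart leaves the
  -- multipliers natural.
  data Outcome {m n} (M : Vector (Vector ℤ n) m) (b : Vector Carrier m) (a : Vector ℤ n) : Set where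
    infeasible : ∀ l → (∀ j → ⟨ l , column M j ⟩ ≈ 0#) → ⟨ l , b ⟩ < 0# → Outcome M b a
    unbounded  : (∀ t → ∃ λ x → Solvesℤ M b x × t ≤ vecℤ ℝ a · x) → Outcome M b a
    optimal    : ∀ x → Solvesℤ M b x → ∀ τ .{{_ : ℕ.NonZero τ}} l →
                 (∀ j → ⟨ l , column M j ⟩ ≈ fromℕ τ * fromℤ (a j)) →
                 ⟨ l , b ⟩ ≤ fromℕ τ * (vecℤ ℝ a · x) → Outcome M b a

  -- The ratio test without division: t is the largest value that all i with nonzero `τ i` admit,
  -- and the index attaining it will provide the dual solution.
  MinimumRatio : {I : Set} → (I → ℕ) → (I → Carrier) → List I → Set
  MinimumRatio τ β is =
    (∀ {i} → i ∈ is → τ i ≡ 0) ⊎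
    ∃[ t ] (∃[ i ] i ∈ is × τ i ≢ 0 × β i ≈ fromℕ (τ i) * t) ×
           (∀ {i} → i ∈ is → τ i ≢ 0 → fromℕ (τ i) * t ≤ β i)

  minimum-ratio : ∀ {I : Set} (τ : I → ℕ) (β : I → Carrier) (is : List I) → MinimumRatio τ β is
  minimum-ratio τ β [] = inj₁ λ ()
  minimum-ratio τ β (i ∷ is) with τ i ℕ.≟ 0 | minimum-ratio τ β is
  ... | yes τ≡0 | inj₁ all≡0 = inj₁ λ { (here ≡.refl) → τ≡0 ; (there p) → all≡0 p }
  ... | yes τ≡0 | inj₂ (t , (k , k∈ , k-rest) , t≤) = inj₂ (t , (k , there k∈ , k-rest) , λ where
    (here ≡.refl) τ≢0 → ⊥-elim (τ≢0 τ≡0)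
    (there p)     τ≢0 → t≤ p τ≢0)
  ... | no τ≢0 | rest = choose rest
    where
    0<τ : 0# < fromℕ (τ i)
    0<τ = fromℕ-pos (τ i) {{ℕ.≢-nonZero τ≢0}}
    u : Carrier
    u = fromℕ (τ i) ⁻¹ * β i
    βi≈τu : β i ≈ fromℕ (τ i) * u
    βi≈τu = sym (trans (x*[y*z]≈y*[x*z] _ _ _) (*-inverse-cancel 0<τ (β i)))
    choose : MinimumRatio τ β is → MinimumRatio τ β (i ∷ is)
    choose (inj₁ all≡0) = inj₂ (u , (i , here ≡.refl , τ≢0 , βi≈τu) , λ where
      (here ≡.refl) _ → ≤-reflexive (sym βi≈τu)
      (there p)   τ≢0 → ⊥-elim (τ≢0 (all≡0 p)))
    choose (inj₂ (t , (k , k∈ , k-rest) , t≤)) with ≤∨> u t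
    ... | inj₁ u≤t = inj₂ (u , (i , here ≡.refl , τ≢0 , βi≈τu) , λ where
      (here ≡.refl)   _ → ≤-reflexive (sym βi≈τu)
      {j} (there p) τ≢0 → ≤-trans (*-monoˡ-≤ (fromℕ-nonNeg (τ j)) u≤t) (t≤ p τ≢0))
    ... | inj₂ t<u = inj₂ (t , (k , there k∈ , k-rest) , λ where
      (here ≡.refl) _ → ≤-trans (*-monoˡ-≤ (fromℕ-nonNeg (τ i)) (<⇒≤ t<u)) (≤-reflexive (sym βi≈τu))
      (there p)   τ≢0 → t≤ p τ≢0)

  vecℤ-neg-∙ : ∀ {n} (a : Vector ℤ n) x → vecℤ ℝ (λ j → ℤ.- a j) · x ≈ - (vecℤ ℝ a · x)
  vecℤ-neg-∙ a x = trans (sum-cong-≋ (λ j → trans (*-congʳ (fromℤ-neg (a j))) (sym (-‿distribˡ-* _ _))))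
                         (sum-neg (λ j → fromℤ (a j) * x j))

  τ[-t]+s : ∀ τ t s → s - τ * t ≈ τ * (- t) + s
  τ[-t]+s = solve 3 (λ τ t s → s :- τ :* t := τ :* (:- t) :+ s) refl

  -- The objective is added as the constraint a·x ≥ t; the values of t admitted by the
  -- multipliers of the extended system have a rational maximum, or no bound at all.
  module _ {m n} (M : Vector (Vector ℤ n) m) (b : Vector Carrier m) (a : Vector ℤ n) where

    private
      M⁺ : Vector (Vector ℤ n) (suc m)
      M⁺ = (λ j → ℤ.- a j) Vector.∷ M

      Λ : List (Vector ℕ (suc m))
      Λ = proj₁ (farkas M⁺)

      τ : Vector ℕ (suc m) → ℕ
      τ l = l zero

      rest : Vector ℕ (suc m) → Vector ℕ m
      rest l i = l (suc i)

      rest-column : ∀ {l} → l ∈ Λ → ∀ j → ⟨ rest l , column M j ⟩ ≈ fromℕ (τ l) * fromℤ (a j)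
      rest-column {l} l∈Λ j = begin
        s                              ≈⟨ solve 3 (λ s t u →
            s := t :* u :+ (t :* (:- u) :+ s)) refl s t u ⟩
        t * u + (t * - u + s)          ≈⟨ +-congˡ (+-congʳ (*-congˡ (sym (fromℤ-neg (a j))))) ⟩
        t * u + (t * fromℤ (ℤ.- a j) + s)  ≈⟨ +-congˡ (proj₁ (proj₂ (farkas M⁺)) l∈Λ j) ⟩
        t * u + 0#                     ≈⟨ +-identityʳ _ ⟩
        t * u                          ∎
        where
        open ≈R
        s = ⟨ rest l , column M j ⟩
        t = fromℕ (τ l)
        u = fromℤ (a j)

      feasible-at : ∀ t → (∀ {l} → l ∈ Λ → fromℕ (τ l) * t ≤ ⟨ rest l , b ⟩) →
                    ∃ λ x → Solvesℤ M b x × t ≤ vecℤ ℝ a · x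
      feasible-at t h =
        let (x , sol) = proj₂ (proj₂ (farkas M⁺)) (- t Vector.∷ b)
                          (λ {l} l∈Λ → ≤-respʳ-≈ (τ[-t]+s (fromℕ (τ l)) t ⟨ rest l , b ⟩)
                              (diff-nonNeg (h l∈Λ)))
        in x , (λ i → sol (suc i)) ,
           ≤-resp-≈ (-‿involutive t) (-‿involutive _)
             (neg-mono-≤ (≤-respˡ-≈ (vecℤ-neg-∙ a x) (sol zero)))

      -- Such a multiplier avoids the objective row, so it refutes the original constraints for
      -- every t: a Farkas certificate of infeasibility.
      Violated : Vector ℕ (suc m) → Set
      Violated l = τ l ≡ 0 × ⟨ rest l , b ⟩ < 0#

      violated? : ∀ l → Dec (Violated l)
      violated? l = (τ l ℕ.≟ 0) ×-dec ¬? (0# ≤? ⟨ rest l , b ⟩)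

      τ≡0⇒ : ∀ l t → τ l ≡ 0 → fromℕ (τ l) * t ≈ 0#
      τ≡0⇒ l t τ≡0 = trans (*-congʳ (reflexive (≡.cong fromℕ τ≡0))) (zeroˡ t)

      from-violated : ∃ (λ l → l ∈ Λ × Violated l) → Outcome M b a
      from-violated (l , l∈Λ , τ≡0 , neg) =
        infeasible (rest l) (λ j → trans (rest-column l∈Λ j) (τ≡0⇒ l (fromℤ (a j)) τ≡0)) neg

      module _ (satisfied : ∀ {l} → l ∈ Λ → τ l ≡ 0 → 0# ≤ ⟨ rest l , b ⟩) where

        from-ratio : MinimumRatio τ (λ l → ⟨ rest l , b ⟩) Λ → Outcome M b a
        from-ratio (inj₁ all≡0) = unbounded λ t → feasible-at t λ {l} l∈Λ →
          ≤-respˡ-≈ (sym (τ≡0⇒ l t (all≡0 l∈Λ))) (satisfied l∈Λ (all≡0 l∈Λ))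
        from-ratio (inj₂ (t , (l , l∈Λ , τ≢0 , βl≈τt) , t≤)) =
          let (x , sol , t≤ax) = feasible-at t below
          in optimal x sol (τ l) {{ℕ.≢-nonZero τ≢0}} (rest l) (rest-column l∈Λ)
               (≤-respˡ-≈ (sym βl≈τt) (*-monoˡ-≤ (fromℕ-nonNeg (τ l)) t≤ax))
          where
          below : ∀ {l} → l ∈ Λ → fromℕ (τ l) * t ≤ ⟨ rest l , b ⟩
          below {l} l∈Λ with τ l ℕ.≟ 0
          ... | yes τ≡0 = ≤-respˡ-≈ (sym (τ≡0⇒ l t τ≡0)) (satisfied l∈Λ τ≡0)
          ... | no  τ≢0 = t≤ l∈Λ τ≢0

    linearProgram : Outcome M b a
    linearProgram with any? violated? Λ
    ... | yes some = from-violated (find some)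
    ... | no  ∄ = from-ratio (λ {l} l∈Λ τ≡0 → ≤-stable λ neg → ∄ (lose l∈Λ (τ≡0 , neg)))
                                (minimum-ratio τ (λ l → ⟨ rest l , b ⟩) Λ)

-- Tight differences and normal vectors of L-convex sets

module LConvexity (ℝ : Reals) where
  open OrderedField ℝ
  open import Data.List.Base using ([]; _∷_)
  open import Data.List.Relation.Unary.All using ([]; _∷_)
  open LinearProgramming ℝ

  -- The closure properties of L-convexity, which pass directly to products, negatives and
  -- preimages. `resp` is a field because an arbitrary predicate need not respect `_≈_`.
  record LClosed {N} (E : Pred (Vector Carrier N) 0ℓ) : Set where
    field
      resp       : ∀ {x y} → (∀ i → x i ≈ y i) → E x → E y
      ∨-closed   : ∀ {x y} → E x → E y → E (λ i → x i ⊔ y i)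
      ∧-closed   : ∀ {x y} → E x → E y → E (λ i → x i ⊓ y i)
      +𝟏-closed  : ∀ {x} → E x → ∀ μ → E (λ i → x i + μ)

  x≤x+ε : ∀ {x ε} → 0# ≤ ε → x ≤ x + ε
  x≤x+ε {x} {ε} p = ≤-from-diff p (solve 2 (λ x ε → (x :+ ε) :- x := ε) refl x ε)

  ⊓-pos : ∀ {x y} → 0# < x → 0# < y → 0# < x ⊓ y
  ⊓-pos {x} {y} p q with total x y
  ... | inj₁ _ = p
  ... | inj₂ _ = q

  raise : ∀ {N} → Vector Carrier N → Vec Bool N → Carrier → Vector Carrier N
  raise q X ε i = q i + (if lookup X i then ε else 0#)

  -- Phrased as a negation so that `¬-dec` applies to it for any predicate E.
  Tight : ∀ {N} → Pred (Vector Carrier N) 0ℓ → Vector Carrier N → Fin N → Fin N → Set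
  Tight E q i j = ¬ (∃[ y ] E y × q i - q j < y i - y j)

  -- If the tight differences at q do not leave X, then q can be raised on X inside E: for
  -- i ∈ X and j ∉ X take y ∈ E with yⱼ = qⱼ and yᵢ > qᵢ, and cut ⋀ⱼ ⋁ᵢ y off at q + ε.
  module Ascent {N} {E : Pred (Vector Carrier N) 0ℓ} (isL : LClosed E)
                {q : Vector Carrier N} (q∈E : E q) (X : Vec Bool N) where
    open LClosed isL

    -- Meeting the raised point with the translate q + δ𝟏 cuts the step down from ε to δ, so lattice
    -- closure takes the place of convexity.
    raise-shrink : ∀ {δ ε} → 0# ≤ δ → δ ≤ ε → E (raise q X ε) → E (raise q X δ)
    raise-shrink {δ} {ε} 0≤δ δ≤ε p = resp (λ i → pointwise i (lookup X i))
        (∧-closed p (+𝟏-closed q∈E δ))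
      where
      pointwise : ∀ i b → (q i + (if b then ε else 0#)) ⊓ (q i + δ) ≈ q i + (if b then δ else 0#)
      pointwise i true  = antisym (x⊓y≤y _ _) (⊓-glb (+-monoʳ-≤ (q i) δ≤ε) ≤-refl)
      pointwise i false = antisym (x⊓y≤x _ _) (⊓-glb ≤-refl (+-monoʳ-≤ (q i) 0≤δ))

    module _ (slack : ∀ i j → lookup X i ≡ true → lookup X j ≡ false → ¬ Tight E q i j) where

      AboveAt : Fin N → List (Fin N) → Set
      AboveAt j is = ∃₂ λ ε z → 0# < ε × E z × (∀ m → q m ≤ z m) × z j ≤ q j ×
                                (∀ i → i ∈ is → lookup X i ≡ true → q i + ε ≤ z i)

      -- A failure of tightness yields its witness only under double negation, so the finitely many
      -- witnesses are joined in continuation-passing style.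
      above : ∀ j → lookup X j ≡ false → ∀ is → ¬ ¬ AboveAt j is
      above j j∉X [] k = k (1# , q , 0<1 , q∈E , (λ _ → ≤-refl) , ≤-refl , λ _ ())
      above j j∉X (i ∷ is) k = above j j∉X is λ rest → extend rest (lookup X i) ≡.refl
        where
        extend : AboveAt j is → ∀ b → lookup X i ≡ b → ⊥
        extend (ε , z , 0<ε , z∈E , q≤z , zj≤ , zi≥) false i∉X =
            k (ε , z , 0<ε , z∈E , q≤z , zj≤ , λ where
          m (here ≡.refl) m∈X → ⊥-elim (Bool.not-¬ i∉X m∈X)
          m (there p)         → zi≥ m p)
        extend (ε , z , 0<ε , z∈E , q≤z , zj≤ , zi≥) true i∈X = slack i j i∈X j∉X λ (y , y∈E , gap) →
          -- `y′` is y translated to agree with q at j; its excess over q at i is then exactly `ε′`.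
          let ε′ = (y i - y j) - (q i - q j)
              y′ = λ m → y m + (q j - y j)
          in k (ε ⊓ ε′ , (λ m → z m ⊔ y′ m) ,
                ⊓-pos 0<ε (λ ε′≤0 → gap (≤-from-diff (diff-nonNeg ε′≤0)
                    (flip-diff (y i - y j) (q i - q j)))) ,
                ∨-closed z∈E (+𝟏-closed y∈E (q j - y j)) ,
                (λ m → ≤-trans (q≤z m) (x≤x⊔y (z m) (y′ m))) ,
                ⊔-lub zj≤ (≤-reflexive (x+[y-x]≈y (y j) (q j))) ,
                λ where
                  m (here ≡.refl) _ → ≤-trans (+-monoʳ-≤ (q i) (x⊓y≤y ε ε′))
                                        (≤-trans (≤-reflexive (jump (q i) (y i) (y j) (q j)))
                                            (x≤y⊔x (z i) (y′ i)))
                  m (there p) m∈X   → ≤-trans (+-monoʳ-≤ (q m) (x⊓y≤x ε ε′))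
                      (≤-trans (zi≥ m p m∈X) (x≤x⊔y (z m) (y′ m))))
          where
          flip-diff : ∀ a b → b - a ≈ 0# - (a - b)
          flip-diff = solve 2 (λ a b → b :- a := con 0ℤ :- (a :- b)) refl
          jump : ∀ qi yi yj qj → qi + ((yi - yj) - (qi - qj)) ≈ yi + (qj - yj)
          jump = solve 4 (λ qi yi yj qj → qi :+ ((yi :- yj) :- (qi :- qj)) := yi :+ (qj :- yj)) refl

      Ceiling : List (Fin N) → Set
      Ceiling js = ∃₂ λ ε z → 0# < ε × E z × (∀ m → q m ≤ z m) ×
                              (∀ i → lookup X i ≡ true → q i + ε ≤ z i) ×
                              (∀ j → j ∈ js → lookup X j ≡ false → z j ≤ q j)

      ceiling : ∀ js → ¬ ¬ Ceiling js
      ceiling [] k = k (1# , (λ m → q m + 1#) , 0<1 , +𝟏-closed q∈E 1# , (λ m → x≤x+ε 0≤1) ,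
          (λ _ _ → ≤-refl) , λ _ ())
      ceiling (j ∷ js) k = ceiling js λ rest → extend rest (lookup X j) ≡.refl
        where
        extend : Ceiling js → ∀ b → lookup X j ≡ b → ⊥
        extend (ε , z , 0<ε , z∈E , q≤z , zi≥ , zj≤) true j∈X =
            k (ε , z , 0<ε , z∈E , q≤z , zi≥ , λ where
          m (here ≡.refl) m∉X → ⊥-elim (Bool.not-¬ j∈X m∉X)
          m (there p)         → zj≤ m p)
        extend (ε , z , 0<ε , z∈E , q≤z , zi≥ , zj≤) false j∉X = above j j∉X (List.allFin N)
          λ (ε′ , z′ , 0<ε′ , z′∈E , q≤z′ , z′j≤ , z′i≥) →
          k (ε ⊓ ε′ , (λ m → z m ⊓ z′ m) , ⊓-pos 0<ε 0<ε′ , ∧-closed z∈E z′∈E ,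
             (λ m → ⊓-glb (q≤z m) (q≤z′ m)) ,
             (λ i i∈X → ⊓-glb (≤-trans (+-monoʳ-≤ (q i) (x⊓y≤x ε ε′)) (zi≥ i i∈X))
                              (≤-trans (+-monoʳ-≤ (q i) (x⊓y≤y ε ε′)) (z′i≥ i (∈-allFin i) i∈X))) ,
             λ where
               m (here ≡.refl) _ → ≤-trans (x⊓y≤y (z m) (z′ m)) z′j≤
               m (there p)   m∉X → ≤-trans (x⊓y≤x (z m) (z′ m)) (zj≤ m p m∉X))

      ascent : ¬ ¬ (∃[ ε ] 0# < ε × E (raise q X ε))
      ascent k = ceiling (List.allFin N) λ (ε , z , 0<ε , z∈E , q≤z , zi≥ , zj≤) →
        let pointwise : ∀ i b → lookup X i ≡ b → z i ⊓ (q i + ε) ≈ q i + (if b then ε else 0#)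
            pointwise = λ where
              i true  i∈X → antisym (x⊓y≤y _ _) (⊓-glb (zi≥ i i∈X) ≤-refl)
              i false i∉X → antisym (≤-trans (x⊓y≤x _ _) (≤-respʳ-≈ (sym (+-identityʳ (q i)))
                  (zj≤ i (∈-allFin i) i∉X)))
                              (⊓-glb (≤-respˡ-≈ (sym (+-identityʳ (q i))) (q≤z i))
                                  (+-monoʳ-≤ (q i) (<⇒≤ 0<ε)))
        in k (ε , 0<ε , resp (λ i → pointwise i (lookup X i) ≡.refl) (∧-closed z∈E (+𝟏-closed q∈E ε)))

  Normal : ∀ {N} → Pred (Vector Carrier N) 0ℓ → Vector Carrier N → Vector ℤ N → Set
  Normal E q v = ∀ y → E y → vecℤ ℝ v · y ≤ vecℤ ℝ v · q

  ·-raise : ∀ {N} (ω : Vector ℤ N) q X ε →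
      vecℤ ℝ ω · raise q X ε ≈ vecℤ ℝ ω · q + ε * fromℤ (weight ω X)
  ·-raise ω q X ε = begin
    vecℤ ℝ ω · raise q X ε
      ≈⟨ sum-cong-≋ (λ i → trans (distribˡ (fromℤ (ω i)) (q i) _) (+-congˡ (step i (lookup X i)))) ⟩
    sum (λ i → fromℤ (ω i) * q i + ε * fromℤ (χ X i ℤ.* ω i))
      ≈⟨ ∑-distrib-+ (λ i → fromℤ (ω i) * q i) (λ i → ε * fromℤ (χ X i ℤ.* ω i)) ⟩
    vecℤ ℝ ω · q + sum (λ i → ε * fromℤ (χ X i ℤ.* ω i))
      ≈⟨ +-congˡ (sym (*-distribˡ-sum ε (λ i → fromℤ (χ X i ℤ.* ω i)))) ⟩
    vecℤ ℝ ω · q + ε * sum (λ i → fromℤ (χ X i ℤ.* ω i))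
      ≈⟨ +-congˡ (*-congˡ (sym (fromℤ-sum (λ i → χ X i ℤ.* ω i)))) ⟩
    vecℤ ℝ ω · q + ε * fromℤ (weight ω X) ∎
    where
    open ≈R
    step : ∀ i b → fromℤ (ω i) * (if b then ε else 0#) ≈ ε * fromℤ ((if b then 1ℤ else 0ℤ) ℤ.* ω i)
    step i true  = trans (*-comm _ _) (*-congˡ (reflexive (≡.cong fromℤ (≡.sym (ℤ.*-identityˡ (ω i))))))
    step i false = trans (zeroʳ _) (sym (trans (*-congˡ (reflexive (≡.cong fromℤ (ℤ.*-zeroˡ (ω i)))))
        (zeroʳ ε)))

  addUnits : ∀ {N} → Vector ℤ N → ℕ → Fin N → Fin N → Vector ℤ N
  addUnits v k i j m = v m ℤ.+ + k ℤ.* (+ unit i m ℤ.- + unit j m)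

  ·-addUnits : ∀ {N} (v : Vector ℤ N) k i j y →
               vecℤ ℝ (addUnits v k i j) · y ≈ vecℤ ℝ v · y + fromℕ k * (y i - y j)
  ·-addUnits v k i j y = begin
    vecℤ ℝ (addUnits v k i j) · y
      ≈⟨ sum-cong-≋ (λ m → trans (*-congʳ (hom (v m) (+ k) (+ unit i m) (+ unit j m)))
          (expand _ _ _ _ (y m))) ⟩
    sum (λ m → fromℤ (v m) * y m + fromℕ k * (fromℕ (unit i m) * y m - fromℕ (unit j m) * y m))
      ≈⟨ ∑-distrib-+ (λ m → fromℤ (v m) * y m)
          (λ m → fromℕ k * (fromℕ (unit i m) * y m - fromℕ (unit j m) * y m)) ⟩
    vecℤ ℝ v · y + sum (λ m → fromℕ k * (fromℕ (unit i m) * y m - fromℕ (unit j m) * y m))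
      ≈⟨ +-congˡ (sym (*-distribˡ-sum (fromℕ k)
          (λ m → fromℕ (unit i m) * y m - fromℕ (unit j m) * y m))) ⟩
    vecℤ ℝ v · y + fromℕ k * sum (λ m → fromℕ (unit i m) * y m - fromℕ (unit j m) * y m)
      ≈⟨ +-congˡ (*-congˡ difference) ⟩
    vecℤ ℝ v · y + fromℕ k * (y i - y j) ∎
    where
    open ≈R
    hom : ∀ v k a b → fromℤ (v ℤ.+ k ℤ.* (a ℤ.- b)) ≈ fromℤ v + fromℤ k * (fromℤ a - fromℤ b)
    hom v k a b = trans (fromℤ-+ v (k ℤ.* (a ℤ.- b))) (+-congˡ (trans (fromℤ-* k (a ℤ.- b))
                    (*-congˡ (trans (fromℤ-+ a (ℤ.- b)) (+-congˡ (fromℤ-neg b))))))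
    expand : ∀ v k a b y → (v + k * (a - b)) * y ≈ v * y + k * (a * y - b * y)
    expand = solve 5 (λ v k a b y → (v :+ k :* (a :- b)) :* y := v :* y :+ k :* (a :* y :- b :* y)) refl
    difference : sum (λ m → fromℕ (unit i m) * y m - fromℕ (unit j m) * y m) ≈ y i - y j
    difference = begin
      sum (λ m → fromℕ (unit i m) * y m - fromℕ (unit j m) * y m)
        ≈⟨ ∑-distrib-+ (λ m → fromℕ (unit i m) * y m) (λ m → - (fromℕ (unit j m) * y m)) ⟩
      ⟨ unit i , y ⟩ + sum (λ m → - (fromℕ (unit j m) * y m))
        ≈⟨ +-congˡ (sum-neg (λ m → fromℕ (unit j m) * y m)) ⟩
      ⟨ unit i , y ⟩ - sum (λ m → fromℕ (unit j m) * y m)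
        ≈⟨ +-cong (⟨unit,⟩ i y) (-‿cong (⟨unit,⟩ j y)) ⟩
      y i - y j ∎

  -- Tightness of (i, j) says that e_i - e_j is normal at q, and normal vectors form a convex cone.
  Normal-addUnits : ∀ {N} {E : Pred (Vector Carrier N) 0ℓ} {q v} k {i j} →
                    Tight E q i j → Normal E q v → Normal E q (addUnits v k i j)
  Normal-addUnits {q = q} {v} k {i} {j} tight nv y y∈E =
    ≤-resp-≈ (sym (·-addUnits v k i j y)) (sym (·-addUnits v k i j q))
      (+-mono-≤ (nv y y∈E) (*-monoˡ-≤ (fromℕ-nonNeg k) (≤-stable λ gap → tight (y , y∈E , gap))))

  module NormalDecomposition {N} {E F : Pred (Vector Carrier N) 0ℓ}
         (E-isL : LClosed E) (F-isL : LClosed F)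
         {q : Vector Carrier N} (q∈E : E q) (q∈F : F q) where

    NormalSum : Vector ℤ N → Set
    NormalSum ω = ∃₂ λ v₁ v₂ → Normal E q v₁ × Normal F q v₂ × (∀ i → ω i ≡ v₁ i ℤ.+ v₂ i)

    TightPair : Fin N × Fin N → Set
    TightPair (i , j) = Tight E q i j ⊎ Tight F q i j

    tightPair? : ∀ a → Dec (TightPair a)
    tightPair? (i , j) = ¬-dec _ ⊎-dec ¬-dec _

    arcs : List (Fin N × Fin N)
    arcs = List.filter tightPair? (List.cartesianProduct (List.allFin N) (List.allFin N))

    tight-arcs : All TightPair arcs
    tight-arcs = All.all-filter tightPair? (List.cartesianProduct (List.allFin N) (List.allFin N))

    ∈-arcs : ∀ {i j} → TightPair (i , j) → (i , j) ∈ arcs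
    ∈-arcs t = ∈-filter⁺ tightPair? (∈-cartesianProduct⁺ (∈-allFin _) (∈-allFin _)) t

    -- Each arc is credited to a set in which it is tight, so the flow separates into an integer
    -- conic combination of normals for E and one for F.
    flow⇒normalSum : ∀ {L ω} → All TightPair L → Flow L ω → NormalSum ω
    flow⇒normalSum _ (stop ω≡0) = (λ _ → 0ℤ) , (λ _ → 0ℤ) , zero-normal , zero-normal , ω≡0
      where
      zero-normal : ∀ {E} → Normal E q (λ _ → 0ℤ)
      zero-normal y _ = ≤-reflexive (trans (sum-cong-≋ (λ m → zeroˡ (y m)))
          (sym (sum-cong-≋ (λ m → zeroˡ (q m)))))
    flow⇒normalSum (_ ∷ ts) (skip f) = flow⇒normalSum ts f
    flow⇒normalSum (t ∷ ts) (push {i} {j} {ω = ω} k f) with flow⇒normalSum ts f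
    ... | v₁ , v₂ , n₁ , n₂ , eq = add t
      where
      ω≡ : ∀ m → ω m ≡ v₁ m ℤ.+ v₂ m ℤ.+ + k ℤ.* (+ unit i m ℤ.- + unit j m)
      ω≡ m = ≡.trans (unshift (ω m) (+ k ℤ.* (+ unit i m ℤ.- + unit j m)))
                     (≡.cong (λ z → z ℤ.+ + k ℤ.* (+ unit i m ℤ.- + unit j m)) (eq m))
        where
        unshift : ∀ x y → x ≡ (x ℤ.- y) ℤ.+ y
        unshift = solve-∀
      add : TightPair (i , j) → NormalSum ω
      add (inj₁ tE) = addUnits v₁ k i j , v₂ , Normal-addUnits {v = v₁} k {i} {j} tE n₁ , n₂ ,
        λ m → ≡.trans (ω≡ m) (swap (v₁ m) (v₂ m) _)
        where
        swap : ∀ a b c → a ℤ.+ b ℤ.+ c ≡ a ℤ.+ c ℤ.+ b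
        swap = solve-∀
      add (inj₂ tF) = v₁ , addUnits v₂ k i j , n₁ , Normal-addUnits {v = v₂} k {i} {j} tF n₂ ,
        λ m → ≡.trans (ω≡ m) (ℤ.+-assoc (v₁ m) (v₂ m) _)

    module _ (ω : Vector ℤ N) (normal : ∀ y → E y → F y → vecℤ ℝ ω · y ≤ vecℤ ℝ ω · q) where

      raise⇒ : ∀ X ε → E (raise q X ε) → F (raise q X ε) → ε * fromℤ (weight ω X) ≤ 0#
      raise⇒ X ε e f = ≤-from-diff
          (diff-nonNeg (≤-respˡ-≈ (·-raise ω q X ε) (normal (raise q X ε) e f)))
        (solve 2 (λ a b → con 0ℤ :- b := a :- (a :+ b)) refl (vecℤ ℝ ω · q) _)

      raise-full : ∀ {E : Pred (Vector Carrier N) 0ℓ} → LClosed E → E q → ∀ μ → E (raise q full μ)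
      raise-full isL q∈E μ = LClosed.resp isL
        (λ i → reflexive (≡.cong (λ b → q i + (if b then μ else 0#))
            (≡.sym (Vec.lookup-replicate i true))))
        (LClosed.+𝟏-closed isL q∈E μ)

      -- Both sets are invariant under translation along 𝟏 in either direction, so a functional
      -- maximal at q is constant along 𝟏.
      total≡0 : weight ω full ≡ 0ℤ
      total≡0 = ℤ.≤-antisym (fromℤ-cancel-≤ (≤-respˡ-≈ (*-identityˡ _) (both 1#)))
        (fromℤ-cancel-≤ (≤-resp-≈ -0#≈0#
            (trans (-‿cong (trans (sym (-‿distribˡ-* _ _)) (-‿cong (*-identityˡ _)))) (-‿involutive _))
          (neg-mono-≤ (both (- 1#)))))
        where
        both : ∀ μ → μ * fromℤ (weight ω full) ≤ 0#
        both μ = raise⇒ full μ (raise-full E-isL q∈E μ) (raise-full F-isL q∈F μ)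

      -- No arc tight in E or in F leaves X, so q can be raised on X within each set. The smaller of
      -- the two steps works in both, and maximality at q then bounds the weight of X.
      closed⇒≤0 : ∀ X → Closed arcs X → weight ω X ℤ.≤ 0ℤ
      closed⇒≤0 X closed = fromℤ-cancel-≤ (≤-stable λ pos →
        Ascent.ascent E-isL q∈E X (leaves inj₁) λ (ε₁ , 0<ε₁ , e) →
        Ascent.ascent F-isL q∈F X (leaves inj₂) λ (ε₂ , 0<ε₂ , f) →
        let ε = ε₁ ⊓ ε₂
            0<ε = ⊓-pos 0<ε₁ 0<ε₂
        in pos (*-cancelˡ-≤ 0<ε (≤-respʳ-≈ (sym (zeroʳ ε))
             (raise⇒ X ε (Ascent.raise-shrink E-isL q∈E X (<⇒≤ 0<ε) (x⊓y≤x ε₁ ε₂) e)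
                         (Ascent.raise-shrink F-isL q∈F X (<⇒≤ 0<ε) (x⊓y≤y ε₁ ε₂) f)))))
        where
        leaves : ∀ {T : Fin N → Fin N → Set} → (∀ {i j} → T i j → TightPair (i , j)) →
                 ∀ i j → lookup X i ≡ true → lookup X j ≡ false → ¬ T i j
        leaves inj i j i∈X j∉X t = Bool.not-¬ j∉X (All.lookup closed (∈-arcs (inj t)) i∈X)

      normal-decomposition : NormalSum ω
      normal-decomposition = flow⇒normalSum tight-arcs (decompose arcs ω total≡0 closed⇒≤0)

unit-value : ∀ {m} (i j : Fin m) → unit i j ≡ 0 ⊎ (i ≡ j × unit i j ≡ 1)
unit-value zero    zero    = inj₂ (≡.refl , ≡.refl)
unit-value zero    (suc j) = inj₁ ≡.refl
unit-value (suc i) zero    = inj₁ ≡.refl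
unit-value (suc i) (suc j) with unit-value i j
... | inj₁ u≡0         = inj₁ u≡0
... | inj₂ (i≡j , u≡1) = inj₂ (≡.cong suc i≡j , u≡1)

-- Homogenisation of L♮-convex sets and the doubling of coordinates

module L♮Convexity (ℝ : Reals) where
  open OrderedField ℝ
  open import Data.Vec.Functional using (_++_; _∷_; [])
  open LinearProgramming ℝ
  open LConvexity ℝ

  Solutions-resp : ∀ {m n} {A : Vector (Vector Carrier n) m} {b} {x y : Vector Carrier n} →
                   (∀ i → x i ≈ y i) → Solutions ℝ A b x → Solutions ℝ A b y
  Solutions-resp p sol i = ≤-respˡ-≈ (sum-cong-≋ (λ j → *-congˡ (p j))) (sol i)

  isLConvex⇒LClosed : ∀ {n} {P : Pred (Vector Carrier n) 0ℓ} → IsLConvex ℝ P → LClosed P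
  isLConvex⇒LClosed {P = P} isL = record
    { resp      = λ p x∈P → let (_ , _ , _ , to , from) = isPolyhedron in from
        (Solutions-resp p (to x∈P))
    ; ∨-closed  = ∨-closed
    ; ∧-closed  = ∧-closed
    ; +𝟏-closed = +𝟏-closed
    }
    where open IsLConvex isL

  -- L♮-convexity in homogeneous form; coordinate 0 carries the constant.
  IsSection : ∀ {n} → Pred (Vector Carrier n) 0ℓ → Set₁
  IsSection {n} P = ∃[ Q ] LClosed {suc n} Q × P ≐ λ x → Q (0# ∷ x)

  -- P is a section of the cylinder in which coordinate 0 is free; the L-convex case thus becomes an
  -- instance of the L♮ one.
  isLConvex⇒isSection : ∀ {n} {P : Pred (Vector Carrier n) 0ℓ} → IsLConvex ℝ P → IsSection P
  isLConvex⇒isSection {P = P} isL = (λ q → P (λ i → q (suc i))) , record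
    { resp      = λ p → resp (λ i → p (suc i))
    ; ∨-closed  = ∨-closed
    ; ∧-closed  = ∧-closed
    ; +𝟏-closed = +𝟏-closed
    } , (λ x∈P → x∈P) , (λ x∈P → x∈P)
    where open LClosed (isLConvex⇒LClosed isL)

  -- Moves the homogenising coordinate from the front, where pattern matching reaches it, to the
  -- end, where `IsL♮Convex` has it.
  rotate : ∀ {n} → Vector Carrier (suc n) → Vector Carrier (n ℕ.+ 1)
  rotate q = (λ i → q (suc i)) ++ (q zero ∷ [])

  isL♮Convex⇒isSection : ∀ {n} {P : Pred (Vector Carrier n) 0ℓ} → IsL♮Convex ℝ P → IsSection P
  isL♮Convex⇒isSection {n} (_ , Q , isL , P⊆ , ⊆P) = (λ q → Q (rotate q)) , record
    { resp      = λ p → resp (pointwise₁ p)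
    ; ∨-closed  = λ {x} {y} p q → resp (pointwise₂ _⊔_ x y) (∨-closed p q)
    ; ∧-closed  = λ {x} {y} p q → resp (pointwise₂ _⊓_ x y) (∧-closed p q)
    ; +𝟏-closed = λ {x} p μ → resp (pointwise₂ _+_ x (λ _ → μ)) (resp (λ k → +-congˡ (constant μ k))
        (+𝟏-closed p μ))
    } , P⊆ , ⊆P
    where
    open LClosed (isLConvex⇒LClosed isL)
    pointwise₁ : ∀ {x y : Vector Carrier (suc n)} → (∀ i → x i ≈ y i) → ∀ k → rotate x k ≈ rotate y k
    pointwise₁ p k with splitAt n k
    ... | inj₁ i    = p (suc i)
    ... | inj₂ zero = p zero
    pointwise₂ : ∀ (_•_ : Carrier → Carrier → Carrier) (x y : Vector Carrier (suc n)) k →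
                 rotate x k • rotate y k ≈ rotate (λ i → x i • y i) k
    pointwise₂ _•_ x y k with splitAt n k
    ... | inj₁ i    = refl
    ... | inj₂ zero = refl
    constant : ∀ μ k → μ ≈ rotate (λ _ → μ) k
    constant μ k with splitAt n k
    ... | inj₁ i    = refl
    ... | inj₂ zero = refl

  sum-↑ : ∀ m {n} (f : Vector Carrier (m ℕ.+ n)) →
          sum f ≈ sum (λ i → f (i ↑ˡ n)) + sum (λ j → f (m ↑ʳ j))
  sum-↑ zero    f = sym (+-identityˡ _)
  sum-↑ (suc m) f = trans (+-congˡ (sum-↑ m (λ i → f (suc i)))) (sym (+-assoc _ _ _))

  neg-⊔ : ∀ x y → (- x) ⊓ (- y) ≈ - (x ⊔ y)
  neg-⊔ x y = antisym
    (≤-respˡ-≈ (-‿involutive _) (neg-mono-≤ (⊔-lub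
      (≤-respˡ-≈ (-‿involutive x) (neg-mono-≤ (x⊓y≤x (- x) (- y))))
      (≤-respˡ-≈ (-‿involutive y) (neg-mono-≤ (x⊓y≤y (- x) (- y)))))))
    (⊓-glb (neg-mono-≤ (x≤x⊔y x y)) (neg-mono-≤ (x≤y⊔x x y)))

  neg-⊓ : ∀ x y → (- x) ⊔ (- y) ≈ - (x ⊓ y)
  neg-⊓ x y = antisym
    (⊔-lub (neg-mono-≤ (x⊓y≤x x y)) (neg-mono-≤ (x⊓y≤y x y)))
    (≤-respʳ-≈ (-‿involutive _) (neg-mono-≤ (⊓-glb
      (≤-respʳ-≈ (-‿involutive x) (neg-mono-≤ (x≤x⊔y (- x) (- y))))
      (≤-respʳ-≈ (-‿involutive y) (neg-mono-≤ (x≤y⊔x (- x) (- y)))))))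

  module Doubled (N : ℕ) where

    left right : Vector Carrier (N ℕ.+ N) → Vector Carrier N
    left  q i = q (i ↑ˡ N)
    right q i = q (N ↑ʳ i)

    leftℤ rightℤ : Vector ℤ (N ℕ.+ N) → Vector ℤ N
    leftℤ  v i = v (i ↑ˡ N)
    rightℤ v i = v (N ↑ʳ i)

    left-++ : ∀ (σ ρ : Vector Carrier N) i → left (σ ++ ρ) i ≈ σ i
    left-++ σ ρ i = reflexive (Vector.lookup-++ˡ σ ρ i)

    right-++ : ∀ (σ ρ : Vector Carrier N) i → right (σ ++ ρ) i ≈ ρ i
    right-++ σ ρ i = reflexive (Vector.lookup-++ʳ σ ρ i)

    ·-++ : ∀ (v : Vector ℤ (N ℕ.+ N)) y →
           vecℤ ℝ v · y ≈ vecℤ ℝ (leftℤ v) · left y + vecℤ ℝ (rightℤ v) · right y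
    ·-++ v y = sum-↑ N (λ k → fromℤ (v k) * y k)

    difference : Vector Carrier (N ℕ.+ N) → Vector Carrier N
    difference y i = left y i - right y i

    -- A functional of the form (a, -a) sees only the difference of the two halves, that is, the sum
    -- s + t once the second half carries -t.
    ·-antisymmetric : ∀ (v : Vector ℤ (N ℕ.+ N)) → (∀ i → rightℤ v i ≡ ℤ.- leftℤ v i) → ∀ y →
                      vecℤ ℝ v · y ≈ vecℤ ℝ (leftℤ v) · difference y
    ·-antisymmetric v v-anti y = begin
      vecℤ ℝ v · y
        ≈⟨ ·-++ v y ⟩
      sum (λ i → fromℤ (leftℤ v i) * left y i) + sum (λ i → fromℤ (rightℤ v i) * right y i)
        ≈⟨ sym (∑-distrib-+ (λ i → fromℤ (leftℤ v i) * left y i)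
            (λ i → fromℤ (rightℤ v i) * right y i)) ⟩
      sum (λ i → fromℤ (leftℤ v i) * left y i + fromℤ (rightℤ v i) * right y i)
        ≈⟨ sum-cong-≋ (λ i →
            trans (+-congˡ (*-congʳ (trans (reflexive (≡.cong fromℤ (v-anti i)))
            (fromℤ-neg (leftℤ v i)))))
                              (factor (fromℤ (leftℤ v i)) (left y i) (right y i))) ⟩
      vecℤ ℝ (leftℤ v) · difference y ∎
      where
      open ≈R
      factor : ∀ a x y → a * x + - a * y ≈ a * (x - y)
      factor = solve 3 (λ a x y → a :* x :+ (:- a) :* y := a :* (x :- y)) refl

    Paired : Pred (Vector Carrier N) 0ℓ → Pred (Vector Carrier N) 0ℓ →
        Pred (Vector Carrier (N ℕ.+ N)) 0ℓ
    Paired Q₁ Q₂ q = Q₁ (left q) × Q₂ (λ i → - right q i)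

    -- Negation exchanges ∨ and ∧ and reverses translations, so it preserves L-closedness of the
    -- second factor.
    Paired-isL : ∀ {Q₁ Q₂} → LClosed Q₁ → LClosed Q₂ → LClosed (Paired Q₁ Q₂)
    Paired-isL isL₁ isL₂ = record
      { resp      = λ p (e₁ , e₂) → 
          L₁.resp (λ i → p (i ↑ˡ N)) e₁ , L₂.resp (λ i → -‿cong (p (N ↑ʳ i))) e₂
      ; ∨-closed  = λ {x} {y} (e₁ , e₂) (f₁ , f₂) →
          L₁.∨-closed e₁ f₁ , L₂.resp (λ i → neg-⊔ (right x i) (right y i)) (L₂.∧-closed e₂ f₂)
      ; ∧-closed  = λ {x} {y} (e₁ , e₂) (f₁ , f₂) →
          L₁.∧-closed e₁ f₁ , L₂.resp (λ i → neg-⊓ (right x i) (right y i)) (L₂.∨-closed e₂ f₂)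
      ; +𝟏-closed = λ {x} (e₁ , e₂) μ →
          L₁.+𝟏-closed e₁ μ , L₂.resp (λ i → -‿+-comm (right x i) μ) (L₂.+𝟏-closed e₂ (- μ))
      }
      where
      module L₁ = LClosed isL₁
      module L₂ = LClosed isL₂

    DiffBounded : Vector Carrier N → Vector Carrier N → Pred (Vector Carrier (N ℕ.+ N)) 0ℓ
    DiffBounded lo hi q = ∀ i → left q i ≤ hi i + right q i × lo i + right q i ≤ left q i

    -- Bounds on the difference of two coordinates survive ∨, ∧ and translation by 𝟏, whereas bounds
    -- on a sum would not. This is why t enters with a negative sign.
    DiffBounded-isL : ∀ lo hi → LClosed (DiffBounded lo hi)
    DiffBounded-isL lo hi = record
      { resp      = λ p f i → ≤-resp-≈ (p (i ↑ˡ N)) (+-congˡ (p (N ↑ʳ i))) (proj₁ (f i)) ,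
                              ≤-resp-≈ (+-congˡ (p (N ↑ʳ i))) (p (i ↑ˡ N)) (proj₂ (f i))
      ; ∨-closed  = λ f g i → ⊔-mono (proj₁ (f i)) (proj₁ (g i)) , ⊔-mono′ (proj₂ (f i)) (proj₂ (g i))
      ; ∧-closed  = λ f g i → ⊓-mono (proj₁ (f i)) (proj₁ (g i)) , ⊓-mono′ (proj₂ (f i)) (proj₂ (g i))
      ; +𝟏-closed = λ f μ i → ≤-respʳ-≈ (+-assoc _ _ _) (+-mono-≤ (proj₁ (f i)) ≤-refl) ,
                              ≤-respˡ-≈ (+-assoc _ _ _) (+-mono-≤ (proj₂ (f i)) ≤-refl)
      }
      where
      ⊔-mono : ∀ {a b a′ b′ c} → a ≤ c + b → a′ ≤ c + b′ → a ⊔ a′ ≤ c + (b ⊔ b′)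
      ⊔-mono {b = b} {b′ = b′} {c} p q = ⊔-lub (≤-trans p (+-monoʳ-≤ c (x≤x⊔y b b′)))
          (≤-trans q (+-monoʳ-≤ c (x≤y⊔x b b′)))
      ⊓-mono : ∀ {a b a′ b′ c} → a ≤ c + b → a′ ≤ c + b′ → a ⊓ a′ ≤ c + (b ⊓ b′)
      ⊓-mono {a} {b} {a′} {b′} p q with total b b′
      ... | inj₁ _ = ≤-trans (x⊓y≤x a a′) p
      ... | inj₂ _ = ≤-trans (x⊓y≤y a a′) q
      ⊔-mono′ : ∀ {a b a′ b′ c} → c + b ≤ a → c + b′ ≤ a′ → c + (b ⊔ b′) ≤ a ⊔ a′
      ⊔-mono′ {a} {b} {a′} {b′} p q with total b′ b
      ... | inj₁ _ = ≤-trans p (x≤x⊔y a a′)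
      ... | inj₂ _ = ≤-trans q (x≤y⊔x a a′)
      ⊓-mono′ : ∀ {a b a′ b′ c} → c + b ≤ a → c + b′ ≤ a′ → c + (b ⊓ b′) ≤ a ⊓ a′
      ⊓-mono′ {b = b} {b′ = b′} {c} p q = ⊓-glb (≤-trans (+-monoʳ-≤ c (x⊓y≤x b b′)) p)
          (≤-trans (+-monoʳ-≤ c (x⊓y≤y b b′)) q)

-- Splitting an integer normal of P ∩ [lo, hi] into a normal of P and a box part

module BoxNormality (ℝ : Reals) where
  open OrderedField ℝ
  open import Data.Vec.Functional using (_++_; _∷_; [])
  open LinearProgramming ℝ
  open LConvexity ℝ
  open L♮Convexity ℝ

  ·-congʳ : ∀ {n} (u : Vector Carrier n) {x y} → (∀ i → x i ≈ y i) → u · x ≈ u · y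
  ·-congʳ u p = sum-cong-≋ (λ i → *-congˡ (p i))

  bump : ∀ {n} → Vector Carrier n → Fin n → Carrier → Vector Carrier n
  bump z i ε m = z m + fromℕ (unit i m) * ε

  ·-bump : ∀ {n} (a : Vector ℤ n) z i ε → vecℤ ℝ a · bump z i ε ≈ vecℤ ℝ a · z + fromℤ (a i) * ε
  ·-bump a z i ε = begin
    vecℤ ℝ a · bump z i ε
      ≈⟨ sum-cong-≋ (λ m → expand (fromℤ (a m)) (z m) (fromℕ (unit i m)) ε) ⟩
    sum (λ m → fromℤ (a m) * z m + (fromℕ (unit i m) * fromℤ (a m)) * ε)
      ≈⟨ ∑-distrib-+ (λ m → fromℤ (a m) * z m) (λ m → (fromℕ (unit i m) * fromℤ (a m)) * ε) ⟩
    vecℤ ℝ a · z + sum (λ m → (fromℕ (unit i m) * fromℤ (a m)) * ε)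
      ≈⟨ +-congˡ (sym (*-distribʳ-sum ε (λ m → fromℕ (unit i m) * fromℤ (a m)))) ⟩
    vecℤ ℝ a · z + ⟨ unit i , vecℤ ℝ a ⟩ * ε
      ≈⟨ +-congˡ (*-congʳ (⟨unit,⟩ i (vecℤ ℝ a))) ⟩
    vecℤ ℝ a · z + fromℤ (a i) * ε ∎
    where
    open ≈R
    expand : ∀ a z u ε → a * (z + u * ε) ≈ a * z + (u * a) * ε
    expand = solve 4 (λ a z u ε → a :* (z :+ u :* ε) := a :* z :+ (u :* a) :* ε) refl

  bump-other : ∀ {n} (z : Vector Carrier n) i m ε → unit i m ≡ 0 → bump z i ε m ≈ z m
  bump-other z i m ε u≡0 = trans (+-congˡ (trans (*-congʳ (reflexive (≡.cong fromℕ u≡0))) (zeroˡ ε)))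
      (+-identityʳ _)

  bump-same : ∀ {n} (z : Vector Carrier n) i m ε → unit i m ≡ 1 → bump z i ε m ≈ z m + ε
  bump-same z i m ε u≡1 = +-congˡ (trans (*-congʳ (trans (reflexive (≡.cong fromℕ u≡1)) fromℤ-1))
      (*-identityˡ ε))

  *ε≤0⇒≤0 : ∀ z {ε} → 0# < ε → fromℤ z * ε ≤ 0# → z ℤ.≤ 0ℤ
  *ε≤0⇒≤0 z {ε} 0<ε p = fromℤ-cancel-≤ (*-cancelˡ-≤ 0<ε (≤-resp-≈ (*-comm _ _) (sym (zeroʳ ε)) p))

  *-ε≤0⇒≥0 : ∀ z {ε} → 0# < ε → fromℤ z * (- ε) ≤ 0# → 0ℤ ℤ.≤ z
  *-ε≤0⇒≥0 z {ε} 0<ε p = fromℤ-cancel-≤ (*-cancelˡ-≤ 0<ε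
    (≤-resp-≈ (trans -0#≈0# (sym (zeroʳ ε))) (trans (-‿cong (sym (-‿distribʳ-* _ _)))
        (trans (-‿involutive _) (*-comm _ _))) (neg-mono-≤ p)))

  module _ {n} {P P₁ P₂ : Pred (Vector Carrier n) 0ℓ}
           (section₁ : IsSection P₁) (section₂ : IsSection P₂)
           (P≐ : P ≐ _⊕_ ℝ P₁ P₂) (lo hi : Vector Carrier n) where

    open Doubled (suc n)

    private
      N = suc n
      Q₁ = proj₁ section₁
      Q₂ = proj₁ section₂
      E = Paired Q₁ Q₂
      -- The zero bounds at coordinate 0 identify the homogenising coordinates of the two halves, so
      -- a single translation of the pair brings both to 0.
      F = DiffBounded (0# ∷ lo) (0# ∷ hi)
      isL₁ = proj₁ (proj₂ section₁)
      isL₂ = proj₁ (proj₂ section₂)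
      E-isL = Paired-isL isL₁ isL₂
      F-isL = DiffBounded-isL (0# ∷ lo) (0# ∷ hi)

    InBox : Vector Carrier n → Set
    InBox x = ∀ i → lo i ≤ x i × x i ≤ hi i

    -- In these coordinates lo ≤ x ≤ hi bounds the differences between the two halves.
    encode : Vector Carrier n → Vector Carrier n → Vector Carrier (N ℕ.+ N)
    encode s t = (0# ∷ s) ++ (λ i → - (0# ∷ t) i)

    encode-∈E : ∀ {s t} → P₁ s → P₂ t → E (encode s t)
    encode-∈E {s} {t} s∈ t∈ =
      LClosed.resp isL₁ (λ i → sym (left-++ (0# ∷ s) (λ i → - (0# ∷ t) i) i))
          (proj₁ (proj₂ (proj₂ section₁)) s∈) ,
      LClosed.resp isL₂ (λ i → sym (trans (-‿cong (right-++ (0# ∷ s) (λ i → - (0# ∷ t) i) i))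
          (-‿involutive ((0# ∷ t) i)))) (proj₁ (proj₂ (proj₂ section₂)) t∈)

    pair-∈F : ∀ (σ ρ : Vector Carrier N) → (∀ i → σ i ≤ (0# ∷ hi) i + ρ i × (0# ∷ lo) i + ρ i ≤ σ i) →
        F (σ ++ ρ)
    pair-∈F σ ρ h i = ≤-resp-≈ (sym (left-++ σ ρ i)) (+-congˡ (sym (right-++ σ ρ i))) (proj₁ (h i)) ,
                      ≤-resp-≈ (+-congˡ (sym (right-++ σ ρ i))) (sym (left-++ σ ρ i)) (proj₂ (h i))

    ·-encode : ∀ (v : Vector ℤ (N ℕ.+ N)) → (∀ i → rightℤ v i ≡ ℤ.- leftℤ v i) → ∀ s t →
               vecℤ ℝ v · encode s t ≈ vecℤ ℝ (λ i → leftℤ v (suc i)) · (λ i → s i + t i)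
    ·-encode v v-anti s t = begin
      vecℤ ℝ v · encode s t
        ≈⟨ ·-antisymmetric v v-anti (encode s t) ⟩
      vecℤ ℝ (leftℤ v) · difference (encode s t)
        ≈⟨ ·-congʳ (vecℤ ℝ (leftℤ v)) (λ i → +-cong (left-++ (0# ∷ s) (λ i → - (0# ∷ t) i) i)
             (-‿cong (right-++ (0# ∷ s) (λ i → - (0# ∷ t) i) i))) ⟩
      vecℤ ℝ (leftℤ v) · (λ i → (0# ∷ s) i - - (0# ∷ t) i)
        ≈⟨ +-cong (trans (*-congˡ (trans (+-identityˡ _) (-‿involutive 0#))) (zeroʳ _))
                  (·-congʳ (λ i → fromℤ (leftℤ v (suc i))) (λ i → +-congˡ (-‿involutive (t i)))) ⟩
      0# + vecℤ ℝ (λ i → leftℤ v (suc i)) · (λ i → s i + t i)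
        ≈⟨ +-identityˡ _ ⟩
      vecℤ ℝ (λ i → leftℤ v (suc i)) · (λ i → s i + t i) ∎
      where open ≈R

    decode : ∀ y → E y → F y → P (λ i → difference y (suc i))
    decode y (e₁ , e₂) f = proj₂ P≐ ((λ i → left y (suc i) - left y zero) ,
        (λ i → - right y (suc i) + left y zero) ,
      proj₂ (proj₂ (proj₂ section₁)) (LClosed.resp isL₁ (λ where
        zero    → -‿inverseʳ (left y zero)
        (suc i) → refl) (LClosed.+𝟏-closed isL₁ e₁ (- left y zero))) ,
      proj₂ (proj₂ (proj₂ section₂)) (LClosed.resp isL₂ (λ where
        zero    → trans (+-congˡ root) (-‿inverseˡ (right y zero))
        (suc i) → refl) (LClosed.+𝟏-closed isL₂ e₂ (left y zero))) ,
      λ i → split (left y (suc i)) (right y (suc i)) (left y zero))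
      where
      root : left y zero ≈ right y zero
      root = antisym (≤-respʳ-≈ (+-identityˡ _) (proj₁ (f zero)))
          (≤-respˡ-≈ (+-identityˡ _) (proj₂ (f zero)))
      split : ∀ a b c → a - b ≈ (a - c) + (- b + c)
      split = solve 3 (λ a b c → a :- b := (a :- c) :+ ((:- b) :+ c)) refl

    decode-InBox : ∀ y → F y → InBox (λ i → difference y (suc i))
    decode-InBox y f i = ≤-from-diff (diff-nonNeg (proj₂ (f (suc i))))
        (low (lo i) (left y (suc i)) (right y (suc i))) ,
                         ≤-from-diff (diff-nonNeg (proj₁ (f (suc i))))
                             (high (hi i) (left y (suc i)) (right y (suc i)))
      where
      low : ∀ l a b → (a - b) - l ≈ a - (l + b)
      low = solve 3 (λ l a b → (a :- b) :- l := a :- (l :+ b)) refl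
      high : ∀ h a b → h - (a - b) ≈ (h + b) - a
      high = solve 3 (λ h a b → h :- (a :- b) := (h :+ b) :- a) refl

    module _ (w : Vector ℤ n) (x : Vector Carrier n) (x∈P : P x) (x∈box : InBox x)
             (maximal : ∀ y → P y → InBox y → vecℤ ℝ w · y ≤ vecℤ ℝ w · x) where

      private
        s = proj₁ (proj₁ P≐ x∈P)
        t = proj₁ (proj₂ (proj₁ P≐ x∈P))
        s∈P₁ = proj₁ (proj₂ (proj₂ (proj₁ P≐ x∈P)))
        t∈P₂ = proj₁ (proj₂ (proj₂ (proj₂ (proj₁ P≐ x∈P))))
        x≈s+t = proj₂ (proj₂ (proj₂ (proj₂ (proj₁ P≐ x∈P))))
        σ ρ : Vector Carrier N
        σ = 0# ∷ s
        ρ i = - (0# ∷ t) i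
        q = encode s t

        ω : Vector ℤ (N ℕ.+ N)
        ω = (0ℤ ∷ w) ++ (λ i → ℤ.- (0ℤ ∷ w) i)

        leftℤ-ω : ∀ i → leftℤ ω i ≡ (0ℤ ∷ w) i
        leftℤ-ω = Vector.lookup-++ˡ (0ℤ ∷ w) (λ i → ℤ.- (0ℤ ∷ w) i)

        ω-anti : ∀ i → rightℤ ω i ≡ ℤ.- leftℤ ω i
        ω-anti i = ≡.trans (Vector.lookup-++ʳ (0ℤ ∷ w) (λ i → ℤ.- (0ℤ ∷ w) i) i)
            (≡.cong ℤ.-_ (≡.sym (leftℤ-ω i)))

        ·-leftℤ-ω : ∀ z → vecℤ ℝ (λ i → leftℤ ω (suc i)) · z ≈ vecℤ ℝ w · z
        ·-leftℤ-ω z = sum-cong-≋ (λ i → *-congʳ {z i} (reflexive (≡.cong fromℤ (leftℤ-ω (suc i)))))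

        ·-ω : ∀ y → vecℤ ℝ ω · y ≈ vecℤ ℝ w · (λ i → difference y (suc i))
        ·-ω y = trans (·-antisymmetric ω ω-anti y)
                  (trans (+-cong (trans (*-congʳ (reflexive (≡.cong fromℤ (leftℤ-ω zero)))) (zeroˡ _))
                      (·-leftℤ-ω (λ i → difference y (suc i))))
                         (+-identityˡ _))

        ·-ω-q : vecℤ ℝ ω · q ≈ vecℤ ℝ w · x
        ·-ω-q = trans (·-encode ω ω-anti s t)
                  (trans (·-leftℤ-ω (λ i → s i + t i)) (·-congʳ (vecℤ ℝ w) (λ i → sym (x≈s+t i))))

        upper-gap : ∀ h a b x → x ≈ a + b → (h + - b) - a ≈ h - x
        upper-gap h a b x p = trans (solve 3 (λ h a b → (h :+ (:- b)) :- a := h :- (a :+ b)) refl h a b)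
            (+-congˡ (-‿cong (sym p)))

        lower-gap : ∀ l a b x → x ≈ a + b → a - (l + - b) ≈ x - l
        lower-gap l a b x p = trans (solve 3 (λ l a b → a :- (l :+ (:- b)) := (a :+ b) :- l) refl l a b)
            (+-congʳ (sym p))

        σρ-bounded : ∀ i → σ i ≤ (0# ∷ hi) i + ρ i × (0# ∷ lo) i + ρ i ≤ σ i
        σρ-bounded zero    = ≤-reflexive (sym (trans (+-identityˡ _) -0#≈0#)) , ≤-reflexive
            (trans (+-identityˡ _) -0#≈0#)
        σρ-bounded (suc i) = ≤-from-diff (diff-nonNeg (proj₂ (x∈box i)))
            (upper-gap (hi i) (s i) (t i) (x i) (x≈s+t i)) ,
                             ≤-from-diff (diff-nonNeg (proj₁ (x∈box i)))
                                 (lower-gap (lo i) (s i) (t i) (x i) (x≈s+t i))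

        ω-normal : ∀ y → E y → F y → vecℤ ℝ ω · y ≤ vecℤ ℝ ω · q
        ω-normal y e f = ≤-resp-≈ (sym (·-ω y)) (sym ·-ω-q) (maximal (λ i → difference y (suc i))
            (decode y e f) (decode-InBox y f))

        decomposition : NormalDecomposition.NormalSum E-isL F-isL {q} (encode-∈E s∈P₁ t∈P₂)
            (pair-∈F σ ρ σρ-bounded) ω
        decomposition = NormalDecomposition.normal-decomposition E-isL F-isL {q} (encode-∈E s∈P₁ t∈P₂)
            (pair-∈F σ ρ σρ-bounded) ω ω-normal

        v₁ v₂ : Vector ℤ (N ℕ.+ N)
        v₁ = proj₁ decomposition
        v₂ = proj₁ (proj₂ decomposition)
        v₁-normal : Normal E q v₁
        v₁-normal = proj₁ (proj₂ (proj₂ decomposition))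
        v₂-normal : Normal F q v₂
        v₂-normal = proj₁ (proj₂ (proj₂ (proj₂ decomposition)))
        ω≡ : ∀ k → ω k ≡ v₁ k ℤ.+ v₂ k
        ω≡ = proj₂ (proj₂ (proj₂ (proj₂ decomposition)))

        ·-pair : ∀ (v : Vector ℤ (N ℕ.+ N)) (σ ρ : Vector Carrier N) →
                 vecℤ ℝ v · (σ ++ ρ) ≈ vecℤ ℝ (leftℤ v) · σ + vecℤ ℝ (rightℤ v) · ρ
        ·-pair v σ ρ = trans (·-++ v (σ ++ ρ)) (+-cong (·-congʳ (vecℤ ℝ (leftℤ v)) (left-++ σ ρ))
            (·-congʳ (vecℤ ℝ (rightℤ v)) (right-++ σ ρ)))

        -- F is a product of strips, one for each coordinate, so `v₂` can be tested by moving the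
        -- two halves at coordinate i alone.
        v₂-bump : ∀ i ε δ → (∀ m → bump σ i ε m ≤ (0# ∷ hi) m + bump ρ i δ m
                                     × (0# ∷ lo) m + bump ρ i δ m ≤ bump σ i ε m) →
                  fromℤ (leftℤ v₂ i) * ε + fromℤ (rightℤ v₂ i) * δ ≤ 0#
        v₂-bump i ε δ h = ≤-from-diff (diff-nonNeg
          (≤-resp-≈ (trans (·-pair v₂ (bump σ i ε) (bump ρ i δ)) (+-cong (·-bump (leftℤ v₂) σ i ε)
              (·-bump (rightℤ v₂) ρ i δ)))
                    (·-pair v₂ σ ρ) (v₂-normal (bump σ i ε ++ bump ρ i δ)
                        (pair-∈F (bump σ i ε) (bump ρ i δ) h))))
          (regroup (vecℤ ℝ (leftℤ v₂) · σ) (vecℤ ℝ (rightℤ v₂) · ρ) (fromℤ (leftℤ v₂ i) * ε)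
              (fromℤ (rightℤ v₂ i) * δ))
          where
          regroup : ∀ a b c d → 0# - (c + d) ≈ (a + b) - ((a + c) + (b + d))
          regroup = solve 4 (λ a b c d → con 0ℤ :- (c :+ d) := (a :+ b) :- ((a :+ c) :+ (b :+ d))) refl

        v₂-sum : ∀ i ε → fromℤ (leftℤ v₂ i ℤ.+ rightℤ v₂ i) * ε ≤ 0#
        v₂-sum i ε = ≤-respˡ-≈
            (trans (sym (distribʳ ε _ _)) (*-congʳ (sym (fromℤ-+ (leftℤ v₂ i) (rightℤ v₂ i)))))
            (v₂-bump i ε ε λ m →
          ≤-from-diff (diff-nonNeg (proj₁ (σρ-bounded m))) (invariant ((0# ∷ hi) m) (σ m) (ρ m) _) ,
          ≤-from-diff (diff-nonNeg (proj₂ (σρ-bounded m))) (invariant′ ((0# ∷ lo) m) (σ m) (ρ m) _))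
          where
          invariant : ∀ h a b u → (h + (b + u)) - (a + u) ≈ (h + b) - a
          invariant = solve 4 (λ h a b u → (h :+ (b :+ u)) :- (a :+ u) := (h :+ b) :- a) refl
          invariant′ : ∀ l a b u → (a + u) - (l + (b + u)) ≈ a - (l + b)
          invariant′ = solve 4 (λ l a b u → (a :+ u) :- (l :+ (b :+ u)) := a :- (l :+ b)) refl

        -- Moving both halves by the same amount at one coordinate, up or down, keeps their
        -- difference and hence stays in F.
        v₂-anti : ∀ i → leftℤ v₂ i ℤ.+ rightℤ v₂ i ≡ 0ℤ
        v₂-anti i = ℤ.≤-antisym (*ε≤0⇒≤0 (leftℤ v₂ i ℤ.+ rightℤ v₂ i) 0<1 (v₂-sum i 1#))
            (*-ε≤0⇒≥0 (leftℤ v₂ i ℤ.+ rightℤ v₂ i) 0<1 (v₂-sum i (- 1#)))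

        -- Since ω and `v₂` are both of the form (a, -a), so is `v₁`; this is what makes it a
        -- functional of s + t, hence a candidate normal of P.
        v₁-anti : ∀ i → rightℤ v₁ i ≡ ℤ.- leftℤ v₁ i
        v₁-anti i = arithmetic (leftℤ v₁ i) (rightℤ v₁ i) (leftℤ v₂ i) (rightℤ v₂ i)
          (≡.trans (≡.sym (ω≡ (N ↑ʳ i))) (≡.trans (ω-anti i) (≡.cong ℤ.-_ (ω≡ (i ↑ˡ N))))) (v₂-anti i)
          where
          isolate : ∀ b d → b ≡ (b ℤ.+ d) ℤ.- d
          isolate = solve-∀
          collect : ∀ a c d → ℤ.- (a ℤ.+ c) ℤ.- d ≡ ℤ.- a ℤ.- (c ℤ.+ d)
          collect = solve-∀
          arithmetic : ∀ a b c d → b ℤ.+ d ≡ ℤ.- (a ℤ.+ c) → c ℤ.+ d ≡ 0ℤ → b ≡ ℤ.- a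
          arithmetic a b c d p q = ≡.trans (isolate b d) (≡.trans (≡.cong (ℤ._- d) p)
            (≡.trans (collect a c d) (≡.trans (≡.cong (λ z → ℤ.- a ℤ.- z) q) (ℤ.+-identityʳ (ℤ.- a)))))

        p : Vector ℤ n
        p i = leftℤ v₁ (suc i)

        p-normal : Normal P x p
        p-normal y y∈P =
          let (s′ , t′ , s′∈ , t′∈ , y≈) = proj₁ P≐ y∈P
          in ≤-resp-≈ (trans (·-encode v₁ v₁-anti s′ t′) (·-congʳ (vecℤ ℝ p) (λ i → sym (y≈ i))))
                      (trans (·-encode v₁ v₁-anti s t) (·-congʳ (vecℤ ℝ p) (λ i → sym (x≈s+t i))))
                      (v₁-normal (encode s′ t′) (encode-∈E s′∈ t′∈))

        w≡p+v₂ : ∀ i → w i ≡ p i ℤ.+ leftℤ v₂ (suc i)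
        w≡p+v₂ i = ≡.trans (≡.sym (leftℤ-ω (suc i))) (ω≡ (suc i ↑ˡ N))

        -- Moving `s i` with `t i` fixed moves `x i` by ε. For F only the box limits this move, as
        -- membership in P₁ is a condition of E.
        single-bump : ∀ i ε → lo i ≤ x i + ε → x i + ε ≤ hi i → fromℤ (leftℤ v₂ (suc i)) * ε ≤ 0#
        single-bump i ε low high = ≤-respˡ-≈ (trans (+-congˡ (zeroʳ _)) (+-identityʳ _))
            (v₂-bump (suc i) ε 0# bounded)
          where
          ρ-same : ∀ m → ρ m ≈ bump ρ (suc i) 0# m
          ρ-same m = sym (trans (+-congˡ (zeroʳ _)) (+-identityʳ _))
          bounded : ∀ m → bump σ (suc i) ε m ≤ (0# ∷ hi) m + bump ρ (suc i) 0# m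
                        × (0# ∷ lo) m + bump ρ (suc i) 0# m ≤ bump σ (suc i) ε m
          bounded m with unit-value (suc i) m
          ... | inj₁ u≡0 = ≤-resp-≈ (sym (bump-other σ (suc i) m ε u≡0)) (+-congˡ (ρ-same m))
              (proj₁ (σρ-bounded m)) ,
                           ≤-resp-≈ (+-congˡ (ρ-same m)) (sym (bump-other σ (suc i) m ε u≡0))
                               (proj₂ (σρ-bounded m))
          ... | inj₂ (≡.refl , u≡1) =
            ≤-resp-≈ (sym (bump-same σ (suc i) (suc i) ε u≡1)) (+-congˡ (ρ-same (suc i)))
              (≤-from-diff (diff-nonNeg high) (upper-gap′ (hi i) (s i) (t i) ε (x i) (x≈s+t i))) ,
            ≤-resp-≈ (+-congˡ (ρ-same (suc i))) (sym (bump-same σ (suc i) (suc i) ε u≡1))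
              (≤-from-diff (diff-nonNeg low) (lower-gap′ (lo i) (s i) (t i) ε (x i) (x≈s+t i)))
            where
            upper-gap′ : ∀ h a b ε x → x ≈ a + b → (h + - b) - (a + ε) ≈ h - (x + ε)
            upper-gap′ h a b ε x p =
                trans (solve 4 (λ h a b ε →
                (h :+ (:- b)) :- (a :+ ε) := h :- ((a :+ b) :+ ε)) refl h a b ε)
                (+-congˡ (-‿cong (+-congʳ (sym p))))
            lower-gap′ : ∀ l a b ε x → x ≈ a + b → (a + ε) - (l + - b) ≈ (x + ε) - l
            lower-gap′ l a b ε x p =
                trans (solve 4 (λ l a b ε →
                (a :+ ε) :- (l :+ (:- b)) := ((a :+ b) :+ ε) :- l) refl l a b ε)
                (+-congʳ (+-congʳ (sym p)))

        y-[y-x]≈x : ∀ x y → y - (y - x) ≈ x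
        y-[y-x]≈x = solve 2 (λ x y → y :- (y :- x) := x) refl

        gap-pos : ∀ {a b} → a < b → 0# < b - a
        gap-pos {a} {b} a<b b-a≤0 =
            a<b (≤-from-diff (diff-nonNeg b-a≤0)
            (solve 2 (λ a b → a :- b := con 0ℤ :- (b :- a)) refl a b))

        -- Complementary slackness for the box: if the upper bound is slack, `x i` may be raised to
        -- it, which forces the box part `v₂` to be nonpositive there. `above-lo` mirrors this.
        below-hi : ∀ i → x i < hi i → w i ℤ.≤ p i
        below-hi i x<hi = ≡.subst (ℤ._≤ p i) (≡.sym (w≡p+v₂ i)) (≡.subst (p i ℤ.+ leftℤ v₂ (suc i) ℤ.≤_)
            (ℤ.+-identityʳ (p i))
          (ℤ.+-monoʳ-≤ (p i) (*ε≤0⇒≤0 (leftℤ v₂ (suc i)) (gap-pos x<hi) (single-bump i (hi i - x i)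
            (≤-trans (proj₁ (x∈box i))
                (≤-trans (proj₂ (x∈box i)) (≤-reflexive (sym (x+[y-x]≈y (x i) (hi i))))))
                (≤-reflexive (x+[y-x]≈y (x i) (hi i)))))))

        above-lo : ∀ i → lo i < x i → p i ℤ.≤ w i
        above-lo i lo<x = ≡.subst (p i ℤ.≤_) (≡.sym (w≡p+v₂ i)) (≡.subst (ℤ._≤ p i ℤ.+ leftℤ v₂ (suc i))
            (ℤ.+-identityʳ (p i))
          (ℤ.+-monoʳ-≤ (p i) (*-ε≤0⇒≥0 (leftℤ v₂ (suc i)) (gap-pos lo<x) (single-bump i (- (x i - lo i))
            (≤-reflexive (sym (y-[y-x]≈x (lo i) (x i)))) (≤-trans (≤-reflexive (y-[y-x]≈x (lo i) (x i)))
                (≤-trans (proj₁ (x∈box i)) (proj₂ (x∈box i))))))))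

      box-normal : ∃[ p ] Normal P x p ×
                   (∀ i → x i < hi i → w i ℤ.≤ p i) ×
                   (∀ i → lo i < x i → p i ℤ.≤ w i)
      box-normal = p , p-normal , below-hi , above-lo

-- Integral dual certificates and total dual integrality

module Duality (ℝ : Reals) where
  open OrderedField ℝ
  open LinearProgramming ℝ

  ·-transpose : ∀ {m n} (A : Vector (Vector Carrier n) m) (y : Vector Carrier m)
      (x : Vector Carrier n) →
                y · (λ i → A i · x) ≈ sum (λ j → (y · (λ i → A i j)) * x j)
  ·-transpose A y x = begin
    sum (λ i → y i * sum (λ j → A i j * x j))
      ≈⟨ sum-cong-≋ (λ i → trans (*-distribˡ-sum (y i) (λ j → A i j * x j))
          (sum-cong-≋ (λ j → sym (*-assoc (y i) (A i j) (x j))))) ⟩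
    sum (λ i → sum (λ j → (y i * A i j) * x j))
      ≈⟨ ∑-comm (λ i j → (y i * A i j) * x j) ⟩
    sum (λ j → sum (λ i → (y i * A i j) * x j))
      ≈⟨ sum-cong-≋ (λ j → sym (*-distribʳ-sum (x j) (λ i → y i * A i j))) ⟩
    sum (λ j → sum (λ i → y i * A i j) * x j) ∎
    where open ≈R

  ⟨,⟩-mono : ∀ {m} (l : Vector ℕ m) {r s : Vector Carrier m} → (∀ i → r i ≤ s i) → ⟨ l , r ⟩ ≤ ⟨ l , s ⟩
  ⟨,⟩-mono l p = sum-mono-≤ (λ i → *-monoˡ-≤ (fromℕ-nonNeg (l i)) (p i))

  ⟨,⟩-rows : ∀ {m n} (M : Vector (Vector ℤ n) m) l τ (a : Vector ℤ n) →
             (∀ j → ⟨ l , column M j ⟩ ≈ fromℕ τ * fromℤ (a j)) → ∀ x →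
             ⟨ l , (λ i → vecℤ ℝ (M i) · x) ⟩ ≈ fromℕ τ * (vecℤ ℝ a · x)
  ⟨,⟩-rows M l τ a h x = begin
    ⟨ l , (λ i → vecℤ ℝ (M i) · x) ⟩
      ≈⟨ ·-transpose (matℤ M) (λ i → fromℕ (l i)) x ⟩
    sum (λ j → ⟨ l , column M j ⟩ * x j)
      ≈⟨ sum-cong-≋ (λ j → trans (*-congʳ (h j)) (*-assoc (fromℕ τ) (fromℤ (a j)) (x j))) ⟩
    sum (λ j → fromℕ τ * (fromℤ (a j) * x j))
      ≈⟨ sym (*-distribˡ-sum (fromℕ τ) (λ j → fromℤ (a j) * x j)) ⟩
    fromℕ τ * (vecℤ ℝ a · x) ∎
    where open ≈R

  weak-duality : ∀ {m n} {M : Vector (Vector ℤ n) m} {b} l τ (a : Vector ℤ n) →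
                 (∀ j → ⟨ l , column M j ⟩ ≈ fromℕ τ * fromℤ (a j)) → ∀ {x} → Solvesℤ M b x →
                 fromℕ τ * (vecℤ ℝ a · x) ≤ ⟨ l , b ⟩
  weak-duality {M = M} l τ a h {x} sol = ≤-respˡ-≈ (⟨,⟩-rows M l τ a h x) (⟨,⟩-mono l sol)

  -- Only an upper bound on the cost is recorded. With β the objective value at a feasible point, it
  -- already gives optimality, because every dual solution costs at least that value.
  record Generated {m n} (A : Vector (Vector ℤ n) m) (b : Vector Carrier m)
                   (u : Vector Carrier n) (β : Carrier) : Set where
    constructor generated
    field
      coefficients : Vector ℕ m
      combination  : ∀ j → ⟨ coefficients , column A j ⟩ ≈ u j
      cost         : ⟨ coefficients , b ⟩ ≤ β

  module _ {m n} {A : Vector (Vector ℤ n) m} {b : Vector Carrier m} where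

    Generated-resp : ∀ {u u′ β β′} → (∀ j → u j ≈ u′ j) → β ≤ β′ → Generated A b u β →
        Generated A b u′ β′
    Generated-resp p q (generated z comb cost) = generated z (λ j → trans (comb j) (p j))
        (≤-trans cost q)

    Generated-row : ∀ i → Generated A b (vecℤ ℝ (A i)) (b i)
    Generated-row i = generated (unit i) (λ j → ⟨unit,⟩ i (column A j)) (≤-reflexive (⟨unit,⟩ i b))

    Generated-0 : Generated A b (λ _ → 0#) 0#
    Generated-0 = generated (λ _ → 0) (λ j → ⟨0,⟩ (column A j)) (≤-reflexive (⟨0,⟩ b))

    Generated-combine : ∀ k {u β} l {u′ β′} → Generated A b u β → Generated A b u′ β′ →
                        Generated A b (λ j → fromℕ k * u j + fromℕ l * u′ j)
                            (fromℕ k * β + fromℕ l * β′)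
    Generated-combine k l (generated z comb cost) (generated z′ comb′ cost′) =
        generated (combine k z l z′)
      (λ j → trans (⟨combine,⟩ k z l z′ (column A j)) (+-cong (*-congˡ (comb j)) (*-congˡ (comb′ j))))
      (≤-respˡ-≈ (sym (⟨combine,⟩ k z l z′ b)) (+-mono-≤ (*-monoˡ-≤ (fromℕ-nonNeg k) cost)
          (*-monoˡ-≤ (fromℕ-nonNeg l) cost′)))

    1*x : ∀ x → fromℕ 1 * x ≈ x
    1*x x = trans (*-congʳ fromℤ-1) (*-identityˡ x)

    Generated-+ : ∀ {u β u′ β′} → Generated A b u β → Generated A b u′ β′ →
                  Generated A b (λ j → u j + u′ j) (β + β′)
    Generated-+ {u} {β} {u′} {β′} g g′ =
      Generated-resp (λ j → +-cong (1*x (u j)) (1*x (u′ j))) (≤-reflexive (+-cong (1*x β) (1*x β′)))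
          (Generated-combine 1 1 g g′)

    Generated-scale : ∀ k {u β} → Generated A b u β → Generated A b (λ j → fromℕ k * u j) (fromℕ k * β)
    Generated-scale k {u} {β} g =
      Generated-resp (λ j → drop (fromℕ k * u j)) (≤-reflexive (drop (fromℕ k * β)))
          (Generated-combine k 1 g Generated-0)
      where
      drop : ∀ x → x + fromℕ 1 * 0# ≈ x
      drop x = trans (+-congˡ (zeroʳ _)) (+-identityʳ x)

    Generated-sum : ∀ {k} (u : Vector (Vector Carrier n) k) β → (∀ i → Generated A b (u i) (β i)) →
                    Generated A b (λ j → sum (λ i → u i j)) (sum β)
    Generated-sum {zero}  u β g = Generated-0
    Generated-sum {suc k} u β g = Generated-+ (g zero) (Generated-sum (λ i → u (suc i))
        (λ i → β (suc i)) (λ i → g (suc i)))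

  dual-bound : ∀ {m n} {A : Vector (Vector Carrier n) m} {b c y} → DualFeasible ℝ A c y →
               ∀ {x} → Solutions ℝ A b x → c · x ≤ y · b
  dual-bound {A = A} {b} {c} {y} feasible {x} sol = ≤-respˡ-≈
    (trans (·-transpose A y x) (sum-cong-≋ (λ j → *-congʳ (DualFeasible.yA≈c feasible j))))
    (sum-mono-≤ (λ i → *-monoˡ-≤ (DualFeasible.y≥0 feasible i) (sol i)))

  x<x+1 : ∀ {x} → x < x + 1#
  x<x+1 {x} p = 0<1 (≤-from-diff (diff-nonNeg p) (collapse x 1#))
    where
    collapse : ∀ x y → 0# - y ≈ x - (x + y)
    collapse = solve 2 (λ x y → con 0ℤ :- y := x :- (x :+ y)) refl

  module _ {m n} (A : Vector (Vector ℤ n) m) (B : Vector (Vector ℚ n) m) (b : Vector ℚ m)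
           (B≈A : ∀ i j → fromℚ (B i j) ≈ fromℤ (A i j)) where

    private
      b′ : Vector Carrier m
      b′ = vecℚ ℝ b

    solvesℚ : ∀ {x} → Solvesℤ A b′ x → Solutions ℝ (matℚ ℝ B) b′ x
    solvesℚ sol i = ≤-respˡ-≈ (sum-cong-≋ (λ j → *-congʳ (sym (B≈A i j)))) (sol i)

    solvesℤ : ∀ {x} → Solutions ℝ (matℚ ℝ B) b′ x → Solvesℤ A b′ x
    solvesℤ sol i = ≤-respˡ-≈ (sum-cong-≋ (λ j → *-congʳ (B≈A i j))) (sol i)

    ⟨,⟩-columnℚ : ∀ (l : Vector ℕ m) j →
        (λ i → fromℕ (l i)) · (λ i → fromℚ (B i j)) ≈ ⟨ l , column A j ⟩
    ⟨,⟩-columnℚ l j = ⟨,⟩-cong l (λ i → B≈A i j)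

    module _ (maximizer-generates : ∀ w x → Solvesℤ A b′ x →
                (∀ y → Solvesℤ A b′ y → vecℤ ℝ w · y ≤ vecℤ ℝ w · x) →
                Generated A b′ (vecℤ ℝ w) (vecℤ ℝ w · x)) where

      module _ (c : Vector ℤ n) {y} (optimal-y : DualOptimal ℝ (matℚ ℝ B) b′ (vecℤ ℝ c) y) where
        open DualOptimal optimal-y

        -- The optimal y excludes two outcomes: adding a certificate of infeasibility to y would
        -- lower its cost, and an unbounded objective would exceed its cost. In the third, l / τ
        -- certifies that x is a maximiser, to which the hypothesis applies.
        integral-dual : Outcome A b′ c → ∃[ z ] DualOptimal ℝ (matℚ ℝ B) b′ (vecℤ ℝ c) (vecℤ ℝ {m} z)
        integral-dual (infeasible l annihilates lb<0) =
            ⊥-elim (lb<0 (≤-from-diff (diff-nonNeg (minimal y⁺ feasible⁺))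
            (trans (cancel (y · b′) ⟨ l , b′ ⟩) (+-congʳ (sym y⁺b)))))
          where
          y⁺ : Vector Carrier m
          y⁺ i = y i + fromℕ (l i)
          y⁺-split : ∀ r → y⁺ · r ≈ y · r + ⟨ l , r ⟩
          y⁺-split r = trans (sum-cong-≋ (λ i → distribʳ (r i) (y i) (fromℕ (l i))))
              (∑-distrib-+ (λ i → y i * r i) (λ i → fromℕ (l i) * r i))
          y⁺b : y⁺ · b′ ≈ y · b′ + ⟨ l , b′ ⟩
          y⁺b = y⁺-split b′
          cancel : ∀ p q → q - 0# ≈ (p + q) - p
          cancel = solve 2 (λ p q → q :- con 0ℤ := (p :+ q) :- p) refl
          feasible⁺ : DualFeasible ℝ (matℚ ℝ B) (vecℤ ℝ c) y⁺
          feasible⁺ = record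
            { yA≈c = λ j → trans (y⁺-split (λ i → fromℚ (B i j)))
                       (trans (+-cong (DualFeasible.yA≈c feasible j)
                           (trans (⟨,⟩-columnℚ l j) (annihilates j))) (+-identityʳ _))
            ; y≥0  = λ i → +-nonNeg (DualFeasible.y≥0 feasible i) (fromℕ-nonNeg (l i))
            }
        integral-dual (unbounded beyond) =
          let (x , sol , t≤cx) = beyond (y · b′ + 1#)
          in ⊥-elim (x<x+1 (≤-trans t≤cx (dual-bound feasible (solvesℚ sol))))
        integral-dual (optimal x sol τ l comb lb≤) =
          let generated z z-comb z-cost = maximizer-generates c x sol λ x′ sol′ →
                *-cancelˡ-≤ (fromℕ-pos τ) (≤-trans (weak-duality {M = A} l τ c comb sol′) lb≤)
          in (λ i → + z i) , record
            { feasible = record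
                { yA≈c = λ j → trans (⟨,⟩-columnℚ z j) (z-comb j)
                ; y≥0  = λ i → fromℕ-nonNeg (z i)
                }
            ; minimal  = λ y′ feasible′ → ≤-trans z-cost (dual-bound feasible′ (solvesℚ sol))
            }

      isTDI : IsTDI ℝ B b
      isTDI c (y , optimal-y) = integral-dual c optimal-y (linearProgram A b′ c)

-- Enumeration of bounded integer vectors

range : ℕ → List ℤ
range K = List.map +_ (List.upTo (suc K)) List.++ List.map (λ k → ℤ.- + k) (List.upTo (suc K))

∈-range : ∀ z {K} → ℤ.∣ z ∣ ℕ.≤ K → z ∈ range K
∈-range (+ k)    k≤K = ∈-++⁺ˡ (∈-map⁺ +_ (∈-upTo⁺ (ℕ.s≤s k≤K)))
∈-range -[1+ k ] {K} k<K = ∈-++⁺ʳ (List.map +_ (List.upTo (suc K)))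
    (∈-map⁺ (λ k → ℤ.- + k) (∈-upTo⁺ (ℕ.s≤s k<K)))

latticePoints : ∀ {n} → Vector ℕ n → List (Vector ℤ n)
latticePoints {zero}  K = Vector.[] List.∷ List.[]
latticePoints {suc n} K = List.cartesianProductWith Vector._∷_ (range (K zero))
    (latticePoints (λ j → K (suc j)))

-- Vectors are functions and function extensionality is not assumed, so the list contains a vector
-- that agrees with a pointwise.
∈-latticePoints : ∀ {n} (K : Vector ℕ n) (a : Vector ℤ n) → (∀ j → ℤ.∣ a j ∣ ℕ.≤ K j) →
                  ∃[ a′ ] a′ ∈ latticePoints K × (∀ j → a′ j ≡ a j)
∈-latticePoints {zero}  K a _ = Vector.[] , here ≡.refl , λ ()
∈-latticePoints {suc n} K a a≤K =
  let (a′ , a′∈ , a′≡a) = ∈-latticePoints (λ j → K (suc j)) (λ j → a (suc j)) (λ j → a≤K (suc j))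
  in a zero Vector.∷ a′ , ∈-cartesianProductWith⁺ Vector._∷_ (∈-range (a zero) (a≤K zero)) a′∈ , λ where
    zero    → ≡.refl
    (suc j) → a′≡a j

absSum : ∀ {m} → Vector ℤ m → ℕ
absSum {zero}  v = 0
absSum {suc m} v = ℤ.∣ v zero ∣ ℕ.+ absSum (λ i → v (suc i))

∣∣-bounded : ∀ z {K} → z ℤ.≤ + K → ℤ.- z ℤ.≤ + K → ℤ.∣ z ∣ ℕ.≤ K
∣∣-bounded (+ k)    p _ = ℤ.drop‿+≤+ p
∣∣-bounded -[1+ k ] _ q = ℤ.drop‿+≤+ q

i≤∣i∣ : ∀ i → i ℤ.≤ + ℤ.∣ i ∣
i≤∣i∣ (+ k)    = ℤ.≤-refl
i≤∣i∣ -[1+ k ] = ℤ.-≤+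

-- Integer descriptions and the additional support rows

module IntegerSystems (ℝ : Reals) where
  open OrderedField ℝ
  open import Data.Vec.Functional using (_++_)
  open LinearProgramming ℝ
  open LConvexity ℝ using (Normal)
  open Duality ℝ

  clear-denominators : ∀ {k} (q : Vector ℚ k) →
    ∃₂ λ D (z : Vector ℤ k) → ℕ.NonZero D × (∀ j → fromℤ (z j) ≈ fromℕ D * fromℚ (q j))
  clear-denominators {zero}  q = 1 , (λ ()) , _ , λ ()
  clear-denominators {suc k} q =
    let (D , z , D≢0 , z≈) = clear-denominators (λ j → q (suc j))
        d  = ℚ.denominatorℕ (q zero)
    in D ℕ.* d , ((+ D ℤ.* ℚ.numerator (q zero)) Vector.∷ (λ j → + d ℤ.* z j)) ,
       ℕ.m*n≢0 D d {{D≢0}} , λ where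
         zero    → trans (fromℤ-* (+ D) (ℚ.numerator (q zero)))
                     (trans (*-congˡ (sym (denominator-*-fromℚ (q zero))))
                       (trans (sym (*-assoc (fromℕ D) (fromℕ d) _)) (*-congʳ (sym (fromℕ-* D d)))))
         (suc j) → trans (fromℤ-* (+ d) (z j))
                     (trans (*-congˡ (z≈ j))
                       (trans (sym (*-assoc (fromℕ d) (fromℕ D) _))
                           (*-congʳ (trans (*-comm _ _) (sym (fromℕ-* D d))))))

  -- The rationality of P enters here. With an integer right-hand side, the optimal values found
  -- below are quotients of integers, as the rational data of a TDI system require.
  integer-system : ∀ {m n} (A : Vector (Vector ℚ n) m) (b : Vector ℚ m) →
    ∃₂ λ (M : Vector (Vector ℤ n) m) (β : Vector ℤ m) →
      (∀ x → Solutions ℝ (matℚ ℝ A) (vecℚ ℝ b) x → Solvesℤ M (vecℤ ℝ β) x) ×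
      (∀ x → Solvesℤ M (vecℤ ℝ β) x → Solutions ℝ (matℚ ℝ A) (vecℚ ℝ b) x)
  integer-system {m} {n} A b = (λ i j → z i (suc j)) , (λ i → z i zero) ,
    (λ x sol i → ≤-resp-≈ (sym (scaled i x)) (sym (z≈ i zero)) (*-monoˡ-≤ (<⇒≤ (0<D i)) (sol i))) ,
    (λ x sol i → *-cancelˡ-≤ (0<D i) (≤-resp-≈ (scaled i x) (z≈ i zero) (sol i)))
    where
    -- The right-hand side is cleared together with its row, so that one positive factor scales
    -- both.
    cleared : ∀ i → ∃₂ λ D (z : Vector ℤ (suc n)) → ℕ.NonZero D ×
                      (∀ j → fromℤ (z j) ≈ fromℕ D * fromℚ ((b i Vector.∷ A i) j))
    cleared i = clear-denominators (b i Vector.∷ A i)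
    D : Vector ℕ m
    D i = proj₁ (cleared i)
    z : ∀ i → Vector ℤ (suc n)
    z i = proj₁ (proj₂ (cleared i))
    0<D : ∀ i → 0# < fromℕ (D i)
    0<D i = fromℕ-pos (D i) {{proj₁ (proj₂ (proj₂ (cleared i)))}}
    z≈ : ∀ i j → fromℤ (z i j) ≈ fromℕ (D i) * fromℚ ((b i Vector.∷ A i) j)
    z≈ i = proj₂ (proj₂ (proj₂ (cleared i)))
    scaled : ∀ i x → vecℤ ℝ (λ j → z i (suc j)) · x ≈ fromℕ (D i) * (matℚ ℝ A i · x)
    scaled i x = trans (sum-cong-≋ (λ j → trans (*-congʳ (z≈ i (suc j)))
        (*-assoc (fromℕ (D i)) (fromℚ (A i j)) (x j))))
                       (sym (*-distribˡ-sum (fromℕ (D i)) (λ j → fromℚ (A i j) * x j)))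

  0·x≈0 : ∀ {n} (x : Vector Carrier n) → vecℤ ℝ (λ _ → 0ℤ) · x ≈ 0#
  0·x≈0 {n} x = trans (sum-cong-≋ (λ j → zeroˡ (x j))) (sum-replicate-zero n)

  module SupportRows {m n} (M : Vector (Vector ℤ n) m) (β : Vector ℤ m) where

    b : Vector Carrier m
    b = vecℤ ℝ β

    -- The inequality a·x ≤ max { a·y | M y ≤ β }; a trivial one when the maximum does not exist.
    supportOf : ∀ a → Outcome M b a → Vector ℤ n × ℚ
    supportOf a (optimal _ _ τ l _ _) = a , pairing l β ℚ./ τ
    supportOf a _                     = (λ _ → 0ℤ) , ℚ.0ℚ

    support : Vector ℤ n → Vector ℤ n × ℚ
    support a = supportOf a (linearProgram M b a)

    value : ∀ τ .{{_ : ℕ.NonZero τ}} l → fromℕ τ * fromℚ (pairing l β ℚ./ τ) ≈ ⟨ l , b ⟩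
    value τ l = trans (fromℚ-/ (pairing l β) τ) (fromℤ-pairing l β)

    support-valid : ∀ a y → Solvesℤ M b y → vecℤ ℝ (proj₁ (support a)) · y ≤ fromℚ (proj₂ (support a))
    support-valid a y sol = valid (linearProgram M b a)
      where
      trivial : vecℤ ℝ (λ _ → 0ℤ) · y ≤ fromℚ ℚ.0ℚ
      trivial = ≤-reflexive (trans (0·x≈0 y) (sym fromℚ-0))
      valid : (o : Outcome M b a) → vecℤ ℝ (proj₁ (supportOf a o)) · y ≤ fromℚ (proj₂ (supportOf a o))
      valid (infeasible _ _ _)       = trivial
      valid (unbounded _)            = trivial
      valid (optimal _ _ τ l comb _) = *-cancelˡ-≤ (fromℕ-pos τ)
        (≤-respʳ-≈ (sym (value τ l)) (weak-duality {M = M} l τ a comb sol))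

    -- A feasible point and a bound on the objective rule out both outcomes for which the row falls
    -- back to the trivial one.
    support-attained : ∀ a y → Solvesℤ M b y → ∀ {B} → (∀ x → Solvesℤ M b x → vecℤ ℝ a · x ≤ B) →
                       proj₁ (support a) ≡ a × (∃[ x ] Solvesℤ M b x × fromℚ (proj₂ (support a)) ≤
                           vecℤ ℝ a · x)
    support-attained a y sol {B} bounded = attained (linearProgram M b a)
      where
      attained : (o : Outcome M b a) → proj₁ (supportOf a o) ≡ a ×
          (∃[ x ] Solvesℤ M b x × fromℚ (proj₂ (supportOf a o)) ≤ vecℤ ℝ a · x)
      attained (infeasible l annihilates lb<0) = ⊥-elim (lb<0 (≤-respˡ-≈
        (trans (⟨,⟩-rows M l 0 a (λ j → trans (annihilates j) (sym (zeroˡ _))) y) (zeroˡ _))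
            (⟨,⟩-mono l sol)))
      attained (unbounded beyond) =
        let (x , sol′ , B+1≤ax) = beyond (B + 1#) in ⊥-elim (x<x+1 (≤-trans B+1≤ax (bounded x sol′)))
      attained (optimal x sol′ τ l comb lb≤) = ≡.refl , x , sol′ ,
        *-cancelˡ-≤ (fromℕ-pos τ) (≤-respˡ-≈ (sym (value τ l)) lb≤)

    -- Column sums of absolute values: they bound the entries of every combination of the rows of M
    -- with coefficients in [0, 1], such as the fractional parts of dual multipliers.
    K : Vector ℕ n
    K j = absSum (λ i → M i j)

    rows : List (Vector ℤ n)
    rows = latticePoints K

    ≤-absSum : ∀ {m} (r : Vector ℕ m) τ (v : Vector ℤ m) → (∀ i → r i ℕ.≤ τ) →
               ⟨ r , vecℤ ℝ v ⟩ ≤ fromℕ τ * fromℕ (absSum v) ×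
               - ⟨ r , vecℤ ℝ v ⟩ ≤ fromℕ τ * fromℕ (absSum v)
    ≤-absSum {zero}  r τ v r≤τ = ≤-reflexive (sym (zeroʳ _)) , ≤-reflexive
        (trans -0#≈0# (sym (zeroʳ _)))
    ≤-absSum {suc m} r τ v r≤τ =
      ≤-respʳ-≈ (sym split) (+-mono-≤ (term (v zero) (i≤∣i∣ (v zero))) (proj₁ rest)) ,
      ≤-resp-≈ (-‿+-comm _ _) (sym split)
        (+-mono-≤ (≤-respˡ-≈ (trans (*-congˡ (fromℤ-neg (v zero))) (sym (-‿distribʳ-* _ _)))
                    (term (ℤ.- v zero) (≡.subst (λ k → ℤ.- v zero ℤ.≤ + k) (ℤ.∣-i∣≡∣i∣ (v zero))
                        (i≤∣i∣ (ℤ.- v zero)))))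
                  (proj₂ rest))
      where
      rest = ≤-absSum (λ i → r (suc i)) τ (λ i → v (suc i)) (λ i → r≤τ (suc i))
      split : fromℕ τ * fromℕ (absSum v) ≈
              fromℕ τ * fromℕ ℤ.∣ v zero ∣ + fromℕ τ * fromℕ (absSum (λ i → v (suc i)))
      split = trans (*-congˡ (fromℕ-+ ℤ.∣ v zero ∣ (absSum (λ i → v (suc i))))) (distribˡ _ _ _)
      term : ∀ z → z ℤ.≤ + ℤ.∣ v zero ∣ → fromℕ (r zero) * fromℤ z ≤ fromℕ τ * fromℕ ℤ.∣ v zero ∣
      term z z≤ = ≤-trans (*-monoˡ-≤ (fromℕ-nonNeg (r zero)) (fromℤ-mono z≤))
        (≤-resp-≈ (*-comm _ _) (*-comm _ _) (*-monoˡ-≤ (fromℕ-nonNeg ℤ.∣ v zero ∣)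
            (fromℤ-mono (ℤ.+≤+ (r≤τ zero)))))

    -- A multiplier vector l with l M = τ p splits as r + τ q with r < τ.  Then p = q M + a
    -- with τ a = r M, so a is one of the finitely many lattice points bounded by K.
    module _ {N} {A : Vector (Vector ℤ n) N} {c : Vector Carrier N}
             (row : ∀ i → Generated A c (vecℤ ℝ (M i)) (b i))
             (support-row : ∀ {a} → a ∈ rows → Generated A c (vecℤ ℝ (proj₁ (support a)))
                 (fromℚ (proj₂ (support a)))) where

      normal-generated : ∀ p x → Solvesℤ M b x → Normal (Solvesℤ M b) x p →
                         Generated A c (vecℤ ℝ p) (vecℤ ℝ p · x)
      normal-generated p x sol normal = from-outcome (linearProgram M b p)
        where
        from-multiplier : ∀ τ .{{_ : ℕ.NonZero τ}} l →
            (∀ j → ⟨ l , column M j ⟩ ≈ fromℕ τ * fromℤ (p j)) →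
                          ⟨ l , b ⟩ ≤ fromℕ τ * (vecℤ ℝ p · x) → Generated A c (vecℤ ℝ p) (vecℤ ℝ p · x)
        from-multiplier τ l comb lb≤ =
          Generated-resp (λ j →
              trans (+-congˡ (trans (reflexive (≡.cong (λ a → fromℤ (a j)) a-row)) (a≈ j)))
              (x+[y-x]≈y (q-part j) (fromℤ (p j)))) cost
            (Generated-+ q-generated (support-row a∈))
          where
          q r : Vector ℕ m
          q i = l i / τ
          r i = l i % τ
          l-split : ∀ s → ⟨ l , s ⟩ ≈ ⟨ r , s ⟩ + fromℕ τ * ⟨ q , s ⟩
          l-split s = begin
            ⟨ l , s ⟩                                   ≈⟨ sum-cong-≋
                (λ i → *-congʳ (reflexive (≡.cong fromℕ (split i)))) ⟩
            ⟨ combine 1 r τ q , s ⟩                     ≈⟨ ⟨combine,⟩ 1 r τ q s ⟩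
            fromℕ 1 * ⟨ r , s ⟩ + fromℕ τ * ⟨ q , s ⟩   ≈⟨ +-congʳ (trans (*-congʳ fromℤ-1)
                (*-identityˡ _)) ⟩
            ⟨ r , s ⟩ + fromℕ τ * ⟨ q , s ⟩             ∎
            where
            open ≈R
            split : ∀ i → l i ≡ 1 ℕ.* r i ℕ.+ τ ℕ.* q i
            split i = ≡.trans (ℕ.m≡m%n+[m/n]*n (l i) τ) (≡.cong₂ ℕ._+_ (≡.sym (ℕ.*-identityˡ (r i)))
                (ℕ.*-comm (q i) τ))

          q-part : Vector Carrier n
          q-part j = ⟨ q , column M j ⟩

          a₀ : Vector ℤ n
          a₀ j = p j ℤ.- pairing q (λ i → M i j)

          a₀≈ : ∀ j → fromℤ (a₀ j) ≈ fromℤ (p j) - q-part j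
          a₀≈ j = trans (fromℤ-+ (p j) (ℤ.- pairing q (λ i → M i j)))
            (+-congˡ (trans (fromℤ-neg (pairing q (λ i → M i j)))
                (-‿cong (fromℤ-pairing q (λ i → M i j)))))

          isolate : ∀ r τ q p → r + τ * q ≈ τ * p → r ≈ τ * (p - q)
          isolate r τ q p h = trans (solve 3 (λ r τ q → r := (r :+ τ :* q) :- τ :* q) refl r τ q)
            (trans (+-congʳ h) (solve 3 (λ τ q p → τ :* p :- τ :* q := τ :* (p :- q)) refl τ q p))

          r-comb : ∀ j → ⟨ r , column M j ⟩ ≈ fromℕ τ * fromℤ (a₀ j)
          r-comb j = trans (isolate _ (fromℕ τ) (q-part j) (fromℤ (p j))
              (trans (sym (l-split (column M j))) (comb j))) (*-congˡ (sym (a₀≈ j)))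

          a₀-bounded : ∀ j → ℤ.∣ a₀ j ∣ ℕ.≤ K j
          a₀-bounded j = ∣∣-bounded (a₀ j)
            (fromℤ-cancel-≤ (*-cancelˡ-≤ (fromℕ-pos τ) (≤-respˡ-≈ (r-comb j) (proj₁ bounds))))
            (fromℤ-cancel-≤ (*-cancelˡ-≤ (fromℕ-pos τ) (≤-respˡ-≈
              (trans (-‿cong (r-comb j)) (trans (-‿distribʳ-* _ _) (*-congˡ (sym (fromℤ-neg (a₀ j))))))
                  (proj₂ bounds))))
            where
            bounds = ≤-absSum r τ (λ i → M i j) (λ i → ℕ.<⇒≤ (ℕ.m%n<n (l i) τ))

          lattice-point = ∈-latticePoints K a₀ a₀-bounded
          a : Vector ℤ n
          a = proj₁ lattice-point
          a∈ : a ∈ rows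
          a∈ = proj₁ (proj₂ lattice-point)
          a≡a₀ : ∀ j → a j ≡ a₀ j
          a≡a₀ = proj₂ (proj₂ lattice-point)

          a≈ : ∀ j → fromℤ (a j) ≈ fromℤ (p j) - q-part j
          a≈ j = trans (reflexive (≡.cong fromℤ (a≡a₀ j))) (a₀≈ j)

          τa≤rb : ∀ y → Solvesℤ M b y → fromℕ τ * (vecℤ ℝ a · y) ≤ ⟨ r , b ⟩
          τa≤rb y sol′ = weak-duality {M = M} r τ a
              (λ j → trans (r-comb j) (*-congˡ (reflexive (≡.cong fromℤ (≡.sym (a≡a₀ j)))))) sol′

          attained = support-attained a x sol {fromℕ τ ⁻¹ * ⟨ r , b ⟩} λ y sol′ →
            ≤-respˡ-≈ (*-inverse-cancel (fromℕ-pos τ) (vecℤ ℝ a · y))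
                (*-monoˡ-≤ (⁻¹-nonNeg (fromℕ-pos τ)) (τa≤rb y sol′))

          a-row : proj₁ (support a) ≡ a
          a-row = proj₁ attained

          h : Carrier
          h = fromℚ (proj₂ (support a))

          τh≤rb : fromℕ τ * h ≤ ⟨ r , b ⟩
          τh≤rb = let (y , sol′ , h≤) = proj₂ attained in ≤-trans (*-monoˡ-≤ (fromℕ-nonNeg τ) h≤)
              (τa≤rb y sol′)

          -- Scaled by τ, the quotient part costs τ⟨q, b⟩ and the support row at most ⟨r, b⟩.
          -- Together they make up ⟨l, b⟩, so rounding the multipliers down loses nothing.
          cost : ⟨ q , b ⟩ + h ≤ vecℤ ℝ p · x
          cost = *-cancelˡ-≤ (fromℕ-pos τ)
              (≤-trans (≤-respˡ-≈ (trans (+-comm _ _) (sym (distribˡ _ _ _))) (+-mono-≤ τh≤rb ≤-refl))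
            (≤-trans (≤-reflexive (sym (l-split b))) lb≤))

          q-generated : Generated A c q-part ⟨ q , b ⟩
          q-generated = Generated-sum (λ i j → fromℕ (q i) * fromℤ (M i j)) (λ i → fromℕ (q i) * b i)
              (λ i → Generated-scale (q i) (row i))

        from-outcome : Outcome M b p → Generated A c (vecℤ ℝ p) (vecℤ ℝ p · x)
        from-outcome (infeasible l annihilates lb<0) = ⊥-elim (lb<0 (≤-respˡ-≈
          (trans (⟨,⟩-rows M l 0 p (λ j → trans (annihilates j) (sym (zeroˡ _))) x) (zeroˡ _))
              (⟨,⟩-mono l sol)))
        from-outcome (unbounded beyond) =
          let (y , sol′ , t≤py) = beyond (vecℤ ℝ p · x + 1#) in ⊥-elim
                  (x<x+1 (≤-trans t≤py (normal y sol′)))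
        -- The linear program may return another optimal point y; normality of p at x carries its
        -- certificate over to x.
        from-outcome (optimal y sol′ τ l comb lb≤) =
          from-multiplier τ l comb (≤-trans lb≤ (*-monoˡ-≤ (fromℕ-nonNeg τ) (normal y sol′)))

unit-sym : ∀ {m} (i j : Fin m) → unit i j ≡ unit j i
unit-sym zero    zero    = ≡.refl
unit-sym zero    (suc j) = ≡.refl
unit-sym (suc i) zero    = ≡.refl
unit-sym (suc i) (suc j) = unit-sym i j

unit-diagonal : ∀ {m} (i : Fin m) → unit i i ≡ 1
unit-diagonal zero    = ≡.refl
unit-diagonal (suc i) = unit-diagonal i

-- The box-TDI system

module BoxTDI (ℝ : Reals) where
  open OrderedField ℝ
  open import Data.Vec.Functional using (_++_)
  open LinearProgramming ℝ
  open LConvexity ℝ using (Normal)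
  open L♮Convexity ℝ using (IsSection; isLConvex⇒isSection; isL♮Convex⇒isSection)
  open BoxNormality ℝ
  open Duality ℝ
  open IntegerSystems ℝ

  fromℚ-/1 : ∀ z → fromℚ (z ℚ./ 1) ≈ fromℤ z
  fromℚ-/1 z = trans (sym (trans (*-congʳ fromℤ-1) (*-identityˡ _))) (fromℚ-/ z 1)

  fromℚ-identity : ∀ {n} (i j : Fin n) → fromℚ (identity ℝ n i j) ≈ fromℕ (unit i j)
  fromℚ-identity i j with i Fin.≟ j | unit-value i j
  ... | yes ≡.refl | _              =
      trans fromℚ-1 (trans (sym fromℤ-1) (reflexive (≡.cong fromℕ (≡.sym (unit-diagonal i)))))
  ... | no  i≢j    | inj₁ u≡0       = trans fromℚ-0 (reflexive (≡.cong fromℕ (≡.sym u≡0)))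
  ... | no  i≢j    | inj₂ (i≡j , _) = ⊥-elim (i≢j i≡j)

  module _ {k l n} {A : Vector (Vector ℤ n) k} {B : Vector
      (Vector ℤ n) l} {b : Vector ℚ k} {c : Vector ℚ l} where

    Solvesℤ-++⁻ : ∀ {x} → Solvesℤ (A ++ B) (vecℚ ℝ (b ++ c)) x → Solvesℤ A (vecℚ ℝ b) x × Solvesℤ B
        (vecℚ ℝ c) x
    Solvesℤ-++⁻ {x} sol =
      (λ i → ≡.subst₂ (λ r β → vecℤ ℝ r · x ≤ fromℚ β) (Vector.lookup-++ˡ A B i)
          (Vector.lookup-++ˡ b c i) (sol (i ↑ˡ l))) ,
      (λ i → ≡.subst₂ (λ r β → vecℤ ℝ r · x ≤ fromℚ β) (Vector.lookup-++ʳ A B i)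
          (Vector.lookup-++ʳ b c i) (sol (k ↑ʳ i)))

    Solvesℤ-++⁺ : ∀ {x} → Solvesℤ A (vecℚ ℝ b) x → Solvesℤ B (vecℚ ℝ c) x →
        Solvesℤ (A ++ B) (vecℚ ℝ (b ++ c)) x
    Solvesℤ-++⁺ solA solB i with splitAt k i
    ... | inj₁ i = solA i
    ... | inj₂ i = solB i

  module _ {n} {P P₁ P₂ : Pred (Vector Carrier n) 0ℓ}
           (section₁ : IsSection P₁) (section₂ : IsSection P₂)
           (P≐P₁⊕P₂ : P ≐ _⊕_ ℝ P₁ P₂) {m} (M : Vector (Vector ℤ n) m) (β : Vector ℤ m)
           (P≐ : P ≐ Solvesℤ M (vecℤ ℝ β)) where

    open SupportRows M β

    private
      k : ℕ
      k = m ℕ.+ List.length rows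

      supports : Vector (Vector ℤ n × ℚ) (List.length rows)
      supports i = support (List.lookup rows i)

      -- The rows of M stay next to the support rows: they describe P, and they generate the integer
      -- parts of the dual multipliers.
      A : Vector (Vector ℤ n) k
      A = M ++ (λ i → proj₁ (supports i))

      Aℚ : Vector (Vector ℚ n) k
      Aℚ i j = A i j ℚ./ 1

      bℚ : Vector ℚ k
      bℚ = (λ i → β i ℚ./ 1) ++ (λ i → proj₂ (supports i))

      P⇒A : ∀ {x} → P x → Solvesℤ A (vecℚ ℝ bℚ) x
      P⇒A {x} x∈P = Solvesℤ-++⁺ {A = M} (λ i → ≤-respʳ-≈ (sym (fromℚ-/1 (β i))) (proj₁ P≐ x∈P i))
                                 (λ i → support-valid (List.lookup rows i) x (proj₁ P≐ x∈P))

      A⇒M : ∀ {x} → Solvesℤ A (vecℚ ℝ bℚ) x → Solvesℤ M b x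
      A⇒M sol i = ≤-respʳ-≈ (fromℚ-/1 (β i)) (proj₁ (Solvesℤ-++⁻ {A = M} {b = λ i → β i ℚ./ 1} sol) i)

      A⇒P : ∀ {x} → Solvesℤ A (vecℚ ℝ bℚ) x → P x
      A⇒P sol = proj₂ P≐ (A⇒M sol)

    describes : P ≐ Solutions ℝ (matℚ ℝ Aℚ) (vecℚ ℝ bℚ)
    describes = (λ x∈P → solvesℚ A Aℚ bℚ (λ i j → fromℚ-/1 (A i j)) (P⇒A x∈P)) ,
                (λ sol → A⇒P (solvesℤ A Aℚ bℚ (λ i j → fromℚ-/1 (A i j)) sol))

    module _ (hi lo : Vector ℚ n) where

      private
        I −I : Vector (Vector ℤ n) n
        I  i j = + unit i j
        −I i j = ℤ.- + unit i j

        B : Vector (Vector ℤ n) (k ℕ.+ (n ℕ.+ n))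
        B = A ++ (−I ++ I)

        Bℚ : Vector (Vector ℚ n) (k ℕ.+ (n ℕ.+ n))
        Bℚ = Aℚ ++ ((λ i j → ℚ.- identity ℝ n i j) ++ identity ℝ n)

        cℚ : Vector ℚ (k ℕ.+ (n ℕ.+ n))
        cℚ = bℚ ++ ((λ i → ℚ.- lo i) ++ hi)

        c : Vector Carrier (k ℕ.+ (n ℕ.+ n))
        c = vecℚ ℝ cℚ

        Bℚ≈B : ∀ i j → fromℚ (Bℚ i j) ≈ fromℤ (B i j)
        Bℚ≈B i j with splitAt k i
        ... | inj₁ i = fromℚ-/1 (A i j)
        ... | inj₂ i with splitAt n i
        ...   | inj₁ i = trans (fromℚ-neg (identity ℝ n i j)) (trans (-‿cong (fromℚ-identity i j))
            (sym (fromℤ-neg (+ unit i j))))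
        ...   | inj₂ i = fromℚ-identity i j

        −I·x : ∀ i x → vecℤ ℝ (−I i) · x ≈ - x i
        −I·x i x = trans (vecℤ-neg-∙ (I i) x) (-‿cong (⟨unit,⟩ i x))

        InBox′ : Vector Carrier n → Set
        InBox′ x = ∀ i → fromℚ (lo i) ≤ x i × x i ≤ fromℚ (hi i)

        B⇒P : ∀ {x} → Solvesℤ B c x → P x × InBox′ x
        B⇒P {x} sol =
          let (solA , sol±) = Solvesℤ-++⁻ {A = A} {b = bℚ} sol
              (sol− , sol+) = Solvesℤ-++⁻ {A = −I} {b = λ i → ℚ.- lo i} sol±
          in A⇒P solA , λ i →
             ≤-resp-≈ (-‿involutive _) (-‿involutive _)
                 (neg-mono-≤ (≤-resp-≈ (−I·x i x) (fromℚ-neg (lo i)) (sol− i))) ,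
             ≤-respˡ-≈ (⟨unit,⟩ i x) (sol+ i)

        P⇒B : ∀ {x} → P x → InBox′ x → Solvesℤ B c x
        P⇒B {x} x∈P x∈box = Solvesℤ-++⁺ {A = A} {b = bℚ} (P⇒A x∈P)
            (Solvesℤ-++⁺ {A = −I} {b = λ i → ℚ.- lo i}
          (λ i → ≤-resp-≈ (sym (−I·x i x)) (sym (fromℚ-neg (lo i))) (neg-mono-≤ (proj₁ (x∈box i))))
          (λ i → ≤-respˡ-≈ (sym (⟨unit,⟩ i x)) (proj₂ (x∈box i))))

        Row : Vector ℤ n → ℚ → Set
        Row a β = Generated B c (vecℤ ℝ a) (fromℚ β)

        row-A : ∀ i → Row (A i) (bℚ i)
        row-A i = ≡.subst₂ Row (Vector.lookup-++ˡ A (−I ++ I) i)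
            (Vector.lookup-++ˡ bℚ ((λ i → ℚ.- lo i) ++ hi) i)
                    (Generated-row {A = B} {c} (i ↑ˡ (n ℕ.+ n)))

        row-± : ∀ i → Row ((−I ++ I) i) (((λ i → ℚ.- lo i) ++ hi) i)
        row-± i = ≡.subst₂ Row (Vector.lookup-++ʳ A (−I ++ I) i)
            (Vector.lookup-++ʳ bℚ ((λ i → ℚ.- lo i) ++ hi) i)
                    (Generated-row {A = B} {c} (k ↑ʳ i))

        row-lo : ∀ i → Row (−I i) (ℚ.- lo i)
        row-lo i = ≡.subst₂ Row (Vector.lookup-++ˡ −I I i) (Vector.lookup-++ˡ (λ i → ℚ.- lo i) hi i)
            (row-± (i ↑ˡ n))

        row-hi : ∀ i → Row (I i) (hi i)
        row-hi i = ≡.subst₂ Row (Vector.lookup-++ʳ −I I i) (Vector.lookup-++ʳ (λ i → ℚ.- lo i) hi i)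
            (row-± (n ↑ʳ i))

        row-M : ∀ i → Generated B c (vecℤ ℝ (M i)) (b i)
        row-M i = Generated-resp (λ _ → refl) (≤-reflexive (fromℚ-/1 (β i)))
          (≡.subst₂ Row (Vector.lookup-++ˡ M _ i) (Vector.lookup-++ˡ (λ i → β i ℚ./ 1)
              (λ i → proj₂ (supports i)) i) (row-A (i ↑ˡ List.length rows)))

        row-supports : ∀ i → Row (proj₁ (supports i)) (proj₂ (supports i))
        row-supports i = ≡.subst₂ Row (Vector.lookup-++ʳ M (λ i → proj₁ (supports i)) i)
          (Vector.lookup-++ʳ (λ i → β i ℚ./ 1) (λ i → proj₂ (supports i)) i) (row-A (m ↑ʳ i))

        row-support : ∀ {a} → a ∈ rows → Row (proj₁ (support a)) (proj₂ (support a))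
        row-support a∈ = ≡.subst (λ a → Row (proj₁ (support a)) (proj₂ (support a)))
            (≡.sym (lookup-index a∈)) (row-supports (index a∈))

        -- The sign of e selects the bound: the row of `hi` for positive e, that of `lo` for
        -- negative e. Since the selected bound is tight, the cost is e times x.
        box-generated : ∀ i e x → (e ℤ.≰ 0ℤ → fromℚ (hi i) ≤ x) → (0ℤ ℤ.≰ e → x ≤ fromℚ (lo i)) →
                        Generated B c (λ j → fromℤ e * fromℕ (unit i j)) (fromℤ e * x)
        box-generated i (+ zero)  x _ _ = Generated-resp (λ j → sym (zeroˡ _))
            (≤-reflexive (sym (zeroˡ x))) Generated-0
        box-generated i (+ suc e) x hi≤x _ = Generated-resp (λ j → refl)
          (*-monoˡ-≤ (fromℕ-nonNeg (suc e)) (hi≤x λ { (ℤ.+≤+ ()) }))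
              (Generated-scale (suc e) (row-hi i))
        box-generated i -[1+ e ]  x _ x≤lo = Generated-resp
          (λ j → trans (*-congˡ (fromℤ-neg (+ unit i j))) (swap-neg _ _))
          (≤-respʳ-≈ (swap-neg (fromℕ (suc e)) x) (*-monoˡ-≤ (fromℕ-nonNeg (suc e))
            (≤-respˡ-≈ (sym (fromℚ-neg (lo i))) (neg-mono-≤ (x≤lo λ ())))))
          (Generated-scale (suc e) (row-lo i))
          where
          swap-neg : ∀ x y → x * - y ≈ - x * y
          swap-neg x y = trans (sym (-‿distribʳ-* x y)) (-‿distribˡ-* x y)

        maximizer-generates : ∀ w x → Solvesℤ B c x →
            (∀ y → Solvesℤ B c y → vecℤ ℝ w · y ≤ vecℤ ℝ w · x) →
                              Generated B c (vecℤ ℝ w) (vecℤ ℝ w · x)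
        maximizer-generates w x sol maximal =
          Generated-resp (λ j → trans (+-congˡ (sum-units j)) (restore j))
              (≤-reflexive (trans (sym (∑-distrib-+ (λ j → fromℤ (p j) * x j)
              (λ j → fromℤ (e j) * x j)))
              (sum-cong-≋ (λ j → trans (sym (distribʳ (x j) _ _)) (*-congʳ (restore j))))))
            (Generated-+ (normal-generated {A = B} {c} row-M row-support p x (proj₁ P≐ x∈P) (λ y sol′ →
                p-normal y (proj₂ P≐ sol′)))
              (Generated-sum (λ i j → fromℤ (e i) * fromℕ (unit i j)) (λ i → fromℤ (e i) * x i)
                  (λ i → box-generated i (e i) (x i)
                (λ e≰0 → ≤-stable λ x<hi → e≰0 (ℤ.i≤j⇒i-j≤0 (below-hi i x<hi)))
                (λ 0≰e → ≤-stable λ lo<x → 0≰e (ℤ.i≤j⇒0≤j-i (above-lo i lo<x))))))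
          where
          x∈P : P x
          x∈P = proj₁ (B⇒P sol)
          normal = box-normal section₁ section₂ P≐P₁⊕P₂ (vecℚ ℝ lo) (vecℚ ℝ hi) w x x∈P
              (proj₂ (B⇒P sol))
                     (λ y y∈P y∈box → maximal y (P⇒B y∈P y∈box))
          p e : Vector ℤ n
          p = proj₁ normal
          e i = w i ℤ.- p i
          p-normal : Normal P x p
          p-normal = proj₁ (proj₂ normal)
          below-hi : ∀ i → x i < fromℚ (hi i) → w i ℤ.≤ p i
          below-hi = proj₁ (proj₂ (proj₂ normal))
          above-lo : ∀ i → fromℚ (lo i) < x i → p i ℤ.≤ w i
          above-lo = proj₂ (proj₂ (proj₂ normal))
          sum-units : ∀ j → sum (λ i → fromℤ (e i) * fromℕ (unit i j)) ≈ fromℤ (e j)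
          sum-units j = trans (sum-cong-≋
              (λ i → trans (*-congˡ (reflexive (≡.cong fromℕ (unit-sym i j)))) (*-comm _ _)))
                              (⟨unit,⟩ j (vecℤ ℝ e))
          restore : ∀ j → fromℤ (p j) + fromℤ (e j) ≈ fromℤ (w j)
          restore j = trans (+-congˡ (trans (fromℤ-+ (w j) (ℤ.- p j)) (+-congˡ (fromℤ-neg (p j)))))
                            (x+[y-x]≈y (fromℤ (p j)) (fromℤ (w j)))

      boxed-isTDI : IsTDI ℝ Bℚ cℚ
      boxed-isTDI = isTDI B Bℚ cℚ Bℚ≈B maximizer-generates

    isBoxTDIPolyhedron : IsBoxTDIPolyhedron ℝ P
    isBoxTDIPolyhedron = k , Aℚ , bℚ , describes , boxed-isTDI

  sum-isBoxTDIPolyhedron : ∀ {n} {P P₁ P₂ : Pred (Vector Carrier n) 0ℓ} → IsRationalPolyhedron ℝ P →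
                           IsSection P₁ → IsSection P₂ → P ≐ _⊕_ ℝ P₁ P₂ → IsBoxTDIPolyhedron ℝ P
  sum-isBoxTDIPolyhedron (_ , A , b , P⊆ , ⊆P) section₁ section₂ P≐P₁⊕P₂ =
    let (M , β , to , from) = integer-system A b
    in isBoxTDIPolyhedron section₁ section₂ P≐P₁⊕P₂ M β
         ((λ {x} x∈P → to x (P⊆ x∈P)) , (λ {x} sol → ⊆P (from x sol)))

theorem5p1 : (ℝ : Reals) (n : ℕ) (P : Pred (Vector (Reals.Carrier ℝ) n) 0ℓ) →
    IsRationalPolyhedron ℝ P →
    (IsL₂Convex ℝ P → IsBoxTDIPolyhedron ℝ P) ×
    (IsL♮₂Convex ℝ P → IsBoxTDIPolyhedron ℝ P)
theorem5p1 ℝ n P rational =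
  (λ (_ , _ , _ , L₁ , L₂ , P≐) → sum-isBoxTDIPolyhedron rational (isLConvex⇒isSection L₁)
      (isLConvex⇒isSection L₂) P≐) ,
  (λ (_ , _ , _ , L₁ , L₂ , P≐) → sum-isBoxTDIPolyhedron rational (isL♮Convex⇒isSection L₁)
      (isL♮Convex⇒isSection L₂) P≐)
  where
  open BoxTDI ℝ
  open L♮Convexity ℝ
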